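{- Let $\Gamma$ be a connected cubic girth-regular graph of girth $g$ with $g\le 5$. Then either the signature of $\Gamma$ is $(0,1,1)$ and $\Gamma$ is isomorphic to the truncation $\mathrm{Tr}(\Lambda,\leftrightarrow)$ of a dihedral scheme $\leftrightarrow$ on some $g$-regular graph $\Lambda$ (possibly with parallel edges), or one of the following occurs: (1) $g=3$ and $\Gamma\cong K_4$, with signature $(2,2,2)$; (2) $g=4$ and $\Gamma$ is isomorphic to a prism $Y_n$ or to a Möbius ladder $M_n$ for some $n$, with signature $(4,4,4)$ if $\Gamma\cong K_{3,3}$, signature $(2,2,2)$ if $\Gamma$ is isomorphic to the cube $Q_3$, and signature $(1,1,2)$ otherwise; (3) $g=5$ and $\Gamma$ is isomorphic to the Petersen graph, with signature $(4,4,4)$, or to the dodecahedron graph, with signature $(2,2,2)$.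
   Context: $\Gamma$ is a finite simple graph. For a graph of finite girth $g$, a girth cycle is a cycle of length $g$, and $\epsilon(e)$ is the number of girth cycles containing the edge $e$. The signature of a vertex $v$ with incident edges $e_1,\ldots,e_k$ ordered so that $\epsilon(e_1)\le\cdots\le\epsilon(e_k)$ is $(\epsilon(e_1),\ldots,\epsilon(e_k))$; a graph is girth-regular if all vertices have the same signature (the signature of the graph). Cubic means $3$-regular. A graph with parallel edges and loops is a triple $(V,E,\partial)$ with $\partial:E\to\{X\subseteq V:|X|\le 2\}$ giving the end-vertices of each edge. Each edge consists of two mutually inverse arcs, each having one end-vertex as its tail; $A(\Lambda)$ is the set of arcs and $\mathrm{out}(u)$ the set of arcs with tail $u$; the valence of $u$ is $|\mathrm{out}(u)|$. A dihedral scheme on $\Lambda$ is an irreflexive symmetric relation $\leftrightarrow$ on $A(\Lambda)$ such that the simple graph $(A(\Lambda),\leftrightarrow)$ is $2$-regular and its connected components are exactly the sets $\mathrm{out}(u)$, $u\in V$. The truncation $\mathrm{Tr}(\Lambda,\leftrightarrow)$ is the simple graph with vertex set $A(\Lambda)$ in which arcs $s,t$ are adjacent iff $s\leftrightarrow t$ or $s,t$ are inverse to each other. For $n\ge3$, the Möbius ladder $M_n$ is the Cayley graph $\mathrm{Cay}(\mathbb{Z}_{2n},\{ -1,1,n\})$, and the prism $Y_n$ is the Cartesian product $C_n\,\square\,K_2$. -}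

module Defs where

open import Data.Nat using (ℕ; zero; suc; _+_; _*_; _∸_; _≤_; _<ᵇ_)
open import Data.Bool using (Bool; true; false; not; _∧_; T; if_then_else_)
open import Data.Fin using (Fin; toℕ; _≟_)
open import Data.List using (List; []; _∷_; length; map; filterᵇ; allFin; concatMap)
open import Data.Bool.ListAction using (any)
open import Data.List.Relation.Binary.Permutation.Propositional using (_↭_)
open import Data.Product using (Σ; ∃; _×_; _,_; proj₁; proj₂)
open import Data.Sum using (_⊎_)
open import Relation.Nullary using (¬_; ⌊_⌋)
open import Relation.Binary.PropositionalEquality using (_≡_; _≢_)
open import Relation.Binary.Construct.Closure.ReflexiveTransitive using (Star)
open import Function.Definitions using (Bijective)
open import Function.Bundles using (_⇔_)

record Graph (n : ℕ) : Set where
  field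
    adj    : Fin n → Fin n → Bool
    sym    : ∀ x y → adj x y ≡ adj y x
    irrefl : ∀ x → adj x x ≡ false

module _ {n : ℕ} (Γ : Graph n) where
  open Graph Γ

  Connected : Set
  Connected = ∀ x y → Star (λ u v → T (adj u v)) x y

  neighbours : Fin n → List (Fin n)
  neighbours v = filterᵇ (adj v) (allFin n)

  Cubic : Set
  Cubic = ∀ v → length (neighbours v) ≡ 3

  distinct : List (Fin n) → Bool
  distinct []       = true
  distinct (x ∷ xs) = not (any (λ y → ⌊ x ≟ y ⌋) xs) ∧ distinct xs

  closesAt : Fin n → List (Fin n) → Bool
  closesAt first []           = false
  closesAt first (x ∷ [])     = adj x first
  closesAt first (x ∷ y ∷ xs) = adj x y ∧ closesAt first (y ∷ xs)

  atLeast3 : List (Fin n) → Bool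
  atLeast3 (_ ∷ _ ∷ _ ∷ _) = true
  atLeast3 _               = false

  isCycle : List (Fin n) → Bool
  isCycle []       = false
  isCycle (x ∷ xs) = atLeast3 (x ∷ xs) ∧ distinct (x ∷ xs) ∧ closesAt x (x ∷ xs)

  IsGirth : ℕ → Set
  IsGirth g = (Σ (List (Fin n)) λ xs → length xs ≡ g × T (isCycle xs))
            × (∀ xs → T (isCycle xs) → g ≤ length xs)

  lists : ℕ → List (List (Fin n))
  lists zero    = [] ∷ []
  lists (suc k) = concatMap (λ x → map (x ∷_) (lists k)) (allFin n)

  -- ε(uv) for girth g: number of g-cycles through the edge uv.
  -- Each g-cycle through uv corresponds to exactly one list
  -- (u , v , v₂ , … , v_{g-1}) that is a cycle.
  ε : ℕ → Fin n → Fin n → ℕ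
  ε g u v = length (filterᵇ (λ xs → isCycle (u ∷ v ∷ xs)) (lists (g ∸ 2)))

  SignatureAt : ℕ → Fin n → ℕ → ℕ → ℕ → Set
  SignatureAt g v a b c =
    (map (ε g v) (neighbours v) ↭ (a ∷ b ∷ c ∷ [])) × a ≤ b × b ≤ c

  GirthRegularWith : ℕ → ℕ → ℕ → ℕ → Set
  GirthRegularWith g a b c = ∀ v → SignatureAt g v a b c

  IsoTo : (A : Set) → (A → A → Set) → Set
  IsoTo A R = Σ (Fin n → A) λ f → Bijective _≡_ _≡_ f
              × (∀ x y → (T (adj x y) ⇔ R (f x) (f y)))

-- Graphs with parallel edges and loops: V = Fin nv, E = Fin ne.
-- Edge e consists of the arcs (e , false) and (e , true), mutually inverse;
-- the tail of (e , b) is  ends e b , so ∂ e = { ends e false , ends e true }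
-- (a loop when the two coincide).

record MultiGraph : Set where
  field
    nv ne : ℕ
    ends  : Fin ne → Bool → Fin nv

module _ (Λ : MultiGraph) where
  open MultiGraph Λ

  Arc : Set
  Arc = Fin ne × Bool

  tail : Arc → Fin nv
  tail (e , b) = ends e b

  inv : Arc → Arc
  inv (e , b) = (e , not b)

  arcs : List Arc
  arcs = concatMap (λ e → (e , false) ∷ (e , true) ∷ []) (allFin ne)

  valence : Fin nv → ℕ
  valence u = length (filterᵇ (λ s → ⌊ tail s ≟ u ⌋) arcs)

  Regular : ℕ → Set
  Regular k = ∀ u → valence u ≡ k

  -- dihedral scheme: irreflexive symmetric relation on arcs whose graph is
  -- 2-regular with connected components exactly the sets out(u)
  IsDihedralScheme : (Arc → Arc → Set) → Set
  IsDihedralScheme R =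
      (∀ s → ¬ R s s)
    × (∀ s t → R s t → R t s)
    × (∀ s → Σ Arc λ t₁ → Σ Arc λ t₂ → t₁ ≢ t₂ × R s t₁ × R s t₂
             × (∀ t → R s t → t ≡ t₁ ⊎ t ≡ t₂))
    × (∀ s t → R s t → tail s ≡ tail t)
    × (∀ s t → tail s ≡ tail t → Star R s t)
    × (∀ u → Σ Arc λ s → tail s ≡ u)

  TrAdj : (Arc → Arc → Set) → Arc → Arc → Set
  TrAdj R s t = R s t ⊎ t ≡ inv s

-- x ≡ y + d  (mod N), for x , y < N and d < N
AddMod : (N : ℕ) → Fin N → Fin N → ℕ → Set
AddMod N x y d = (toℕ y + d ≡ toℕ x) ⊎ (toℕ y + d ≡ toℕ x + N)

CycAdj : (m : ℕ) → Fin m → Fin m → Set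
CycAdj m x y = AddMod m y x 1 ⊎ AddMod m x y 1

K4Adj : Fin 4 → Fin 4 → Set
K4Adj x y = x ≢ y

K33Adj : Bool × Fin 3 → Bool × Fin 3 → Set
K33Adj (b , _) (b' , _) = b ≢ b'

Q3 : Set
Q3 = Bool × Bool × Bool

diffB : Bool → Bool → ℕ
diffB true  false = 1
diffB false true  = 1
diffB _     _     = 0

Q3Adj : Q3 → Q3 → Set
Q3Adj (a , b , c) (a' , b' , c') = diffB a a' + diffB b b' + diffB c c' ≡ 1

PrismAdj : (m : ℕ) → Fin m × Bool → Fin m × Bool → Set
PrismAdj m (i , b) (j , b') = (i ≡ j × b ≢ b') ⊎ (b ≡ b' × CycAdj m i j)

-- Möbius ladder M_m = Cay(Z_{2m}, {-1, 1, m})  (x ~ y iff y - x ∈ S)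
MobiusAdj : (m : ℕ) → Fin (2 * m) → Fin (2 * m) → Set
MobiusAdj m x y = AddMod (2 * m) y x 1 ⊎ AddMod (2 * m) x y 1 ⊎ AddMod (2 * m) y x m

-- Petersen graph: Kneser graph K(5,2) (2-subsets {i<j} of Fin 5, adjacent iff disjoint)
Pet : Set
Pet = Σ (Fin 5 × Fin 5) λ p → T (toℕ (proj₁ p) <ᵇ toℕ (proj₂ p))

PetAdj : Pet → Pet → Set
PetAdj ((i , j) , _) ((k , l) , _) = i ≢ k × i ≢ l × j ≢ k × j ≢ l

-- dodecahedron graph, as the generalized Petersen graph GP(10,2):
-- outer cycle (i , false) ~ (i±1 , false), spokes (i , false) ~ (i , true),
-- inner (i , true) ~ (i±2 , true)   (indices mod 10)
DodAdj : Fin 10 × Bool → Fin 10 × Bool → Set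
DodAdj (i , false) (j , false) = CycAdj 10 i j
DodAdj (i , false) (j , true)  = i ≡ j
DodAdj (i , true)  (j , false) = i ≡ j
DodAdj (i , true)  (j , true)  = AddMod 10 j i 2 ⊎ AddMod 10 i j 2

{-# OPTIONS --safe #-}
-- Write X u v w for the number of girth cycles through the 2-path u v w.  If p, q, r are the neighbours
-- of v, then ε(vp) = X p v q + X p v r, and cyclically; so the signature is equivalent to the sorted
-- triple x ≤ y ≤ z of the numbers X at a vertex, which is the same at all vertices, and z ≤ 2 for g ≤ 5.
-- The triple (0,0,1) says that every vertex lies on exactly one girth cycle: contracting these cycles
-- exhibits Γ as a truncation.  The remaining triples are either contradictory, by looking at the
-- neighbours of v and using that ε does not depend on the orientation of an edge, or determine the
-- adjacencies around v.  In the latter case a map from the target graph to Γ is built which is bijective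
-- on neighbourhoods; it is onto because Γ is connected, and injective because two vertices of the target
-- with the same image would yield a cycle shorter than g or a second girth cycle through some 2-path.
-- For g = 4 and (0,1,1), the edges lying on two 4-cycles form a perfect matching whose involution is an
-- automorphism; deleting it leaves one or two cycles, hence a Möbius ladder or a prism.

module Submission where

open import Defs
open import Data.Nat using (ℕ; zero; suc; _+_; _*_; _∸_; _≤_; _<_; z≤n; s≤s)
import Data.Nat as ℕ
import Data.Nat.Properties as ℕₚ
open import Data.Nat.Induction using (<-rec)
open import Data.Nat.Tactic.RingSolver using (solve-∀)
open import Data.Bool using (Bool; true; false; not; _∧_; T)
import Data.Bool as Bool
open import Data.Bool.ListAction using (any)
open import Data.Bool.Properties using (T-∧; T-∨; T?; T-irrelevant)
open import Data.Empty using (⊥; ⊥-elim)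
open import Data.Unit using (tt)
open import Data.Product using (Σ; ∃; ∃₂; _×_; _,_; proj₁; proj₂)
open import Data.Product.Properties using (≡-dec)
open import Data.Sum using (_⊎_; inj₁; inj₂; [_,_]′)
open import Data.Fin using (Fin; zero; suc; toℕ; fromℕ<; _≟_)
open import Data.Fin.Patterns
open import Data.Fin.Properties using (all?; any?; toℕ-injective; toℕ<n; toℕ-fromℕ<; pigeonhole)
open import Data.Vec using (Vec; []; _∷_; lookup)
open import Data.List using (List; []; _∷_; length; map; filterᵇ; allFin; concatMap; _++_)
import Data.List as List
open import Data.List.Properties using (length-++; length-map; ∷-injectiveˡ; ∷-injectiveʳ; filter-≐)
import Data.List.Properties as Listₚ
open import Data.List.Membership.Propositional using (_∈_)
open import Data.List.Membership.Propositional.Properties using (∈-filter⁺; ∈-filter⁻; ∈-allFin; ∈-∃++; ∈-map⁺; ∈-map⁻; ∈-concatMap⁺; ∈-concatMap⁻; ∈-++⁺ˡ; ∈-++⁺ʳ; ∈-++⁻; ∈-lookup; ∈-deduplicate⁺; ∈-deduplicate⁻)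
import Data.List.Membership.DecPropositional as DecMembership
open import Data.List.Relation.Unary.All using (All; []; _∷_)
import Data.List.Relation.Unary.All as All
open import Data.List.Relation.Unary.AllPairs using ([]; _∷_)
open import Data.List.Relation.Unary.Any using (Any; here; there)
import Data.List.Relation.Unary.Any as Any
open import Data.List.Relation.Unary.Any.Properties using (lookup-index)
open import Data.List.Relation.Unary.Unique.Propositional using (Unique)
import Data.List.Relation.Unary.Unique.Propositional.Properties as Uniqueₚ
import Data.List.Relation.Unary.Unique.DecPropositional.Properties as DecUniqueₚ
open import Data.List.Relation.Binary.Permutation.Propositional using (_↭_; ↭-sym; ↭⇒↭ₛ)
open import Data.List.Relation.Binary.Permutation.Propositional.Properties using (↭-map-inv; ∈-resp-↭)
import Data.List.Relation.Binary.Permutation.Setoid.Properties as Permₛ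
open import Function using (_∘_; id; case_of_)
open import Function.Bundles using (Equivalence; _⇔_; mk⇔)
open import Function.Construct.Symmetry using (⇔-sym)
open import Relation.Nullary using (¬_; Dec; yes; no; ⌊_⌋; contradiction)
open import Relation.Nullary.Decidable using (toWitness; fromWitness; from-yes; from-no; _×-dec_; _⊎-dec_; _→-dec_; ¬?)
open import Relation.Binary.Definitions using (tri<; tri≈; tri>)
open import Relation.Binary.PropositionalEquality
open import Relation.Binary.Construct.Closure.ReflexiveTransitive using (Star; _◅_; _◅◅_; gmap; reverse) renaming (ε to ε⋆)

-- The bound on `g` acts through the path of length `g − 3` that closes `u v w` and a next vertex
-- `s` to a girth cycle: having length at most two, it is determined by its ends, for `g = 5`
-- because there are no 4-cycles. So a corner counts the admissible `s` among two candidates, which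
-- gives `z ≤ 2` and leaves ten triples, of which `(0,0,0)` would mean that there is no girth cycle.
-- The two corners along an edge have the same sum at both ends of the edge. Hence an edge whose
-- value of ε occurs only once at its ends is singled out from both sides, and such edges form a
-- perfect matching. This yields the involution for `(0,0,1)` and `(0,1,1)`, and it carries large or
-- small corners across edges for `(1,1,2)` and `(1,2,2)` in girth five, the two triples that do not
-- fall to counting alone and need a chase through the vertices near `v`.

private
  variable
    A B : Set

-- Counting

-- Pigeonhole for a relation, since the partner of an element is often only known to exist. Each
-- step removes the partner `y` of the head from `ys`; injectivity keeps the partners of the tail
-- available.
length≤ : (R : A → B → Set) {xs : List A} (ys : List B) → Unique xs
  → (∀ {x} → x ∈ xs → ∃ λ y → y ∈ ys × R x y)
  → (∀ {x x′ y} → x ∈ xs → x′ ∈ xs → R x y → R x′ y → x ≡ x′)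
  → length xs ≤ length ys
length≤ R {[]} ys _ _ _ = z≤n
length≤ R {x ∷ xs} ys (x∉ ∷ uniq) into inj with into (here refl)
... | y , y∈ , xRy with ∈-∃++ y∈
... | ls , rs , refl = subst (suc (length xs) ≤_) (sym len)
      (s≤s (length≤ R (ls ++ rs) uniq into′ (λ p q → inj (there p) (there q))))
  where
  len : length (ls ++ y ∷ rs) ≡ suc (length (ls ++ rs))
  len = trans (length-++ ls) (trans (ℕₚ.+-suc (length ls) (length rs)) (cong suc (sym (length-++ ls))))
  into′ : ∀ {x′} → x′ ∈ xs → ∃ λ y′ → y′ ∈ (ls ++ rs) × R x′ y′
  into′ {x′} x′∈ with into (there x′∈)
  ... | y′ , y′∈ , x′Ry′ with ∈-++⁻ ls y′∈
  ... | inj₁ l = y′ , ∈-++⁺ˡ l , x′Ry′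
  ... | inj₂ (there r) = y′ , ∈-++⁺ʳ ls r , x′Ry′
  ... | inj₂ (here refl) = contradiction (inj (here refl) (there x′∈) xRy x′Ry′) (All.lookup x∉ x′∈)

length≡ : {xs ys : List A} → Unique xs → Unique ys
  → (∀ {x} → x ∈ xs → x ∈ ys) → (∀ {x} → x ∈ ys → x ∈ xs) → length xs ≡ length ys
length≡ {xs = xs} {ys} ux uy f g = ℕₚ.≤-antisym
  (length≤ _≡_ ys ux (λ p → _ , f p , refl) (λ _ _ p q → trans p (sym q)))
  (length≤ _≡_ xs uy (λ p → _ , g p , refl) (λ _ _ p q → trans p (sym q)))

∈-filterᵇ⁺ : (p : A → Bool) {x : A} {xs : List A} → x ∈ xs → T (p x) → x ∈ filterᵇ p xs
∈-filterᵇ⁺ p = ∈-filter⁺ (T? ∘ p)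

∈-filterᵇ⁻ : (p : A → Bool) {x : A} {xs : List A} → x ∈ filterᵇ p xs → x ∈ xs × T (p x)
∈-filterᵇ⁻ p {xs = xs} = ∈-filter⁻ (T? ∘ p) {xs = xs}

Unique-filterᵇ : (p : A → Bool) {xs : List A} → Unique xs → Unique (filterᵇ p xs)
Unique-filterᵇ p = Uniqueₚ.filter⁺ (T? ∘ p)

∈-concatMap : (f : A → List B) {y : B} {x : A} {xs : List A} → x ∈ xs → y ∈ f x → y ∈ concatMap f xs
∈-concatMap f x∈ y∈ = ∈-concatMap⁺ f (go x∈ y∈)
  where
  go : ∀ {x xs y} → x ∈ xs → y ∈ f x → Any (λ x → y ∈ f x) xs
  go (here refl) y∈ = here y∈
  go (there p) y∈ = there (go p y∈)

Unique-concatMap : (f : A → List B) {xs : List A} → Unique xs → (∀ x → Unique (f x))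
  → (∀ {x x′ y} → y ∈ f x → y ∈ f x′ → x ≡ x′) → Unique (concatMap f xs)
Unique-concatMap f {[]} _ _ _ = []
Unique-concatMap f {x ∷ xs} (x∉ ∷ u) uf disj =
  Uniqueₚ.++⁺ (uf x) (Unique-concatMap f u uf disj) λ (y∈ , y∈′) → go x∉ y∈ (∈-concatMap⁻ f {xs = xs} y∈′)
  where
  go : ∀ {ys y} → All (x ≢_) ys → y ∈ f x → Any (λ x → y ∈ f x) ys → ⊥
  go (x≢ ∷ _) y∈ (here y∈′) = x≢ (disj y∈ y∈′)
  go (_ ∷ x∉) y∈ (there p) = go x∉ y∈ p

T⇒true : {b : Bool} → T b → b ≡ true
T⇒true {true} _ = refl

¬T⇒false : {b : Bool} → ¬ T b → b ≡ false
¬T⇒false {true} ¬b = ⊥-elim (¬b tt)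
¬T⇒false {false} _ = refl

true⇒T : {b : Bool} → b ≡ true → T b
true⇒T refl = tt

T-ext : {b c : Bool} → (T b → T c) → (T c → T b) → b ≡ c
T-ext {true} {c} f g = sym (T⇒true (f tt))
T-ext {false} {c} f g = sym (¬T⇒false g)

∧-T : {b c : Bool} → T b → T c → T (b ∧ c)
∧-T p q = Equivalence.from T-∧ (p , q)

T-∧₁ : {b c : Bool} → T (b ∧ c) → T b
T-∧₁ {true} p = tt

T-∧₂ : {b c : Bool} → T (b ∧ c) → T c
T-∧₂ {true} p = p

T-not : {b : Bool} → ¬ T b → T (not b)
T-not {true} p = p tt
T-not {false} p = tt

not-T : {b : Bool} → T (not b) → ¬ T b
not-T {false} _ ()

⟦_⟧ : Bool → ℕ
⟦ true ⟧ = 1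
⟦ false ⟧ = 0

length-filterᵇ₂ : (p : A → Bool) (s t : A) → length (filterᵇ p (s ∷ t ∷ [])) ≡ ⟦ p s ⟧ + ⟦ p t ⟧
length-filterᵇ₂ p s t with p s
... | true with p t
...   | true  = refl
...   | false = refl
length-filterᵇ₂ p s t | false with p t
...   | true  = refl
...   | false = refl

T-any⁺ : (p : A → Bool) {x : A} {xs : List A} → x ∈ xs → T (p x) → T (any p xs)
T-any⁺ p (here refl) px = Equivalence.from T-∨ (inj₁ px)
T-any⁺ p (there x∈) px = Equivalence.from T-∨ (inj₂ (T-any⁺ p x∈ px))

T-any⁻ : (p : A → Bool) (xs : List A) → T (any p xs) → ∃ λ x → x ∈ xs × T (p x)
T-any⁻ p (x ∷ xs) h with Equivalence.to (T-∨ {p x}) h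
... | inj₁ px = x , here refl , px
... | inj₂ h′ with T-any⁻ p xs h′
... | y , y∈ , py = y , there y∈ , py

-- Neighbourhoods in a cubic graph

module Cub {n : ℕ} (Γ : Graph n) (cubic : Cubic Γ) where
  open Graph Γ using (adj; irrefl) renaming (sym to adj-sym)

  infix 4 _~_
  _~_ : Fin n → Fin n → Set
  u ~ v = T (adj u v)

  abstract
    ~-sym : ∀ {u v} → u ~ v → v ~ u
    ~-sym {u} {v} = subst T (adj-sym u v)

    ~⇒≢ : ∀ {u v} → u ~ v → u ≢ v
    ~⇒≢ {u} u~u refl = subst T (irrefl u) u~u

  record Nbrs (v p q r : Fin n) : Set where
    constructor nbrs
    field
      ~p : v ~ p
      ~q : v ~ q
      ~r : v ~ r
      p≢q : p ≢ q
      p≢r : p ≢ r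
      q≢r : q ≢ r
      only : ∀ {t} → v ~ t → t ≡ p ⊎ t ≡ q ⊎ t ≡ r

  swap₁₂ : ∀ {v p q r} → Nbrs v p q r → Nbrs v q p r
  swap₁₂ (nbrs a b c d e f o) = nbrs b a c (d ∘ sym) f e λ h → case o h of λ where
    (inj₁ x) → inj₂ (inj₁ x)
    (inj₂ (inj₁ x)) → inj₁ x
    (inj₂ (inj₂ x)) → inj₂ (inj₂ x)

  swap₂₃ : ∀ {v p q r} → Nbrs v p q r → Nbrs v p r q
  swap₂₃ (nbrs a b c d e f o) = nbrs a c b e d (f ∘ sym) λ h → case o h of λ where
    (inj₁ x) → inj₁ x
    (inj₂ (inj₁ x)) → inj₂ (inj₂ x)
    (inj₂ (inj₂ x)) → inj₂ (inj₁ x)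

  swap₁₃ : ∀ {v p q r} → Nbrs v p q r → Nbrs v r q p
  swap₁₃ = swap₁₂ ∘ swap₂₃ ∘ swap₁₂

  rot : ∀ {v p q r} → Nbrs v p q r → Nbrs v q r p
  rot = swap₂₃ ∘ swap₁₂

  rot² : ∀ {v p q r} → Nbrs v p q r → Nbrs v r p q
  rot² = rot ∘ rot

  abstract
    Unique-neighbours : ∀ v → Unique (neighbours Γ v)
    Unique-neighbours v = Unique-filterᵇ (adj v) (Uniqueₚ.allFin⁺ n)

    ~⇒∈ : ∀ {v t} → v ~ t → t ∈ neighbours Γ v
    ~⇒∈ {v} {t} = ∈-filterᵇ⁺ (adj v) (∈-allFin t)

    ∈⇒~ : ∀ {v t} → t ∈ neighbours Γ v → v ~ t
    ∈⇒~ {v} t∈ = proj₂ (∈-filterᵇ⁻ (adj v) {xs = allFin n} t∈)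

    ↭⇒Nbrs : ∀ {v p q r} → neighbours Γ v ↭ p ∷ q ∷ r ∷ [] → Nbrs v p q r
    ↭⇒Nbrs {v} {p} {q} {r} π with Permₛ.Unique-resp-↭ (setoid (Fin n)) (↭⇒↭ₛ π) (Unique-neighbours v)
    ... | (p≢q ∷ p≢r ∷ []) ∷ (q≢r ∷ []) ∷ _ = nbrs (in′ (here refl)) (in′ (there (here refl)))
           (in′ (there (there (here refl)))) p≢q p≢r q≢r only
      where
      in′ : ∀ {t} → t ∈ p ∷ q ∷ r ∷ [] → v ~ t
      in′ t∈ = ∈⇒~ (∈-resp-↭ (↭-sym π) t∈)
      only : ∀ {t} → v ~ t → t ≡ p ⊎ t ≡ q ⊎ t ≡ r
      only v~t with ∈-resp-↭ π (~⇒∈ v~t)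
      ... | here e = inj₁ e
      ... | there (here e) = inj₂ (inj₁ e)
      ... | there (there (here e)) = inj₂ (inj₂ e)

    nbrs₀ : ∀ v → ∃ λ p → ∃ λ q → ∃ λ r → Nbrs v p q r
    nbrs₀ v with neighbours Γ v | ↭⇒Nbrs {v} | cubic v
    ... | p ∷ q ∷ r ∷ [] | f | _ = p , q , r , f _↭_.refl

    nbrs₁ : ∀ {v p} → v ~ p → ∃ λ q → ∃ λ r → Nbrs v p q r
    nbrs₁ {v} v~p with nbrs₀ v
    ... | a , b , c , N with Nbrs.only N v~p
    ... | inj₁ refl = b , c , N
    ... | inj₂ (inj₁ refl) = a , c , swap₁₂ N
    ... | inj₂ (inj₂ refl) = a , b , rot² N

    nbrs₂ : ∀ {v p q} → v ~ p → v ~ q → p ≢ q → ∃ λ r → Nbrs v p q r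
    nbrs₂ v~p v~q p≢q with nbrs₁ v~p
    ... | b , c , N with Nbrs.only N v~q
    ... | inj₁ refl = contradiction refl p≢q
    ... | inj₂ (inj₁ refl) = c , N
    ... | inj₂ (inj₂ refl) = b , swap₂₃ N

    nbrs₃ : ∀ {v p q r} → v ~ p → v ~ q → v ~ r → p ≢ q → p ≢ r → q ≢ r → Nbrs v p q r
    nbrs₃ v~p v~q v~r p≢q p≢r q≢r with nbrs₂ v~p v~q p≢q
    ... | c , N with Nbrs.only N v~r
    ... | inj₁ refl = contradiction refl p≢r
    ... | inj₂ (inj₁ refl) = contradiction refl q≢r
    ... | inj₂ (inj₂ refl) = N

    only₂ : ∀ {v p q r t} → Nbrs v p q r → v ~ t → t ≢ p → t ≡ q ⊎ t ≡ r
    only₂ N v~t t≢p with Nbrs.only N v~t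
    ... | inj₁ e = contradiction e t≢p
    ... | inj₂ e = e

    only₁ : ∀ {v p q r t} → Nbrs v p q r → v ~ t → t ≢ p → t ≢ q → t ≡ r
    only₁ N v~t t≢p t≢q with only₂ N v~t t≢p
    ... | inj₁ e = contradiction e t≢q
    ... | inj₂ e = e

  -- If κ s u tells whether u and s are joined by a path of length g − 3, then
  -- X u v w is the number of girth cycles through the 2-path u v w.
  module Corner (κ : Fin n → Fin n → Bool) where

    abstract
      X : Fin n → Fin n → Fin n → ℕ
      X u v w = length (filterᵇ (λ s → κ s u ∧ not ⌊ s ≟ v ⌋) (neighbours Γ w))

      X≡ : ∀ {v w s t} u → Nbrs w v s t → X u v w ≡ ⟦ κ s u ⟧ + ⟦ κ t u ⟧
      X≡ {v} {w} {s} {t} u N = trans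
        (length≡ (Unique-filterᵇ _ (Unique-neighbours w)) (Unique-filterᵇ k {s ∷ t ∷ []} ((N.q≢r ∷ []) ∷ [] ∷ [])) to from)
        (length-filterᵇ₂ k s t)
        where
        module N = Nbrs N
        k p : Fin n → Bool
        k s = κ s u
        p s = κ s u ∧ not ⌊ s ≟ v ⌋
        to : ∀ {x} → x ∈ filterᵇ p (neighbours Γ w) → x ∈ filterᵇ k (s ∷ t ∷ [])
        to {x} x∈ with ∈-filterᵇ⁻ p {xs = neighbours Γ w} x∈
        ... | x∈N , h with only₂ N (∈⇒~ x∈N) (λ e → not-T (T-∧₂ {κ x u} h) (fromWitness e))
        ... | inj₁ refl = ∈-filterᵇ⁺ k {xs = s ∷ t ∷ []} (here refl) (T-∧₁ {κ x u} h)
        ... | inj₂ refl = ∈-filterᵇ⁺ k {xs = s ∷ t ∷ []} (there (here refl)) (T-∧₁ {κ x u} h)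
        from : ∀ {x} → x ∈ filterᵇ k (s ∷ t ∷ []) → x ∈ filterᵇ p (neighbours Γ w)
        from x∈ with ∈-filterᵇ⁻ k {xs = s ∷ t ∷ []} x∈
        ... | here refl , h = ∈-filterᵇ⁺ p (~⇒∈ N.~q) (∧-T h (T-not (N.p≢q ∘ sym ∘ toWitness)))
        ... | there (here refl) , h = ∈-filterᵇ⁺ p (~⇒∈ N.~r) (∧-T h (T-not (N.p≢r ∘ sym ∘ toWitness)))

      -- `R s y` stands for: `s` after `w` and `y` before `u` lie on one girth cycle through
      -- `u v w`. Passing from `s` to `y` injects the continuations at `w` into those at `u`; used
      -- in both directions it makes `X` symmetric.
      X≤X : ∀ {u v w} (R : Fin n → Fin n → Set)
        → (∀ {s} → w ~ s → s ≢ v → T (κ s u) → ∃ λ y → u ~ y × y ≢ v × T (κ y w) × R s y)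
        → (∀ {s s′ y} → w ~ s → w ~ s′ → T (κ s u) → R s y → R s′ y → s ≡ s′)
        → X u v w ≤ X w v u
      X≤X {u} {v} {w} R f inj = length≤ R (filterᵇ (p w) (neighbours Γ u)) (Unique-filterᵇ (p u) (Unique-neighbours w)) into
          (λ a b → inj (proj₁ (∈p a)) (proj₁ (∈p b)) (proj₂ (proj₂ (∈p a))))
        where
        p : Fin n → Fin n → Bool
        p u s = κ s u ∧ not ⌊ s ≟ v ⌋
        ∈p : ∀ {s u w} → s ∈ filterᵇ (p u) (neighbours Γ w) → w ~ s × s ≢ v × T (κ s u)
        ∈p {s} {u} {w} s∈ with ∈-filterᵇ⁻ (p u) {xs = neighbours Γ w} s∈
        ... | s∈N , h = ∈⇒~ s∈N , (λ e → not-T (T-∧₂ {κ s u} h) (fromWitness e)) , T-∧₁ h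
        into : ∀ {s} → s ∈ filterᵇ (p u) (neighbours Γ w) → ∃ λ y → y ∈ filterᵇ (p w) (neighbours Γ u) × R s y
        into s∈ with ∈p s∈
        ... | w~s , s≢v , k with f w~s s≢v k
        ... | y , u~y , y≢v , k′ , r = y , ∈-filterᵇ⁺ (p w) (~⇒∈ u~y) (∧-T k′ (T-not (y≢v ∘ toWitness))) , r

    abstract
      X≥1 : ∀ {u v w x} → w ~ v → w ~ x → x ≢ v → T (κ x u) → 1 ≤ X u v w
      X≥1 {u} w~v w~x x≢v h with nbrs₂ w~v w~x (x≢v ∘ sym)
      ... | t , N = subst (1 ≤_) (sym (trans (X≡ u N) (cong (λ b → ⟦ b ⟧ + ⟦ κ t u ⟧) (T⇒true h)))) (s≤s z≤n)

      X≥1⇒ : ∀ {u v w} → w ~ v → 1 ≤ X u v w → ∃ λ x → w ~ x × x ≢ v × T (κ x u)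
      X≥1⇒ {u} w~v h with nbrs₁ w~v
      ... | s , t , N with κ s u in es | κ t u in et | X≡ u N
      ... | true | _ | _ = s , Nbrs.~q N , Nbrs.p≢q N ∘ sym , true⇒T es
      ... | false | true | _ = t , Nbrs.~r N , Nbrs.p≢r N ∘ sym , true⇒T et
      ... | false | false | e = contradiction (subst (1 ≤_) e h) λ ()

      X≡2⇒ : ∀ {u v w x} → w ~ v → X u v w ≡ 2 → w ~ x → x ≢ v → T (κ x u)
      X≡2⇒ {u} {x = x} w~v h w~x x≢v with nbrs₂ w~v w~x (x≢v ∘ sym)
      ... | t , N with κ x u | κ t u | trans (sym h) (X≡ u N)
      ... | true  | _     | _ = tt
      ... | false | true  | ()
      ... | false | false | ()

      X≡1⇒ : ∀ {u v w x y} → w ~ v → X u v w ≡ 1 → w ~ x → x ≢ v → T (κ x u) → w ~ y → y ≢ v → T (κ y u) → x ≡ y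
      X≡1⇒ {u} {x = x} {y} w~v h w~x x≢v κx w~y y≢v κy with x ≟ y
      ... | yes e = e
      ... | no x≢y with nbrs₃ w~v w~x w~y (x≢v ∘ sym) (y≢v ∘ sym) x≢y
      ... | N with trans (sym h) (X≡ u N)
      ... | e rewrite T⇒true κx | T⇒true κy = contradiction e λ ()

      X≤1 : ∀ {u v w x} → w ~ v → w ~ x → x ≢ v → ¬ T (κ x u) → X u v w ≤ 1
      X≤1 {u} w~v w~x x≢v ¬κ with nbrs₂ w~v w~x (x≢v ∘ sym)
      ... | t , N rewrite X≡ u N | ¬T⇒false ¬κ with κ t u
      ... | true = s≤s z≤n
      ... | false = z≤n

      X≤2 : ∀ {u v w} → w ~ v → X u v w ≤ 2
      X≤2 {u} w~v with nbrs₁ w~v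
      ... | s , t , N rewrite X≡ u N with κ s u | κ t u
      ... | true | true = s≤s (s≤s z≤n)
      ... | true | false = s≤s z≤n
      ... | false | true = s≤s z≤n
      ... | false | false = z≤n

      X≡2 : ∀ {u v w s t} → Nbrs w v s t → T (κ s u) → T (κ t u) → X u v w ≡ 2
      X≡2 {u} N κs κt = trans (X≡ u N) (cong₂ (λ a b → ⟦ a ⟧ + ⟦ b ⟧) (T⇒true κs) (T⇒true κt))

-- Girth cycles and signatures

∈-lists : {n : ℕ} (Γ : Graph n) (xs : List (Fin n)) → xs ∈ lists Γ (length xs)
∈-lists Γ [] = here refl
∈-lists Γ (x ∷ xs) = ∈-concatMap (λ x → map (x ∷_) (lists Γ (length xs))) (∈-allFin x) (∈-map⁺ (x ∷_) (∈-lists Γ xs))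

∈-lists⇒length : {n : ℕ} (Γ : Graph n) (k : ℕ) {xs : List (Fin n)} → xs ∈ lists Γ k → length xs ≡ k
∈-lists⇒length Γ zero (here refl) = refl
∈-lists⇒length {n} Γ (suc k) xs∈ = go (allFin n) (∈-concatMap⁻ _ {xs = allFin n} xs∈)
  where
  go : ∀ ys {xs} → Any (λ x → xs ∈ map (x ∷_) (lists Γ k)) ys → length xs ≡ suc k
  go (y ∷ ys) (here h) with ∈-map⁻ (y ∷_) h
  ... | _ , zs∈ , refl = cong suc (∈-lists⇒length Γ k zs∈)
  go (y ∷ ys) (there h) = go ys h

Unique-lists : {n : ℕ} (Γ : Graph n) (k : ℕ) → Unique (lists Γ k)
Unique-lists Γ zero = [] ∷ []
Unique-lists {n} Γ (suc k) = Unique-concatMap (λ x → map (x ∷_) (lists Γ k)) (Uniqueₚ.allFin⁺ n)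
  (λ x → Uniqueₚ.map⁺ ∷-injectiveʳ (Unique-lists Γ k)) same
  where
  same : ∀ {x x′ ys} → ys ∈ map (x ∷_) (lists Γ k) → ys ∈ map (x′ ∷_) (lists Γ k) → x ≡ x′
  same {x} {x′} p q with ∈-map⁻ (x ∷_) p | ∈-map⁻ (x′ ∷_) q
  ... | _ , _ , refl | _ , _ , e = ∷-injectiveˡ e

distinct⁺ : {n : ℕ} (Γ : Graph n) {xs : List (Fin n)} → Unique xs → T (distinct Γ xs)
distinct⁺ Γ [] = tt
distinct⁺ Γ {x ∷ xs} (x∉ ∷ u) = ∧-T (T-not x∉′) (distinct⁺ Γ u)
  where
  x∉′ : ¬ T (any (λ y → ⌊ x ≟ y ⌋) xs)
  x∉′ h with T-any⁻ _ xs h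
  ... | y , y∈ , e = All.lookup x∉ y∈ (toWitness e)

distinct⁻ : {n : ℕ} (Γ : Graph n) {xs : List (Fin n)} → T (distinct Γ xs) → Unique xs
distinct⁻ Γ {[]} _ = []
distinct⁻ Γ {x ∷ xs} h = All.tabulate (λ y∈ e → not-T (T-∧₁ h) (T-any⁺ (λ y → ⌊ x ≟ y ⌋) y∈ (fromWitness e)))
  ∷ distinct⁻ Γ (T-∧₂ {not (any (λ y → ⌊ x ≟ y ⌋) xs)} h)

isCycle⁺ : {n : ℕ} (Γ : Graph n) {x y z : Fin n} {xs : List (Fin n)}
  → Unique (x ∷ y ∷ z ∷ xs) → T (closesAt Γ x (x ∷ y ∷ z ∷ xs)) → T (isCycle Γ (x ∷ y ∷ z ∷ xs))
isCycle⁺ Γ {x} {y} {z} {xs} u c = ∧-T {distinct Γ (x ∷ y ∷ z ∷ xs)} (distinct⁺ Γ u) c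

isCycle⁻ : {n : ℕ} (Γ : Graph n) {x y z : Fin n} {xs : List (Fin n)}
  → T (isCycle Γ (x ∷ y ∷ z ∷ xs)) → Unique (x ∷ y ∷ z ∷ xs) × T (closesAt Γ x (x ∷ y ∷ z ∷ xs))
isCycle⁻ Γ {x} {y} {z} {xs} h = distinct⁻ Γ (T-∧₁ {distinct Γ (x ∷ y ∷ z ∷ xs)} h) , T-∧₂ {distinct Γ (x ∷ y ∷ z ∷ xs)} h

length-filterᵇ₄ : {A : Set} (p : A → Bool) (a b c d : A)
  → length (filterᵇ p (a ∷ b ∷ c ∷ d ∷ [])) ≡ (⟦ p a ⟧ + ⟦ p b ⟧) + (⟦ p c ⟧ + ⟦ p d ⟧)
length-filterᵇ₄ p a b c d with p a
... | true with p b
...   | true = cong (2 +_) (length-filterᵇ₂ p c d)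
...   | false = cong (1 +_) (length-filterᵇ₂ p c d)
length-filterᵇ₄ p a b c d | false with p b
...   | true = cong (1 +_) (length-filterᵇ₂ p c d)
...   | false = length-filterᵇ₂ p c d

-- The first two sums exceed the third by `2 * x`. This is how a signature determines its triple of
-- corner counts.
pair-sums-cancel : ∀ {x y z x′ y′ z′} → x + y ≡ x′ + y′ → x + z ≡ x′ + z′ → y + z ≡ y′ + z′ → x ≡ x′ × y ≡ y′ × z ≡ z′
pair-sums-cancel {x} {y} {z} {x′} {y′} {z′} xy xz yz =
  x≡ , ℕₚ.+-cancelˡ-≡ x y y′ (trans xy (cong (_+ y′) (sym x≡))) , ℕₚ.+-cancelˡ-≡ x z z′ (trans xz (cong (_+ z′) (sym x≡)))
  where
  shuffle : ∀ x y z → (x + y) + (x + z) ≡ 2 * x + (y + z)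
  shuffle = solve-∀
  2x : 2 * x ≡ 2 * x′
  2x = ℕₚ.+-cancelʳ-≡ (y + z) (2 * x) (2 * x′)
    (trans (sym (shuffle x y z)) (trans (cong₂ _+_ xy xz) (trans (shuffle x′ y′ z′) (cong (2 * x′ +_) (sym yz)))))
  x≡ : x ≡ x′
  x≡ = ℕₚ.*-cancelˡ-≡ x x′ 2 2x

module Signature {n : ℕ} (Γ : Graph n) (cubic : Cubic Γ) (g : ℕ) (κ : Fin n → Fin n → Bool) where
  open Graph Γ using (adj)
  open Cub Γ cubic
  open Corner κ

  -- Here `xs` completes the edge `v w` to a girth cycle, and `Ends xs (x , y)` says that the cycle
  -- goes on from `w` to `x` and returns to `v` from `y`; for triangles these coincide. The fields
  -- match the girth cycles through `v w` with the pairs satisfying `κ`, whatever the girth.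
  record GirthPaths : Set₁ where
    field
      Ends  : List (Fin n) → Fin n × Fin n → Set
      to    : ∀ {v w xs} → length xs ≡ g ∸ 2 → T (isCycle Γ (v ∷ w ∷ xs))
            → ∃₂ λ x y → w ~ x × x ≢ v × v ~ y × y ≢ w × T (κ x y) × Ends xs (x , y)
      from  : ∀ {v w x y} → v ~ w → w ~ x → x ≢ v → v ~ y → y ≢ w → T (κ x y)
            → ∃ λ xs → length xs ≡ g ∸ 2 × T (isCycle Γ (v ∷ w ∷ xs)) × Ends xs (x , y)
      uniq  : ∀ {v w xs ys e} → T (isCycle Γ (v ∷ w ∷ xs)) → T (isCycle Γ (v ∷ w ∷ ys))
            → Ends xs e → Ends ys e → xs ≡ ys
      ends! : ∀ {xs e e′} → Ends xs e → Ends xs e′ → e ≡ e′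

  module _ (P : GirthPaths) where
    open GirthPaths P

    -- A girth cycle through `v w` leaves `w` by `s` or `t` and reaches `v` from `u` or `u′`. `κ`
    -- tests these four pairs, and grouping them by the end at `v` gives the two corner counts.
    ε≡ : ∀ {v w u u′} → Nbrs v w u u′ → ε Γ g v w ≡ X u v w + X u′ v w
    ε≡ {v} {w} {u} {u′} N with nbrs₁ (~-sym (Nbrs.~p N))
    ... | s , t , M rewrite X≡ u M | X≡ u′ M = trans
        (ℕₚ.≤-antisym (length≤ Ends ends (Unique-filterᵇ cyc (Unique-lists Γ (g ∸ 2))) into
                         (λ p q → uniq (proj₂ (∈cycles p)) (proj₂ (∈cycles q))))
                      (length≤ (λ e xs → Ends xs e) cycles (Unique-filterᵇ κ′ pairs-unique) onto (λ _ _ → ends!)))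
        (length-filterᵇ₄ κ′ (s , u) (t , u) (s , u′) (t , u′))
      where
      module N = Nbrs N
      module M = Nbrs M
      cyc : List (Fin n) → Bool
      cyc xs = isCycle Γ (v ∷ w ∷ xs)
      κ′ : Fin n × Fin n → Bool
      κ′ e = κ (proj₁ e) (proj₂ e)
      pairs ends : List (Fin n × Fin n)
      pairs = (s , u) ∷ (t , u) ∷ (s , u′) ∷ (t , u′) ∷ []
      ends = filterᵇ κ′ pairs
      cycles : List (List (Fin n))
      cycles = filterᵇ cyc (lists Γ (g ∸ 2))
      ∈cycles : ∀ {xs} → xs ∈ cycles → length xs ≡ g ∸ 2 × T (cyc xs)
      ∈cycles xs∈ with ∈-filterᵇ⁻ cyc {xs = lists Γ (g ∸ 2)} xs∈
      ... | l , c = ∈-lists⇒length Γ (g ∸ 2) l , c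
      pairs-unique : Unique pairs
      pairs-unique = (M.q≢r ∘ cong proj₁ ∷ N.q≢r ∘ cong proj₂ ∷ M.q≢r ∘ cong proj₁ ∷ [])
        ∷ (M.q≢r ∘ sym ∘ cong proj₁ ∷ N.q≢r ∘ cong proj₂ ∷ []) ∷ (M.q≢r ∘ cong proj₁ ∷ []) ∷ [] ∷ []
      pair∈ : ∀ {x y} → w ~ x → x ≢ v → v ~ y → y ≢ w → (x , y) ∈ pairs
      pair∈ w~x x≢v v~y y≢w with only₂ M w~x x≢v | only₂ N v~y y≢w
      ... | inj₁ refl | inj₁ refl = here refl
      ... | inj₂ refl | inj₁ refl = there (here refl)
      ... | inj₁ refl | inj₂ refl = there (there (here refl))
      ... | inj₂ refl | inj₂ refl = there (there (there (here refl)))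
      ∈pair : ∀ {e} → e ∈ pairs → w ~ proj₁ e × proj₁ e ≢ v × v ~ proj₂ e × proj₂ e ≢ w
      ∈pair (here refl) = M.~q , M.p≢q ∘ sym , N.~q , N.p≢q ∘ sym
      ∈pair (there (here refl)) = M.~r , M.p≢r ∘ sym , N.~q , N.p≢q ∘ sym
      ∈pair (there (there (here refl))) = M.~q , M.p≢q ∘ sym , N.~r , N.p≢r ∘ sym
      ∈pair (there (there (there (here refl)))) = M.~r , M.p≢r ∘ sym , N.~r , N.p≢r ∘ sym
      into : ∀ {xs} → xs ∈ cycles → ∃ λ e → e ∈ ends × Ends xs e
      into xs∈ with ∈cycles xs∈
      ... | l , c with to l c
      ... | x , y , w~x , x≢v , v~y , y≢w , k , E = (x , y) , ∈-filterᵇ⁺ κ′ (pair∈ w~x x≢v v~y y≢w) k , E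
      onto : ∀ {e} → e ∈ ends → ∃ λ xs → xs ∈ cycles × Ends xs e
      onto e∈ with ∈-filterᵇ⁻ κ′ {xs = pairs} e∈
      ... | p , k with ∈pair p
      ... | w~x , x≢v , v~y , y≢w with from N.~p w~x x≢v v~y y≢w k
      ... | xs , l , c , E = xs , ∈-filterᵇ⁺ cyc (subst (λ m → xs ∈ lists Γ m) l (∈-lists Γ xs)) c , E

  X-Symmetric : Set
  X-Symmetric = ∀ {u v w} → u ~ v → v ~ w → u ≢ w → X u v w ≡ X w v u

  -- The labelling of the neighbours is chosen anew at each vertex and is not unique when values
  -- coincide; only the three numbers are global.
  record Balanced (x y z : ℕ) : Set where
    field
      x≤y : x ≤ y
      y≤z : y ≤ z
      star : ∀ v → ∃ λ p → ∃ λ q → ∃ λ r → Nbrs v p q r × X p v q ≡ x × X p v r ≡ y × X q v r ≡ z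

  labelled : GirthPaths → X-Symmetric → ∀ {a b c} → GirthRegularWith Γ g a b c
    → ∀ v → ∃ λ p → ∃ λ q → ∃ λ r → Nbrs v p q r
      × a ≡ X p v q + X p v r × b ≡ X p v q + X q v r × c ≡ X p v r + X q v r
  labelled P X-sym reg v with ↭-map-inv (ε Γ g v) (proj₁ (reg v))
  ... | p ∷ q ∷ r ∷ [] , refl , π = p , q , r , N ,
        trans (ε≡ P N) (cong₂ _+_ (X-sym (~-sym N.~q) N.~p (N.p≢q ∘ sym)) (X-sym (~-sym N.~r) N.~p (N.p≢r ∘ sym))) ,
        trans (ε≡ P (swap₁₂ N)) (cong (X p v q +_) (X-sym (~-sym N.~r) N.~q (N.q≢r ∘ sym))) ,
        ε≡ P (rot² N)
    where
    N = ↭⇒Nbrs π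
    module N = Nbrs N

  -- The values at `v₀` serve at every vertex because the pairwise sums agree and can be inverted.
  -- The order of `x`, `y`, `z` is that of the signature after a common summand is cancelled.
  balanced : GirthPaths → X-Symmetric → Fin n → ∀ {a b c} → GirthRegularWith Γ g a b c
    → ∃ λ x → ∃ λ y → ∃ λ z → Balanced x y z × a ≡ x + y × b ≡ x + z × c ≡ y + z
  balanced P X-sym v₀ reg with labelled P X-sym reg v₀
  ... | p₀ , q₀ , r₀ , N₀ , a₀ , b₀ , c₀ = x , y , z , bal , a₀ , b₀ , c₀
    where
    x = X p₀ v₀ q₀
    y = X p₀ v₀ r₀
    z = X q₀ v₀ r₀
    bal : Balanced x y z
    bal = record
      { x≤y = ℕₚ.+-cancelʳ-≤ z x y (subst₂ _≤_ b₀ c₀ (proj₂ (proj₂ (reg v₀))))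
      ; y≤z = ℕₚ.+-cancelˡ-≤ x y z (subst₂ _≤_ a₀ b₀ (proj₁ (proj₂ (reg v₀))))
      ; star = λ v → let p , q , r , N , a′ , b′ , c′ = labelled P X-sym reg v
                         e₁ , e₂ , e₃ = pair-sums-cancel (trans (sym a′) a₀) (trans (sym b′) b₀) (trans (sym c′) c₀)
                     in p , q , r , N , e₁ , e₂ , e₃ }

module Girths {n : ℕ} (Γ : Graph n) (cubic : Cubic Γ) where
  open Graph Γ using (adj) renaming (sym to adj-sym)
  open Cub Γ cubic

  cycle₃⁺ : ∀ {a b c} → a ~ b → b ~ c → c ~ a → T (isCycle Γ (a ∷ b ∷ c ∷ []))
  cycle₃⁺ {a} {b} {c} ab bc ca = isCycle⁺ Γ {xs = []}
    ((~⇒≢ ab ∷ ~⇒≢ ca ∘ sym ∷ []) ∷ (~⇒≢ bc ∷ []) ∷ [] ∷ []) (∧-T ab (∧-T bc ca))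

  cycle₃⁻ : ∀ {a b c} → T (isCycle Γ (a ∷ b ∷ c ∷ [])) → a ~ b × b ~ c × c ~ a
  cycle₃⁻ {a} {b} {c} h with isCycle⁻ Γ {a} {b} {c} {[]} h
  ... | _ , k = T-∧₁ {adj a b} k , T-∧₁ {adj b c} (T-∧₂ {adj a b} k) , T-∧₂ {adj b c} (T-∧₂ {adj a b} k)

  cycle₄⁺ : ∀ {a b c d} → a ~ b → b ~ c → c ~ d → d ~ a → a ≢ c → b ≢ d → T (isCycle Γ (a ∷ b ∷ c ∷ d ∷ []))
  cycle₄⁺ ab bc cd da a≢c b≢d = isCycle⁺ Γ
    ((~⇒≢ ab ∷ a≢c ∷ ~⇒≢ da ∘ sym ∷ []) ∷ (~⇒≢ bc ∷ b≢d ∷ []) ∷ (~⇒≢ cd ∷ []) ∷ [] ∷ [])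
    (∧-T ab (∧-T bc (∧-T cd da)))

  cycle₄⁻ : ∀ {a b c d} → T (isCycle Γ (a ∷ b ∷ c ∷ d ∷ [])) → a ~ b × b ~ c × c ~ d × d ~ a × a ≢ c × b ≢ d
  cycle₄⁻ {a} {b} {c} {d} h with isCycle⁻ Γ {a} {b} {c} {d ∷ []} h
  ... | (_ ∷ a≢c ∷ _) ∷ (_ ∷ b≢d ∷ _) ∷ _ , k with T-∧₂ {adj a b} k
  ... | k′ = T-∧₁ {adj a b} k , T-∧₁ {adj b c} k′ , T-∧₁ {adj c d} (T-∧₂ {adj b c} k′) , T-∧₂ {adj c d} (T-∧₂ {adj b c} k′) , a≢c , b≢d

  cycle₅⁺ : ∀ {a b c d e} → a ~ b → b ~ c → c ~ d → d ~ e → e ~ a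
    → a ≢ c → a ≢ d → b ≢ d → b ≢ e → c ≢ e → T (isCycle Γ (a ∷ b ∷ c ∷ d ∷ e ∷ []))
  cycle₅⁺ ab bc cd de ea a≢c a≢d b≢d b≢e c≢e = isCycle⁺ Γ
    ((~⇒≢ ab ∷ a≢c ∷ a≢d ∷ ~⇒≢ ea ∘ sym ∷ []) ∷ (~⇒≢ bc ∷ b≢d ∷ b≢e ∷ []) ∷ (~⇒≢ cd ∷ c≢e ∷ []) ∷ (~⇒≢ de ∷ []) ∷ [] ∷ [])
    (∧-T ab (∧-T bc (∧-T cd (∧-T de ea))))

  cycle₅⁻ : ∀ {a b c d e} → T (isCycle Γ (a ∷ b ∷ c ∷ d ∷ e ∷ []))
    → a ~ b × b ~ c × c ~ d × d ~ e × e ~ a × a ≢ c × b ≢ e × c ≢ e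
  cycle₅⁻ {a} {b} {c} {d} {e} h with isCycle⁻ Γ {a} {b} {c} {d ∷ e ∷ []} h
  ... | (_ ∷ a≢c ∷ _) ∷ (_ ∷ _ ∷ b≢e ∷ _) ∷ (_ ∷ c≢e ∷ _) ∷ _ , k with T-∧₂ {adj a b} k
  ... | k′ with T-∧₂ {adj b c} k′
  ... | k″ = T-∧₁ {adj a b} k , T-∧₁ {adj b c} k′ , T-∧₁ {adj c d} k″
           , T-∧₁ {adj d e} (T-∧₂ {adj c d} k″) , T-∧₂ {adj d e} (T-∧₂ {adj c d} k″) , a≢c , b≢e , c≢e

  TriangleFree : Set
  TriangleFree = ∀ {a b c} → a ~ b → b ~ c → c ~ a → ⊥

  SquareFree : Set
  SquareFree = ∀ {a b c d} → a ~ b → b ~ c → c ~ d → d ~ a → a ≢ c → b ≢ d → ⊥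

  triangleFree : ∀ {g} → 4 ≤ g → IsGirth Γ g → TriangleFree
  triangleFree 4≤g (_ , min) {a} {b} {c} ab bc ca = ℕₚ.<⇒≱ 4≤g (min (a ∷ b ∷ c ∷ []) (cycle₃⁺ ab bc ca))

  squareFree : ∀ {g} → 5 ≤ g → IsGirth Γ g → SquareFree
  squareFree 5≤g (_ , min) {a} {b} {c} {d} ab bc cd da a≢c b≢d = ℕₚ.<⇒≱ 5≤g (min (a ∷ b ∷ c ∷ d ∷ []) (cycle₄⁺ ab bc cd da a≢c b≢d))

  κ₃ κ₄ : Fin n → Fin n → Bool
  κ₃ s u = ⌊ s ≟ u ⌋
  κ₄ = adj

  abstract
    κ₅ : Fin n → Fin n → Bool
    κ₅ s u = any (λ m → adj s m ∧ adj m u) (allFin n)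

    κ₅⁺ : ∀ {s m u} → s ~ m → m ~ u → T (κ₅ s u)
    κ₅⁺ {s} {m} {u} sm mu = T-any⁺ (λ m → adj s m ∧ adj m u) (∈-allFin m) (∧-T sm mu)

    κ₅⁻ : ∀ {s u} → T (κ₅ s u) → ∃ λ m → s ~ m × m ~ u
    κ₅⁻ {s} {u} h with T-any⁻ (λ m → adj s m ∧ adj m u) (allFin n) h
    ... | m , _ , k = m , T-∧₁ k , T-∧₂ {adj s m} k

  κ₃-sym : ∀ s u → κ₃ s u ≡ κ₃ u s
  κ₃-sym s u = T-ext (λ h → fromWitness (sym (toWitness h))) (λ h → fromWitness (sym (toWitness h)))

  κ₅-sym : ∀ s u → κ₅ s u ≡ κ₅ u s
  κ₅-sym s u = T-ext flip flip
    where
    flip : ∀ {s u} → T (κ₅ s u) → T (κ₅ u s)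
    flip h with κ₅⁻ h
    ... | m , sm , mu = κ₅⁺ (~-sym mu) (~-sym sm)

  module S₃ = Signature Γ cubic 3 κ₃
  module S₄ = Signature Γ cubic 4 κ₄
  module S₅ = Signature Γ cubic 5 κ₅

  X₃-sym : S₃.X-Symmetric
  X₃-sym u~v v~w u≢w = ℕₚ.≤-antisym (le u~v v~w) (le (~-sym v~w) (~-sym u~v))
    where
    open Corner κ₃
    le : ∀ {u v w} → u ~ v → v ~ w → X u v w ≤ X w v u
    -- On a triangle the vertex after `w` is `u` itself, and the vertex before `u` is `w`.
    le {u} {v} {w} u~v v~w = X≤X (λ s y → s ≡ u)
      (λ w~s s≢v h → w , ~-sym (subst (w ~_) (toWitness h) w~s) , ~⇒≢ (~-sym v~w) , fromWitness refl , toWitness h)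
      (λ _ _ _ e e′ → trans e (sym e′))

  X₄-sym : S₄.X-Symmetric
  X₄-sym u~v v~w u≢w = ℕₚ.≤-antisym le le
    where
    open Corner κ₄
    le : ∀ {u v w} → X u v w ≤ X w v u
    le = X≤X _≡_ (λ {s} w~s s≢v h → s , ~-sym h , s≢v , ~-sym w~s , refl) (λ _ _ _ e e′ → trans e (sym e′))

  -- The pentagon is `u v w s y`, so `y` is the middle of the closing path from `s` to `u`. Two
  -- different `s` with the same `y` would span a 4-cycle with `w`.
  X₅-sym : TriangleFree → SquareFree → S₅.X-Symmetric
  X₅-sym no₃ no₄ u~v v~w u≢w = ℕₚ.≤-antisym (le u~v v~w) (le (~-sym v~w) (~-sym u~v))
    where
    open Corner κ₅
    le : ∀ {u v w} → u ~ v → v ~ w → X u v w ≤ X w v u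
    le {u} {v} {w} u~v v~w = X≤X (λ s y → s ~ y × y ~ u) into inj
      where
      into : ∀ {s} → w ~ s → s ≢ v → T (κ₅ s u) → ∃ λ y → u ~ y × y ≢ v × T (κ₅ y w) × (s ~ y × y ~ u)
      into w~s s≢v h with κ₅⁻ h
      ... | m , s~m , m~u = m , ~-sym m~u , (λ { refl → no₃ s~m v~w w~s }) , κ₅⁺ (~-sym s~m) (~-sym w~s) , s~m , m~u
      inj : ∀ {s s′ y} → w ~ s → w ~ s′ → T (κ₅ s u) → s ~ y × y ~ u → s′ ~ y × y ~ u → s ≡ s′
      inj {s} {s′} w~s w~s′ _ (s~y , y~u) (s′~y , _) with s ≟ s′
      ... | yes e = e
      ... | no s≢s′ = ⊥-elim (no₄ w~s s~y (~-sym s′~y) (~-sym w~s′) (λ { refl → no₃ y~u u~v v~w }) s≢s′)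

  paths₃ : S₃.GirthPaths
  paths₃ = record
    { Ends = λ xs e → xs ≡ proj₁ e ∷ [] × proj₁ e ≡ proj₂ e
    ; to = to
    ; from = from
    ; uniq = λ { _ _ (refl , _) (refl , _) → refl }
    ; ends! = λ { (refl , refl) (refl , refl) → refl }
    }
    where
    to : ∀ {v w xs} → length xs ≡ 1 → T (isCycle Γ (v ∷ w ∷ xs))
      → ∃₂ λ x y → w ~ x × x ≢ v × v ~ y × y ≢ w × T (κ₃ x y) × (xs ≡ x ∷ [] × x ≡ y)
    to {v} {w} {x ∷ []} _ c with cycle₃⁻ {v} {w} {x} c
    ... | vw , wx , xv = x , x , wx , ~⇒≢ xv , ~-sym xv , ~⇒≢ (~-sym wx) , fromWitness refl , refl , refl
    from : ∀ {v w x y} → v ~ w → w ~ x → x ≢ v → v ~ y → y ≢ w → T (κ₃ x y)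
      → ∃ λ xs → length xs ≡ 1 × T (isCycle Γ (v ∷ w ∷ xs)) × (xs ≡ x ∷ [] × x ≡ y)
    from {x = x} vw wx x≢v vy y≢w h with toWitness h
    ... | refl = x ∷ [] , refl , cycle₃⁺ vw wx (~-sym vy) , refl , refl

  paths₄ : S₄.GirthPaths
  paths₄ = record
    { Ends = λ xs e → xs ≡ proj₁ e ∷ proj₂ e ∷ []
    ; to = to
    ; from = λ {_} {_} {x} {y} vw wx x≢v vy y≢w h →
        x ∷ y ∷ [] , refl , cycle₄⁺ vw wx h (~-sym vy) (x≢v ∘ sym) (y≢w ∘ sym) , refl
    ; uniq = λ { _ _ refl refl → refl }
    ; ends! = λ { refl refl → refl }
    }
    where
    to : ∀ {v w xs} → length xs ≡ 2 → T (isCycle Γ (v ∷ w ∷ xs))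
      → ∃₂ λ x y → w ~ x × x ≢ v × v ~ y × y ≢ w × T (κ₄ x y) × (xs ≡ x ∷ y ∷ [])
    to {v} {w} {x ∷ y ∷ []} _ c with cycle₄⁻ {v} {w} {x} {y} c
    ... | vw , wx , xy , yv , v≢x , w≢y = x , y , wx , v≢x ∘ sym , ~-sym yv , w≢y ∘ sym , xy , refl

  -- The middle vertex `m` is not recorded in the pair of ends; two choices of it would form a
  -- 4-cycle. Triangle-freeness supplies the inequalities that make the closed walk a cycle.
  paths₅ : TriangleFree → SquareFree → S₅.GirthPaths
  paths₅ no₃ no₄ = record
    { Ends = λ xs e → ∃ λ m → xs ≡ proj₁ e ∷ m ∷ proj₂ e ∷ []
    ; to = to
    ; from = from
    ; uniq = uniq
    ; ends! = λ { (_ , refl) (_ , refl) → refl }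
    }
    where
    to : ∀ {v w xs} → length xs ≡ 3 → T (isCycle Γ (v ∷ w ∷ xs))
      → ∃₂ λ x y → w ~ x × x ≢ v × v ~ y × y ≢ w × T (κ₅ x y) × (∃ λ m → xs ≡ x ∷ m ∷ y ∷ [])
    to {v} {w} {x ∷ m ∷ y ∷ []} _ c with cycle₅⁻ {v} {w} {x} {m} {y} c
    ... | vw , wx , xm , my , yv , v≢x , w≢y , _ =
          x , y , wx , v≢x ∘ sym , ~-sym yv , w≢y ∘ sym , κ₅⁺ xm my , m , refl
    from : ∀ {v w x y} → v ~ w → w ~ x → x ≢ v → v ~ y → y ≢ w → T (κ₅ x y)
      → ∃ λ xs → length xs ≡ 3 × T (isCycle Γ (v ∷ w ∷ xs)) × (∃ λ m → xs ≡ x ∷ m ∷ y ∷ [])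
    from {x = x} {y} vw wx x≢v vy y≢w h with κ₅⁻ h
    ... | m , xm , my = x ∷ m ∷ y ∷ [] , refl ,
          cycle₅⁺ vw wx xm my (~-sym vy) (x≢v ∘ sym) (λ { refl → no₃ vw wx xm }) (λ { refl → no₃ vw my (~-sym vy) })
            (y≢w ∘ sym) (λ { refl → no₃ vw wx (~-sym vy) }) , m , refl
    uniq : ∀ {v w xs ys} {e : Fin n × Fin n} → T (isCycle Γ (v ∷ w ∷ xs)) → T (isCycle Γ (v ∷ w ∷ ys))
      → (∃ λ m → xs ≡ proj₁ e ∷ m ∷ proj₂ e ∷ []) → (∃ λ m → ys ≡ proj₁ e ∷ m ∷ proj₂ e ∷ []) → xs ≡ ys
    uniq {v} {w} {e = x , y} c c′ (m , refl) (m′ , refl) with m ≟ m′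
    ... | yes refl = refl
    ... | no m≢m′ with cycle₅⁻ {v} {w} {x} {m} {y} c | cycle₅⁻ {v} {w} {x} {m′} {y} c′
    ... | _ , _ , xm , my , _ , _ , _ , x≢y | _ , _ , xm′ , m′y , _ =
          ⊥-elim (no₄ xm my (~-sym m′y) (~-sym xm′) x≢y m≢m′)

-- Isomorphisms

IsoTo-∘ : {n : ℕ} (Γ : Graph n) {A B : Set} (R : A → A → Set) (S : B → B → Set)
  (to : A → B) (from : B → A) → (∀ a → from (to a) ≡ a) → (∀ b → to (from b) ≡ b)
  → (∀ a a′ → R a a′ ⇔ S (to a) (to a′)) → IsoTo Γ A R → IsoTo Γ B S
IsoTo-∘ Γ R S to from from∘to to∘from R⇔S (f , (inj , surj) , hom) = to ∘ f
  , ((λ e → inj (trans (sym (from∘to _)) (trans (cong from e) (from∘to _))))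
    , λ b → proj₁ (surj (from b)) , λ e → trans (cong to (proj₂ (surj (from b)) e)) (to∘from b))
  , λ x y → mk⇔ (Equivalence.to (R⇔S _ _) ∘ Equivalence.to (hom x y)) (Equivalence.from (hom x y) ∘ Equivalence.from (R⇔S _ _))

IsoTo-≤ : {n : ℕ} (Γ : Graph n) {A B : Set} {R : A → A → Set} {S : B → B → Set}
  → IsoTo Γ A R → IsoTo Γ B S → {as : List A} {bs : List B} → Unique as → (∀ b → b ∈ bs) → length as ≤ length bs
IsoTo-≤ Γ (f , (finj , fsurj) , _) (h , (hinj , hsurj) , _) {bs = bs} u all =
  length≤ (λ a b → ∃ λ x → f x ≡ a × h x ≡ b) bs u
    (λ {a} _ → _ , all _ , proj₁ (fsurj a) , proj₂ (fsurj a) refl , refl)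
    (λ { _ _ (x , refl , e) (y , refl , e′) → cong f (hinj (trans e (sym e′))) })

module Covers {n : ℕ} (Γ : Graph n) (cubic : Cubic Γ) (connected : Connected Γ) where
  open Cub Γ cubic
  open Girths Γ cubic using (TriangleFree; SquareFree)

  -- Walks from `φ a₀` lift edge by edge, so connectedness makes `φ` onto. Non-edges need no check:
  -- an edge of Γ lifts at `f x`, and injectivity identifies the end of the lift with `f y`.
  isoFrom : {A : Set} {R : A → A → Set} (φ : A → Fin n) (a₀ : A)
    → (∀ {a b} → φ a ≡ φ b → a ≡ b)
    → (∀ {a b} → R a b → φ a ~ φ b)
    → (∀ {a y} → φ a ~ y → ∃ λ b → R a b × φ b ≡ y)
    → IsoTo Γ A R
  isoFrom {A} {R} φ a₀ inj hom lift = f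
      , ((λ e → trans (sym (φf _)) (trans (cong φ e) (φf _)))
        , λ a → φ a , λ { refl → inj (φf (φ a)) })
      , λ x y → mk⇔ (reflect x y) (λ r → subst₂ _~_ (φf x) (φf y) (hom r))
    where
    onto : ∀ a {y} → Star _~_ (φ a) y → ∃ λ b → φ b ≡ y
    onto a ε⋆ = a , refl
    onto a (e ◅ es) with lift e
    ... | b , _ , refl = onto b es
    f : Fin n → A
    f y = proj₁ (onto a₀ (connected (φ a₀) y))
    φf : ∀ y → φ (f y) ≡ y
    φf y = proj₂ (onto a₀ (connected (φ a₀) y))
    reflect : ∀ x y → x ~ y → R (f x) (f y)
    reflect x y e with lift (subst (_~ y) (sym (φf x)) e)
    ... | b , r , φb = subst (R (f x)) (inj (trans φb (sym (φf y)))) r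

  module Cover {A : Set} (_≟ᴬ_ : (a b : A) → Dec (a ≡ b)) (nb : A → Fin 3 → A) (φ : A → Fin n)
               (back : ∀ a i → ∃ λ j → nb (nb a i) j ≡ a)
               (cover : ∀ a → Nbrs (φ a) (φ (nb a 0F)) (φ (nb a 1F)) (φ (nb a 2F))) where

    edge : ∀ a i → φ a ~ φ (nb a i)
    edge a 0F = Nbrs.~p (cover a)
    edge a 1F = Nbrs.~q (cover a)
    edge a 2F = Nbrs.~r (cover a)

    local-inj : ∀ a i j → nb a i ≢ nb a j → φ (nb a i) ≢ φ (nb a j)
    local-inj a 0F 0F ne = contradiction refl ne
    local-inj a 1F 1F ne = contradiction refl ne
    local-inj a 2F 2F ne = contradiction refl ne
    local-inj a 0F 1F _ = Nbrs.p≢q (cover a)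
    local-inj a 0F 2F _ = Nbrs.p≢r (cover a)
    local-inj a 1F 2F _ = Nbrs.q≢r (cover a)
    local-inj a 1F 0F _ = Nbrs.p≢q (cover a) ∘ sym
    local-inj a 2F 0F _ = Nbrs.p≢r (cover a) ∘ sym
    local-inj a 2F 1F _ = Nbrs.q≢r (cover a) ∘ sym

    iso : A → (∀ {a b} → φ a ≡ φ b → a ≡ b) → IsoTo Γ (A) (λ a b → ∃ λ i → nb a i ≡ b)
    iso a₀ inj = isoFrom φ a₀ inj (λ { (i , refl) → edge _ i }) lift
      where
      lift : ∀ {a y} → φ a ~ y → ∃ λ b → (∃ λ i → nb a i ≡ b) × φ b ≡ y
      lift {a} e with Nbrs.only (cover a) e
      ... | inj₁ refl = _ , (0F , refl) , refl
      ... | inj₂ (inj₁ refl) = _ , (1F , refl) , refl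
      ... | inj₂ (inj₂ refl) = _ , (2F , refl) , refl

    data Near₂ (a : A) : A → Set where
      near₀ : Near₂ a a
      near₁ : ∀ i → Near₂ a (nb a i)
      near₂ : ∀ i j → Near₂ a (nb (nb a i) j)

    -- Both ends are neighbours of `nb a i`, and `cover` makes `φ` injective on neighbourhoods.
    step₂ : ∀ a i j → nb (nb a i) j ≢ a → φ (nb (nb a i) j) ≢ φ a
    step₂ a i j ne e with back a i
    ... | l , p = local-inj (nb a i) j l (ne ∘ (λ q → trans q p)) (trans e (cong φ (sym p)))

    near₂-inj : ∀ {a b} → Near₂ a b → φ a ≡ φ b → a ≡ b
    near₂-inj near₀ _ = refl
    near₂-inj {a} (near₁ i) e = contradiction e (~⇒≢ (edge a i))
    near₂-inj {a} (near₂ i j) e with nb (nb a i) j ≟ᴬ a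
    ... | yes p = sym p
    ... | no ne = contradiction (sym e) (step₂ a i j ne)

    -- A walk of length three whose ends collide would be mapped onto a triangle.
    near₃-inj : TriangleFree → ∀ {a} i j l → φ a ≢ φ (nb (nb (nb a i) j) l)
    near₃-inj no₃ {a} i j l e = no₃ (edge a i) (edge _ j) (subst (φ (nb (nb a i) j) ~_) (sym e) (edge _ l))

module Regular {n : ℕ} (Γ : Graph n) (cubic : Cubic Γ) (g : ℕ) (κ : Fin n → Fin n → Bool) where
  open Cub Γ cubic
  open Corner κ
  open Signature Γ cubic g κ

  -- Both sides add the same four values of `κ` between neighbours of `v` and neighbours of `w`,
  -- once by rows and once by columns. For the intended `κ` this is ε of the edge `v w`, computed at
  -- either end.
  ε-sym : (∀ s u → κ s u ≡ κ u s)
    → ∀ {v w u u′ s t} → Nbrs v w u u′ → Nbrs w v s t → X u v w + X u′ v w ≡ X s w v + X t w v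
  ε-sym κ-sym {v} {w} {u} {u′} {s} {t} N M
    rewrite X≡ u M | X≡ u′ M | X≡ s N | X≡ t N | κ-sym s u | κ-sym t u | κ-sym s u′ | κ-sym t u′
    = interchange ⟦ κ u s ⟧ ⟦ κ u t ⟧ ⟦ κ u′ s ⟧ ⟦ κ u′ t ⟧
    where
    interchange : ∀ a b c d → (a + b) + (c + d) ≡ (a + c) + (b + d)
    interchange = solve-∀

  -- Any labelling of the neighbours of `v` is a rearrangement of the one given by `star`. So a
  -- property of the corners need only be checked on the six arrangements of `x`, `y`, `z`; premises
  -- placed inside `P` discard the arrangements that contradict them.
  corners : X-Symmetric → ∀ {x y z} → Balanced x y z → (P : ℕ → ℕ → ℕ → Set)
    → P x y z → P x z y → P y x z → P y z x → P z x y → P z y x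
    → ∀ {v a b c} → Nbrs v a b c → P (X a v b) (X a v c) (X b v c)
  corners X-sym {x} {y} {z} bal P xyz xzy yxz yzx zxy zyx {v} {a} {b} {c} M =
    match (proj₁ (proj₂ (proj₂ (proj₂ (star v))))) (proj₂ (proj₂ (proj₂ (proj₂ (star v)))))
    where
    open Balanced bal
    subst₃ : ∀ {i j k i′ j′ k′} → i ≡ i′ → j ≡ j′ → k ≡ k′ → P i′ j′ k′ → P i j k
    subst₃ refl refl refl h = h
    flip : ∀ {s t m} → v ~ s → v ~ t → s ≢ t → X s v t ≡ m → X t v s ≡ m
    flip v~s v~t s≢t = trans (X-sym (~-sym v~t) v~s (s≢t ∘ sym))
    match : ∀ {p q r} → Nbrs v p q r → X p v q ≡ x × X p v r ≡ y × X q v r ≡ z → P (X a v b) (X a v c) (X b v c)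
    match N@(nbrs vp vq vr p≢q p≢r q≢r _) (pq , pr , qr) with Nbrs.only N (Nbrs.~p M)
    ... | inj₁ refl with only₂ N (Nbrs.~q M) (Nbrs.p≢q M ∘ sym)
    ...   | inj₁ refl with refl ← only₁ N (Nbrs.~r M) (Nbrs.p≢r M ∘ sym) (Nbrs.q≢r M ∘ sym) = subst₃ pq pr qr xyz
    ...   | inj₂ refl with refl ← only₁ (swap₂₃ N) (Nbrs.~r M) (Nbrs.p≢r M ∘ sym) (Nbrs.q≢r M ∘ sym) =
              subst₃ pr pq (flip vq vr q≢r qr) yxz
    match N@(nbrs vp vq vr p≢q p≢r q≢r _) (pq , pr , qr) | inj₂ (inj₁ refl) with only₂ (swap₁₂ N) (Nbrs.~q M) (Nbrs.p≢q M ∘ sym)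
    ...   | inj₁ refl with refl ← only₁ (swap₁₂ N) (Nbrs.~r M) (Nbrs.p≢r M ∘ sym) (Nbrs.q≢r M ∘ sym) =
              subst₃ (flip vp vq p≢q pq) qr pr xzy
    ...   | inj₂ refl with refl ← only₁ (rot N) (Nbrs.~r M) (Nbrs.p≢r M ∘ sym) (Nbrs.q≢r M ∘ sym) =
              subst₃ qr (flip vp vq p≢q pq) (flip vp vr p≢r pr) zxy
    match N@(nbrs vp vq vr p≢q p≢r q≢r _) (pq , pr , qr) | inj₂ (inj₂ refl) with only₂ (rot² N) (Nbrs.~q M) (Nbrs.p≢q M ∘ sym)
    ...   | inj₁ refl with refl ← only₁ (rot² N) (Nbrs.~r M) (Nbrs.p≢r M ∘ sym) (Nbrs.q≢r M ∘ sym) =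
              subst₃ (flip vp vr p≢r pr) (flip vq vr q≢r qr) pq yzx
    ...   | inj₂ refl with refl ← only₁ (swap₁₃ N) (Nbrs.~r M) (Nbrs.p≢r M ∘ sym) (Nbrs.q≢r M ∘ sym) =
              subst₃ (flip vq vr q≢r qr) (flip vp vr p≢r pr) (flip vp vq p≢q pq) zyx

  all-corners : X-Symmetric → ∀ {k} → Balanced k k k → ∀ {u v w} → u ~ v → v ~ w → u ≢ w → X u v w ≡ k
  all-corners X-sym {k} bal uv vw u≢w =
    corners X-sym bal (λ i _ _ → i ≡ k) refl refl refl refl refl refl (proj₂ (nbrs₂ (~-sym uv) vw u≢w))

-- Girth three

module GirthThree {n : ℕ} (Γ : Graph n) (cubic : Cubic Γ) (connected : Connected Γ) where
  open Cub Γ cubic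
  open Girths Γ cubic
  open Corner κ₃
  open Covers Γ cubic connected

  corner₃ : ∀ {u v w} → w ~ v → 1 ≤ X u v w → u ~ w
  corner₃ {u} {v} {w} w~v h with X≥1⇒ w~v h
  ... | x , w~x , _ , k = ~-sym (subst (w ~_) (toWitness k) w~x)

  -- A triangle on `u v w` continues from `w` to `u`, so only one of the two candidates can count.
  -- This removes every triple with `z = 2` in girth three.
  X₃≤1 : ∀ {u v w} → w ~ v → X u v w ≤ 1
  X₃≤1 {u} {v} {w} w~v with nbrs₁ w~v
  ... | s , t , N with s ≟ u
  ... | no s≢u = X≤1 w~v (Nbrs.~q N) (Nbrs.p≢q N ∘ sym) (s≢u ∘ toWitness)
  ... | yes refl = X≤1 w~v (Nbrs.~r N) (Nbrs.p≢r N ∘ sym) (Nbrs.q≢r N ∘ sym ∘ toWitness)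

  -- The vertices `v`, `p`, `q`, `r` span `K₄` without the edge `p q`, and every edge lies on a
  -- triangle by `others`. The third edge at `p` would need a triangle through `v` or `r`, whose
  -- neighbourhoods are already full.
  no-011 : Fin n → ¬ S₃.Balanced 0 1 1
  no-011 v bal with S₃.Balanced.star bal v
  ... | p , q , r , N , pq , pr , qr = impossible
    where
    module N = Nbrs N
    p≁q : ¬ p ~ q
    p≁q h = contradiction (subst (1 ≤_) pq (X≥1 (~-sym N.~q) (~-sym h) (~⇒≢ (~-sym N.~p)) (fromWitness refl))) λ ()
    p~r : p ~ r
    p~r = corner₃ (~-sym N.~r) (subst (1 ≤_) (sym pr) (s≤s z≤n))
    q~r : q ~ r
    q~r = corner₃ (~-sym N.~r) (subst (1 ≤_) (sym qr) (s≤s z≤n))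
    Nr : Nbrs r v p q
    Nr = nbrs₃ (~-sym N.~r) (~-sym p~r) (~-sym q~r) (~⇒≢ N.~p) (~⇒≢ N.~q) N.p≢q
    others : ∀ w {t} → w ~ t → ∃ λ t′ → w ~ t′ × t ~ t′
    others w w~t with S₃.Balanced.star bal w
    ... | a , b , c , M , _ , ac , bc with corner₃ (~-sym (Nbrs.~r M)) (subst (1 ≤_) (sym ac) (s≤s z≤n))
                                         | corner₃ (~-sym (Nbrs.~r M)) (subst (1 ≤_) (sym bc) (s≤s z≤n)) | Nbrs.only M w~t
    ... | a~c | _ | inj₁ refl = c , Nbrs.~r M , a~c
    ... | _ | b~c | inj₂ (inj₁ refl) = c , Nbrs.~r M , b~c
    ... | a~c | _ | inj₂ (inj₂ refl) = a , Nbrs.~p M , ~-sym a~c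
    impossible : ⊥
    impossible with nbrs₂ (~-sym N.~p) p~r (~⇒≢ N.~r)
    ... | s , Np with others p (Nbrs.~r Np)
    ... | t′ , p~t′ , s~t′ with Nbrs.only Np p~t′
    ... | inj₂ (inj₂ refl) = ~⇒≢ s~t′ refl
    ... | inj₁ refl = case Nbrs.only N (~-sym s~t′) of λ where
            (inj₁ refl) → ~⇒≢ (Nbrs.~r Np) refl
            (inj₂ (inj₁ refl)) → p≁q (Nbrs.~r Np)
            (inj₂ (inj₂ refl)) → Nbrs.q≢r Np refl
    ... | inj₂ (inj₁ refl) = case Nbrs.only Nr (~-sym s~t′) of λ where
            (inj₁ refl) → Nbrs.p≢r Np refl
            (inj₂ (inj₁ refl)) → ~⇒≢ (Nbrs.~r Np) refl
            (inj₂ (inj₂ refl)) → p≁q (Nbrs.~r Np)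

  K₄-nb : Fin 4 → Fin 3 → Fin 4
  K₄-nb 0F = λ { 0F → 1F ; 1F → 2F ; 2F → 3F }
  K₄-nb 1F = λ { 0F → 0F ; 1F → 2F ; 2F → 3F }
  K₄-nb 2F = λ { 0F → 0F ; 1F → 1F ; 2F → 3F }
  K₄-nb 3F = λ { 0F → 0F ; 1F → 1F ; 2F → 2F }

  abstract
    K₄-adj : ∀ a b → (∃ λ i → K₄-nb a i ≡ b) ⇔ K4Adj a b
    K₄-adj a b = mk⇔ (proj₁ (check a b)) (proj₂ (check a b))
      where
      check : ∀ a b → ((∃ λ i → K₄-nb a i ≡ b) → a ≢ b) × (a ≢ b → ∃ λ i → K₄-nb a i ≡ b)
      check = from-yes (all? λ a → all? λ b → let d = any? (λ i → K₄-nb a i ≟ b) in (d →-dec ¬? (a ≟ b)) ×-dec (¬? (a ≟ b) →-dec d))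

  111⇒K₄ : Fin n → S₃.Balanced 1 1 1 → IsoTo Γ (Fin 4) K4Adj
  111⇒K₄ v bal with S₃.Balanced.star bal v
  ... | p , q , r , N , pq , pr , qr = IsoTo-∘ Γ (λ a b → ∃ λ i → K₄-nb a i ≡ b) K4Adj id id (λ _ → refl) (λ _ → refl) K₄-adj
        (iso 0F λ {a} {b} → near₂-inj (near a b))
    where
    module N = Nbrs N
    p~q : p ~ q
    p~q = corner₃ (~-sym N.~q) (subst (1 ≤_) (sym pq) (s≤s z≤n))
    p~r : p ~ r
    p~r = corner₃ (~-sym N.~r) (subst (1 ≤_) (sym pr) (s≤s z≤n))
    q~r : q ~ r
    q~r = corner₃ (~-sym N.~r) (subst (1 ≤_) (sym qr) (s≤s z≤n))
    φ : Fin 4 → Fin n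
    φ 0F = v
    φ 1F = p
    φ 2F = q
    φ 3F = r
    cover : ∀ a → Nbrs (φ a) (φ (K₄-nb a 0F)) (φ (K₄-nb a 1F)) (φ (K₄-nb a 2F))
    cover 0F = N
    cover 1F = nbrs₃ (~-sym N.~p) p~q p~r (~⇒≢ N.~q) (~⇒≢ N.~r) N.q≢r
    cover 2F = nbrs₃ (~-sym N.~q) (~-sym p~q) q~r (~⇒≢ N.~p) (~⇒≢ N.~r) N.p≢r
    cover 3F = nbrs₃ (~-sym N.~r) (~-sym p~r) (~-sym q~r) (~⇒≢ N.~p) (~⇒≢ N.~q) N.p≢q
    open Cover _≟_ K₄-nb φ (from-yes (all? λ a → all? λ i → any? λ j → K₄-nb (K₄-nb a i) j ≟ a)) cover
    near : ∀ a b → Near₂ a b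
    near a b with a ≟ b
    ... | yes refl = near₀
    ... | no ne with Equivalence.from (K₄-adj a b) ne
    ... | i , refl = near₁ i

-- Girth five

module GirthFive {n : ℕ} (Γ : Graph n) (cubic : Cubic Γ)
  (no₃ : Girths.TriangleFree Γ cubic) (no₄ : Girths.SquareFree Γ cubic) where

  open Cub Γ cubic
  open Girths Γ cubic
  open Corner κ₅
  open Signature Γ cubic 5 κ₅ using (Balanced; X-Symmetric)
  open Balanced using (star)

  private
    ! : ∀ {u v} → u ~ v → v ~ u
    ! = ~-sym
    Xsym : X-Symmetric
    Xsym = X₅-sym no₃ no₄
    open module R = Regular Γ cubic 5 κ₅ using (corners; all-corners)

  abstract
    via : ∀ {x p v p₁ p₂} → Nbrs p v p₁ p₂ → ¬ x ~ v → T (κ₅ x p) → x ~ p₁ ⊎ x ~ p₂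
    via N x≁v h with κ₅⁻ h
    ... | m , xm , mp with Nbrs.only N (! mp)
    ... | inj₁ refl = contradiction xm x≁v
    ... | inj₂ (inj₁ refl) = inj₁ xm
    ... | inj₂ (inj₂ refl) = inj₂ xm

    -- The two pentagons on `p v q` leave `p` by `p₁` and by `p₂`. They arrive at `q` by different
    -- vertices, since a common one would close a 4-cycle through `p`.
    matching : ∀ {v p q p₁ p₂} → v ~ q → p ≢ q → X p v q ≡ 2 → Nbrs p v p₁ p₂
      → ∃ λ q₁ → ∃ λ q₂ → Nbrs q v q₁ q₂ × p₁ ~ q₁ × p₂ ~ q₂
    matching {v} {p} {q} {p₁} {p₂} vq p≢q h N@(nbrs pv pp₁ pp₂ v≢p₁ v≢p₂ p₁≢p₂ _) =
      let m₁ , p₁m₁ , m₁q = κ₅⁻ (X≡2⇒ pv h′ pp₁ (v≢p₁ ∘ sym))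
          m₂ , p₂m₂ , m₂q = κ₅⁻ (X≡2⇒ pv h′ pp₂ (v≢p₂ ∘ sym))
          p≢m₁ = λ p≡m₁ → no₃ (! vq) (! pv) (subst (_~ q) (sym p≡m₁) m₁q)
          m₁≢m₂ = λ m₁≡m₂ → no₄ pp₁ p₁m₁ (! (subst (p₂ ~_) (sym m₁≡m₂) p₂m₂)) (! pp₂) p≢m₁ p₁≢p₂
      in m₁ , m₂ , nbrs₃ (! vq) (! m₁q) (! m₂q)
           (λ e → no₃ pv (! (subst (p₁ ~_) (sym e) p₁m₁)) (! pp₁))
           (λ e → no₃ pv (! (subst (p₂ ~_) (sym e) p₂m₂)) (! pp₂)) m₁≢m₂ , p₁m₁ , p₂m₂
      where
      h′ : X q v p ≡ 2
      h′ = trans (Xsym (! vq) (! pv) (p≢q ∘ sym)) h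

  -- The two 5-cycles through r v q leave q by both remaining edges, so the corners of q at the
  -- edge q v are both positive; they sum to 2, as do 0 and 2 at v.
  no-0y2 : Fin n → ∀ {y} → ¬ Balanced 0 y 2
  no-0y2 v {y} bal = let p , q , r , N , pq , _ , qr = star bal v in go N pq qr
    where
    ones : ∀ {i j} → 1 ≤ i → 1 ≤ j → i + j ≡ 2 → i ≡ 1 × j ≡ 1
    ones {suc zero} {suc zero} _ _ _ = refl , refl
    ones {suc zero} {suc (suc j)} _ _ ()
    ones {suc (suc i)} {suc j} _ _ e = contradiction (trans (sym (ℕₚ.+-suc i j)) (ℕₚ.suc-injective (ℕₚ.suc-injective e))) λ ()
    go : ∀ {p q r} → Nbrs v p q r → X p v q ≡ 0 → X q v r ≡ 2 → ⊥
    go {p} {q} {r} N@(nbrs vp vq vr p≢q p≢r q≢r _) pq qr =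
      let q₁ , q₂ , Nq@(nbrs qv qq₁ qq₂ v≢q₁ v≢q₂ q₁≢q₂ _) = nbrs₁ (! vq)
          rq = trans (Xsym (! vr) vq (q≢r ∘ sym)) qr
          pos = λ {t} (qt : q ~ t) (v≢t : v ≢ t) →
            let m , tm , mr = κ₅⁻ (X≡2⇒ qv rq qt (v≢t ∘ sym))
            in subst (1 ≤_) (Xsym (! qt) qv (v≢t ∘ sym)) (X≥1 {t} vq vr (q≢r ∘ sym) (κ₅⁺ (! mr) (! tm)))
          sum = trans (cong₂ _+_ (Xsym vq qq₁ v≢q₁) (Xsym vq qq₂ v≢q₂))
                  (trans (sym (R.ε-sym κ₅-sym (swap₁₂ N) Nq)) (cong₂ _+_ pq rq))
          one₁ , one₂ = ones (pos qq₁ v≢q₁) (pos qq₂ v≢q₂) sum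
      in corners Xsym bal (λ i j _ → i ≡ 1 → j ≡ 1 → ⊥)
           (λ ()) (λ ()) (λ _ ()) (λ _ ()) (λ ()) (λ ()) Nq one₁ one₂

  -- Around a 5-cycle, edges lying on one and on two 5-cycles alternate.
  no-011 : Fin n → ¬ Balanced 0 1 1
  no-011 v bal =
    let p , q , r , N , _ , pr , _ = star bal v
        nbrs vp vq vr p≢q p≢r q≢r _ = N
        x , rx , x≢v , h = X≥1⇒ (! vr) (subst (1 ≤_) (sym pr) (s≤s z≤n))
        y , xy , yp = κ₅⁻ h
    in odd (! vp) vr rx xy yp
    where
    third : ∀ {a b c} → a ~ b → b ~ c → a ≢ c → ∃ λ t → Nbrs b a c t
    third ab bc a≢c = nbrs₂ (! ab) bc a≢c
    -- A positive corner has value `1`; of the other two corners at `b` one is `0` and one is `1`,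
    -- so its two edges lie on one and on two pentagons.
    sum₃ : ∀ {a b c t} → Nbrs b a c t → 1 ≤ X a b c → (X a b c + X t b c) + (X c b a + X t b a) ≡ 3
    sum₃ {a} {b} {c} {t} N@(nbrs ba bc bt a≢c a≢t c≢t _) h =
      trans (cong₂ _+_ (cong (X a b c +_) (Xsym (! bt) bc (c≢t ∘ sym)))
                       (cong₂ _+_ (Xsym (! bc) ba (a≢c ∘ sym)) (Xsym (! bt) ba (a≢t ∘ sym))))
        (corners Xsym bal (λ i j k → 1 ≤ i → (i + k) + (i + j) ≡ 3)
          (λ ()) (λ ()) (λ _ → refl) (λ _ → refl) (λ _ → refl) (λ _ → refl) N h)
    -- Equal consecutive sums make terms two steps apart equal. On a cycle of odd length this
    -- reaches a neighbouring term, and `3` would be even.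
    odd-sums : ∀ {a b c d e} → a + b ≡ 3 → b + c ≡ 3 → c + d ≡ 3 → d + e ≡ 3 → e + a ≡ 3 → ⊥
    odd-sums {a} {b} {c} {d} {e} ab bc cd de ea = even≢3 a (trans (cong (_+ a) a≡e) ea)
      where
      a≡c : a ≡ c
      a≡c = ℕₚ.+-cancelʳ-≡ b a c (trans ab (sym (trans (ℕₚ.+-comm c b) bc)))
      c≡e : c ≡ e
      c≡e = ℕₚ.+-cancelʳ-≡ d c e (trans cd (sym (trans (ℕₚ.+-comm e d) de)))
      a≡e = trans a≡c c≡e
      even≢3 : ∀ a → a + a ≡ 3 → ⊥
      even≢3 (suc (suc (suc a))) e = contradiction (ℕₚ.m+n≡0⇒n≡0 a (ℕₚ.suc-injective (ℕₚ.suc-injective (ℕₚ.suc-injective e)))) λ ()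
    link : ∀ {e a b c t t′} → Nbrs a e b t → Nbrs b a c t′ → 1 ≤ X a b c → (X e a b + X t a b) + (X a b c + X t′ b c) ≡ 3
    link {a = a} {b} {c} {t′ = t′} Na Nb h =
      trans (cong (_+ (X a b c + X t′ b c)) (R.ε-sym κ₅-sym (swap₁₂ Na) Nb)) (trans (ℕₚ.+-comm _ (X a b c + X t′ b c)) (sum₃ Nb h))
    odd : ∀ {a b c d e} → a ~ b → b ~ c → c ~ d → d ~ e → e ~ a → ⊥
    odd {a} {b} {c} {d} {e} ab bc cd de ea =
      let a≢c = λ a≡c → no₃ (subst (_~ d) (sym a≡c) cd) de ea
          b≢d = λ b≡d → no₃ (subst (_~ e) (sym b≡d) de) ea ab
          c≢e = λ c≡e → no₃ (subst (_~ a) (sym c≡e) ea) ab bc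
          d≢a = λ d≡a → no₃ (subst (_~ b) (sym d≡a) ab) bc cd
          e≢b = λ e≡b → no₃ (subst (_~ c) (sym e≡b) bc) cd de
          ta , Na = third ea ab e≢b
          tb , Nb = third ab bc a≢c
          tc , Nc = third bc cd b≢d
          td , Nd = third cd de c≢e
          te , Ne = third de ea d≢a
      in odd-sums {X e a b + X ta a b} {X a b c + X tb b c} {X b c d + X tc c d} {X c d e + X td d e} {X d e a + X te e a}
           (link Na Nb (X≥1 (! bc) cd (b≢d ∘ sym) (κ₅⁺ de ea)))
           (link Nb Nc (X≥1 (! cd) de (c≢e ∘ sym) (κ₅⁺ ea ab)))
           (link Nc Nd (X≥1 (! de) ea (d≢a ∘ sym) (κ₅⁺ ab bc)))
           (link Nd Ne (X≥1 (! ea) ab (e≢b ∘ sym) (κ₅⁺ bc cd)))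
           (link Ne Na (X≥1 (! ab) bc (a≢c ∘ sym) (κ₅⁺ cd de)))

-- Girth five: the triple (1,1,2) is impossible

module GirthFive-112 {n : ℕ} (Γ : Graph n) (cubic : Cubic Γ)
  (no₃ : Girths.TriangleFree Γ cubic) (no₄ : Girths.SquareFree Γ cubic) (bal : Girths.S₅.Balanced Γ cubic 1 1 2) where

  open Cub Γ cubic
  open Girths Γ cubic
  open Corner κ₅
  open GirthFive Γ cubic no₃ no₄
  private
    ! : ∀ {u v} → u ~ v → v ~ u
    ! = ~-sym
    Xsym : S₅.X-Symmetric
    Xsym = X₅-sym no₃ no₄
    open module R = Regular Γ cubic 5 κ₅ using (corners)

  2⇒1,1 : ∀ {v a b c} → Nbrs v a b c → X a v b ≡ 2 → X a v c ≡ 1 × X b v c ≡ 1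
  2⇒1,1 = corners Xsym bal (λ i j k → i ≡ 2 → j ≡ 1 × k ≡ 1)
    (λ ()) (λ ()) (λ ()) (λ ()) (λ _ → refl , refl) (λ _ → refl , refl)

  -- The signature is `(2,3,3)`. A corner equal to `2` lies opposite the edge on two pentagons, here
  -- `w s`; at `s` the corners along this edge are then `1` and `1`, which leaves `2` for the third.
  opposite : ∀ {w u t s y z} → Nbrs w u t s → X u w t ≡ 2 → Nbrs s w y z → X y s z ≡ 2
  opposite {w} {u} {t} {s} {y} {z} N h M =
    let us , ts = 2⇒1,1 N h
        nbrs sw sy sz w≢y w≢z y≢z _ = M
        sum = trans (cong₂ _+_ (Xsym (! sw) sy w≢y) (Xsym (! sw) sz w≢z))
                (trans (sym (R.ε-sym κ₅-sym (rot² N) M)) (cong₂ _+_ us ts))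
    in corners Xsym bal (λ i j k → i + j ≡ 2 → k ≡ 2)
         (λ _ → refl) (λ ()) (λ _ → refl) (λ ()) (λ ()) (λ ()) M sum

  -- Three pentagons through `v` are fixed: `v p p₁ q₁ q` and `v p p₂ q₂ q` on the corner equal to
  -- `2`, and `v p p₂ r₁ r` on `p v r`.
  module Configuration {v p q r p₁ p₂ q₁ q₂ r₁ r₂ s : Fin n}
    (Nv : Nbrs v p q r) (pq : X p v q ≡ 2)
    (Np : Nbrs p v p₁ p₂) (Nq : Nbrs q v q₁ q₂) (Nr : Nbrs r v r₁ r₂)
    (Np₁ : Nbrs p₁ p q₁ s) (Np₂ : Nbrs p₂ p q₂ r₁) where

    private
      module V = Nbrs Nv
      module P = Nbrs Np
      module Q = Nbrs Nq
      module R′ = Nbrs Nr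
      module P₁ = Nbrs Np₁
      module P₂ = Nbrs Np₂

    -- The corner `p v r` equals `1`, and its pentagon already passes through `p₂`.
    p₁-r : ¬ T (κ₅ p₁ r)
    p₁-r h = P.q≢r (X≡1⇒ P.~p (trans (Xsym (! V.~r) V.~p (V.p≢r ∘ sym)) (proj₁ (2⇒1,1 Nv pq)))
      P.~q (P.p≢q ∘ sym) h P.~r (P.p≢r ∘ sym) (κ₅⁺ P₂.~r (! R′.~q)))

    only-q-r : ∀ {x y} → q ~ x → x ≢ v → T (κ₅ x r) → q ~ y → y ≢ v → T (κ₅ y r) → x ≡ y
    only-q-r = X≡1⇒ (! V.~q) (trans (Xsym (! V.~r) V.~q (V.q≢r ∘ sym)) (proj₂ (2⇒1,1 Nv pq)))

    vpp₂ : X v p p₂ ≡ 2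
    vpp₂ = X≡2 Np₂ (κ₅⁺ (! Q.~r) Q.~p) (κ₅⁺ (! R′.~q) R′.~p)

    vpp₁ : X v p p₁ ≡ 1
    vpp₁ = proj₁ (2⇒1,1 (swap₂₃ Np) vpp₂)

    q₁p₁s : X q₁ p₁ s ≡ 2
    q₁p₁s = opposite (swap₂₃ Np) vpp₂ Np₁

    vrr₂ : X v r r₂ ≡ 1
    vrr₂ = trans (Xsym V.~r R′.~r R′.p≢r) (proj₂ (2⇒1,1 (rot Nr) (opposite Nv pq Nr)))

    -- The pentagon on `v r r₂` returns to `v` through `p` or `q`; the return through `p` is
    -- excluded by triangles, 4-cycles and `p₁-r`.
    r₂-q : r₂ ~ q₁ ⊎ r₂ ~ q₂
    r₂-q with X≥1⇒ (! R′.~r) (subst (1 ≤_) (sym vrr₂) (s≤s z≤n))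
    ... | x , r₂x , x≢r , h with κ₅⁻ h
    ... | m , xm , mv with Nbrs.only Nv (! mv)
    ... | inj₂ (inj₂ refl) = ⊥-elim (no₃ R′.~r r₂x xm)
    ... | inj₁ refl = case Nbrs.only Np (! xm) of λ where
            (inj₁ refl) → ⊥-elim (no₃ V.~r R′.~r r₂x)
            (inj₂ (inj₁ refl)) → ⊥-elim (p₁-r (κ₅⁺ (! r₂x) (! R′.~r)))
            (inj₂ (inj₂ refl)) → ⊥-elim (no₄ R′.~q (! P₂.~r) (! r₂x) (! R′.~r) (λ { refl → no₃ V.~p P.~r (! V.~r) }) R′.q≢r)
    ... | inj₂ (inj₁ refl) = case Nbrs.only Nq (! xm) of λ where
            (inj₁ refl) → ⊥-elim (no₃ V.~r R′.~r r₂x)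
            (inj₂ (inj₁ refl)) → inj₁ r₂x
            (inj₂ (inj₂ refl)) → inj₂ r₂x

    -- Two corners at `p₂` are not `2`, so `p p₂ r₁` is, and the third neighbour `u` of `r₁` has a
    -- path of length two to `p`. It runs through `p₁`, and `u` fails to be any of the neighbours of
    -- `p₁`.
    case-q₂ : ∀ {u} → Nbrs r₁ r p₂ u → r₂ ~ q₂ → ⊥
    case-q₂ {u} Nr₁ r₂q₂ = case via Np (λ uv → no₄ uv V.~r R′.~q R₁.~r (R₁.p≢r ∘ sym) R′.p≢q) u-p of λ where
        (inj₂ up₂) → no₃ R₁.~q (! up₂) (! R₁.~r)
        (inj₁ up₁) → case Nbrs.only Np₁ (! up₁) of λ where
          (inj₁ refl) → no₃ P.~r P₂.~r R₁.~r
          (inj₂ (inj₁ refl)) → Q.q≢r (only-q-r Q.~q (Q.p≢q ∘ sym) (κ₅⁺ (! R₁.~r) (! R′.~q)) Q.~r (Q.p≢r ∘ sym) (κ₅⁺ (! r₂q₂) (! R′.~r)))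
          (inj₂ (inj₂ u≡s)) → r₁-q₁ (subst (r₁ ~_) u≡s R₁.~r) u≡s
      where
      module R₁ = Nbrs Nr₁
      r₂-p : ¬ T (κ₅ r₂ p)
      r₂-p h with κ₅⁻ h
      ... | m , r₂m , mp with Nbrs.only Np (! mp)
      ... | inj₁ refl = no₃ V.~r R′.~r r₂m
      ... | inj₂ (inj₁ refl) = p₁-r (κ₅⁺ (! r₂m) (! R′.~r))
      ... | inj₂ (inj₂ refl) = no₃ P₂.~q (! r₂q₂) r₂m
      pp₂q₂ : X p p₂ q₂ ≤ 1
      pp₂q₂ = X≤1 (! P₂.~q) (! r₂q₂) (λ e → no₃ R′.~q (! P₂.~r) (subst (_~ r) e (! R′.~r))) r₂-p
      q₂p₂r₁ : X q₂ p₂ r₁ ≢ 2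
      q₂p₂r₁ h = contradiction (trans (sym (opposite (rot Np₂) h (rot² Np))) vpp₁) λ ()
      pp₂r₁ : X p p₂ r₁ ≡ 2
      pp₂r₁ = corners Xsym bal (λ i j k → i ≤ 1 → k ≢ 2 → j ≡ 2)
        (λ _ h → contradiction refl h) (λ _ _ → refl) (λ _ h → contradiction refl h) (λ _ _ → refl)
        (λ { (s≤s ()) }) (λ { (s≤s ()) }) Np₂ pp₂q₂ q₂p₂r₁
      u-p : T (κ₅ u p)
      u-p = X≡2⇒ R₁.~q pp₂r₁ R₁.~r (R₁.q≢r ∘ sym)
      r₁-q₁ : r₁ ~ s → u ≡ s → ⊥
      r₁-q₁ r₁s u≡s with κ₅⁻ (X≡2⇒ (! P₁.~r) q₁p₁s (! r₁s) (λ e → no₃ P.~q (subst (_~ p₂) e (! P₂.~r)) (! P.~r)))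
      ... | m , r₁m , mq₁ with Nbrs.only Nr₁ r₁m
      ... | inj₁ refl = no₄ V.~q Q.~q (! mq₁) (! V.~r) Q.p≢q V.q≢r
      ... | inj₂ (inj₁ refl) = no₄ P.~q P₁.~q (! mq₁) (! P.~r) P₁.p≢q P.q≢r
      ... | inj₂ (inj₂ m≡u) = no₃ P₁.~q (! (subst (_~ q₁) (trans m≡u u≡s) mq₁)) (! P₁.~r)

    -- Two corners at `q₁` are not `2`, so `q q₁ p₁` is, which gives `s` a path of length two to
    -- `q`. Only `s ≡ t` with `s ~ q₂` survives; then the third neighbour of `s` is adjacent to `r₁`
    -- and `r₂` and closes a 4-cycle with `r`.
    case-q₁ : ∀ {t} → Nbrs q₁ q p₁ r₂ → Nbrs q₂ q p₂ t → ⊥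
    case-q₁ {t} Nq₁ Nq₂ = case via Nq (λ sv → no₄ sv V.~p P.~q P₁.~r (P₁.p≢r ∘ sym) P.p≢q) s-q of λ where
        (inj₁ sq₁) → no₃ P₁.~q (! sq₁) (! P₁.~r)
        (inj₂ sq₂) → case Nbrs.only Nq₂ (! sq₂) of λ where
          (inj₁ s≡q) → no₃ Q.~q Q₁.~q (subst (p₁ ~_) s≡q P₁.~r)
          (inj₂ (inj₁ s≡p₂)) → no₃ P.~q (subst (p₁ ~_) s≡p₂ P₁.~r) (! P.~r)
          (inj₂ (inj₂ s≡t)) → square sq₂ s≡t
      where
      module Q₁ = Nbrs Nq₁
      module Q₂ = Nbrs Nq₂
      q₂-r : ¬ T (κ₅ q₂ r)
      q₂-r h = Q.q≢r (only-q-r Q.~q (Q.p≢q ∘ sym) (κ₅⁺ Q₁.~r (! R′.~r)) Q.~r (Q.p≢r ∘ sym) h)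
      vqq₁ : X v q q₁ ≡ 2
      vqq₁ = X≡2 Nq₁ (κ₅⁺ (! P.~q) P.~p) (κ₅⁺ (! R′.~r) R′.~p)
      vqq₂ : X v q q₂ ≡ 1
      vqq₂ = proj₁ (2⇒1,1 Nq vqq₁)
      p₂q₂t : X p₂ q₂ t ≡ 2
      p₂q₂t = opposite Nq vqq₁ Nq₂
      qq₁r₂ : X q q₁ r₂ ≢ 2
      qq₁r₂ h = contradiction (trans (sym (opposite (swap₂₃ Nq₁) h (swap₁₂ Np₁)))
        (trans (Xsym P.~q P₁.~r P₁.p≢r) (proj₂ (2⇒1,1 (rot Np₁) q₁p₁s)))) λ ()
      p₁q₁r₂ : X p₁ q₁ r₂ ≢ 2
      p₁q₁r₂ h = contradiction (trans (sym (opposite (rot Nq₁) h (swap₁₂ Nq))) vqq₂) λ ()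
      qq₁p₁ : X q q₁ p₁ ≡ 2
      qq₁p₁ = corners Xsym bal (λ i j k → j ≢ 2 → k ≢ 2 → i ≡ 2)
        (λ _ h → contradiction refl h) (λ h _ → contradiction refl h) (λ _ h → contradiction refl h)
        (λ h _ → contradiction refl h) (λ _ _ → refl) (λ _ _ → refl) Nq₁ qq₁r₂ p₁q₁r₂
      s-q : T (κ₅ s q)
      s-q = X≡2⇒ P₁.~q qq₁p₁ P₁.~r (P₁.q≢r ∘ sym)
      square : s ~ q₂ → s ≡ t → ⊥
      square sq₂ s≡t =
        let w , r₂w , ws = κ₅⁻ (X≡2⇒ {s} Q₁.~q (trans (Xsym (! P₁.~r) P₁.~q (P₁.q≢r ∘ sym)) q₁p₁s) Q₁.~r (Q₁.q≢r ∘ sym))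
            u , r₁u , us = κ₅⁻ (X≡2⇒ {s} P₂.~q (trans (Xsym sq₂ Q₂.~q (λ e → Q₂.q≢r (trans (sym e) s≡t))) (subst (λ t → X p₂ q₂ t ≡ 2) (sym s≡t) p₂q₂t))
                              P₂.~r (P₂.q≢r ∘ sym))
            s₃ , Ns = nbrs₂ (! P₁.~r) sq₂ (λ e → no₃ P.~q (subst (_~ p₂) (sym e) (! P₂.~q)) (! P.~r))
            w≡s₃ = only₁ Ns (! ws) (λ e → p₁-r (κ₅⁺ (! (subst (r₂ ~_) e r₂w)) (! R′.~r)))
                                   (λ e → q₂-r (κ₅⁺ (! (subst (r₂ ~_) e r₂w)) (! R′.~r)))
            u≡s₃ = only₁ Ns (! us) (λ e → p₁-r (κ₅⁺ (! (subst (r₁ ~_) e r₁u)) (! R′.~q)))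
                                   (λ e → q₂-r (κ₅⁺ (! (subst (r₁ ~_) e r₁u)) (! R′.~q)))
        in no₄ r₁u (! (subst (r₂ ~_) (trans w≡s₃ (sym u≡s₃)) r₂w)) (! R′.~r) R′.~q R′.q≢r
             (λ e → p₁-r (κ₅⁺ P₁.~r (! (subst (_~ s) e us))))

    impossible : ⊥
    impossible = case r₂-q of λ where
      (inj₁ r₂q₁) → case-q₁
        (nbrs₃ (! Q.~q) (! P₁.~q) (! r₂q₁) (λ e → no₃ V.~p (subst (p ~_) (sym e) P.~q) (! V.~q))
          (λ e → no₃ V.~r (subst (r ~_) (sym e) R′.~r) (! V.~q)) (λ e → no₄ V.~p P.~q (subst (_~ r) (sym e) (! R′.~r)) (! V.~r) P.p≢q V.p≢r))
        (proj₂ (nbrs₂ (! Q.~r) (! P₂.~q) (λ e → no₃ V.~p (subst (p ~_) (sym e) P.~r) (! V.~q))))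
      (inj₂ r₂q₂) → case-q₂ (proj₂ (nbrs₂ (! R′.~q) (! P₂.~r) (λ e → no₃ V.~p (subst (p ~_) (sym e) P.~r) (! V.~r)))) r₂q₂

  absurd : Fin n → ⊥
  absurd v = let _ , _ , _ , N , _ , _ , pq = S₅.Balanced.star bal v in around (rot N) pq
    where
    configure : ∀ {v p q r p₁ p₂ q₁ q₂ r₁} → Nbrs v p q r → X p v q ≡ 2 → Nbrs p v p₁ p₂ → Nbrs q v q₁ q₂
      → p₁ ~ q₁ → p₂ ~ q₂ → p₂ ~ r₁ → r ~ r₁ → ⊥
    configure {v} {p} {q} {r} {p₁} {p₂} {q₁} {q₂} {r₁} Nv@(nbrs vp vq vr p≢q p≢r q≢r _) pq
              Np@(nbrs pv pp₁ pp₂ v≢p₁ v≢p₂ p₁≢p₂ _) Nq@(nbrs qv qq₁ qq₂ v≢q₁ v≢q₂ q₁≢q₂ _) p₁q₁ p₂q₂ p₂r₁ rr₁ =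
      let _ , Nr = nbrs₂ (! vr) rr₁ (λ e → no₃ vp pp₂ (subst (p₂ ~_) (sym e) p₂r₁))
          _ , Np₁ = nbrs₂ (! pp₁) p₁q₁ (λ e → no₃ vp (subst (_~ q) (sym e) (! qq₁)) qv)
          Np₂ = nbrs₃ (! pp₂) p₂q₂ p₂r₁ (λ e → no₃ vp (subst (_~ q) (sym e) (! qq₂)) qv)
                  (λ e → no₃ vp (subst (_~ r) (sym e) (! rr₁)) (! vr))
                  (λ e → no₄ vq qq₂ (subst (_~ r) (sym e) (! rr₁)) (! vr) v≢q₂ q≢r)
      in Configuration.impossible Nv pq Np Nq Nr Np₁ Np₂
    -- The pentagon on `p v r` leaves `p` by `p₁` or `p₂`; exchanging the indices of both matched
    -- pairs reduces to `p₂`.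
    around : ∀ {v p q r} → Nbrs v p q r → X p v q ≡ 2 → ⊥
    around Nv@(nbrs vp vq vr p≢q p≢r q≢r _) pq with nbrs₁ (! vp)
    ... | _ , _ , Np with matching vq p≢q pq Np
    ... | _ , _ , Nq , p₁q₁ , p₂q₂
        with X≥1⇒ (! vp) (subst (1 ≤_) (sym (trans (Xsym (! vr) vp (p≢r ∘ sym)) (proj₁ (2⇒1,1 Nv pq)))) (s≤s z≤n))
    ... | _ , px , x≢v , h with κ₅⁻ h | only₂ Np px x≢v
    ... | _ , xr₁ , r₁r | inj₂ refl = configure Nv pq Np Nq p₁q₁ p₂q₂ xr₁ (! r₁r)
    ... | _ , xr₁ , r₁r | inj₁ refl = configure Nv pq (swap₂₃ Np) (swap₂₃ Nq) p₂q₂ p₁q₁ xr₁ (! r₁r)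

-- Girth five: the triple (1,2,2) is impossible

module GirthFive-122 {n : ℕ} (Γ : Graph n) (cubic : Cubic Γ)
  (no₃ : Girths.TriangleFree Γ cubic) (no₄ : Girths.SquareFree Γ cubic) (bal : Girths.S₅.Balanced Γ cubic 1 2 2) where

  open Cub Γ cubic
  open Girths Γ cubic
  open Corner κ₅
  open GirthFive Γ cubic no₃ no₄
  private
    ! : ∀ {u v} → u ~ v → v ~ u
    ! = ~-sym
    Xsym : S₅.X-Symmetric
    Xsym = X₅-sym no₃ no₄
    open module R = Regular Γ cubic 5 κ₅ using (corners)

  1⇒2,2 : ∀ {v a b c} → Nbrs v a b c → X a v b ≡ 1 → X a v c ≡ 2 × X b v c ≡ 2
  1⇒2,2 = corners Xsym bal (λ i j k → i ≡ 1 → j ≡ 2 × k ≡ 2)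
    (λ _ → refl , refl) (λ _ → refl , refl) (λ ()) (λ ()) (λ ()) (λ ())

  -- The signature is `(3,3,4)`. A corner equal to `1` lies opposite the edge on four pentagons, and
  -- at its other end `s` the sum `4` again forces the corners `2` and `2`.
  opposite : ∀ {w u t s y z} → Nbrs w u t s → X u w t ≡ 1 → Nbrs s w y z → X y s z ≡ 1
  opposite {w} {u} {t} {s} {y} {z} N h M =
    let us , ts = 1⇒2,2 N h
        nbrs sw sy sz w≢y w≢z y≢z _ = M
        sum = trans (cong₂ _+_ (Xsym (! sw) sy w≢y) (Xsym (! sw) sz w≢z))
                (trans (sym (R.ε-sym κ₅-sym (rot² N) M)) (cong₂ _+_ us ts))
    in corners Xsym bal (λ i j k → i + j ≡ 4 → k ≡ 1)
         (λ ()) (λ ()) (λ ()) (λ _ → refl) (λ ()) (λ _ → refl) M sum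

  -- The pentagon on `p v q` is `v p p₁ q₂ q`. The vertex `s` beyond `p₂` has no path of length two
  -- to `v`, so `v p p₂` is the small corner at `p`; by `opposite` the small corner at `p₁` is
  -- `r₁ p₁ q₂`, so `p p₁ r₁` equals `2`. Then `q₁` must reach `p`, by a triangle or by a second
  -- pentagon on `p v q`.
  configuration : ∀ {v p q r p₁ p₂ q₁ q₂ r₁ r₂} → Nbrs v p q r → X p v q ≡ 1 → Nbrs p v p₁ p₂ → Nbrs q v q₁ q₂ → Nbrs r v r₁ r₂
    → p₁ ~ r₁ → p₂ ~ r₂ → r₁ ~ q₁ → r₂ ~ q₂ → q₂ ~ p₁ → ⊥
  configuration {v} {p} {q} {r} {p₁} {p₂} {q₁} {q₂} {r₁} {r₂} Nv@(nbrs vp vq vr p≢q p≢r q≢r _) pq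
    Np@(nbrs pv pp₁ pp₂ v≢p₁ v≢p₂ p₁≢p₂ _) Nq@(nbrs qv qq₁ qq₂ v≢q₁ v≢q₂ q₁≢q₂ _) Nr@(nbrs rv rr₁ rr₂ v≢r₁ v≢r₂ r₁≢r₂ _)
    p₁r₁ p₂r₂ r₁q₁ r₂q₂ q₂p₁ =
    let r₁≢q₂ = λ e → no₄ vq qq₂ (subst (_~ r) e (! rr₁)) (! vr) v≢q₂ q≢r
        Np₁ = nbrs₃ (! pp₁) p₁r₁ (! q₂p₁) (λ e → no₃ vp (subst (_~ r) (sym e) (! rr₁)) rv)
                (λ e → no₃ vp (subst (_~ q) (sym e) (! qq₂)) qv) r₁≢q₂
        s , Np₂ = nbrs₂ (! pp₂) p₂r₂ (λ e → no₃ vp (subst (_~ r) (sym e) (! rr₂)) rv)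
        r₁p₁q₂ = opposite (swap₂₃ Np) (vpp₂ Np₂) Np₁
        pp₁r₁ = trans (Xsym pp₁ p₁r₁ (Nbrs.p≢q Np₁)) (proj₁ (1⇒2,2 (rot Np₁) r₁p₁q₂))
        q₁-p = X≡2⇒ (! p₁r₁) pp₁r₁ r₁q₁ (λ e → no₄ vp (subst (p ~_) (sym e) pp₁) (! qq₁) qv v≢q₁ p≢q)
    in case via Np (λ q₁v → no₃ vq qq₁ q₁v) q₁-p of λ where
         (inj₁ q₁p₁) → no₃ p₁r₁ r₁q₁ q₁p₁
         (inj₂ q₁p₂) → q₁≁p₂ q₁p₂
    where
    q₁≁p₂ : ¬ q₁ ~ p₂
    q₁≁p₂ h = q₁≢q₂ (X≡1⇒ qv pq qq₁ (v≢q₁ ∘ sym) (κ₅⁺ h (! pp₂)) qq₂ (v≢q₂ ∘ sym) (κ₅⁺ q₂p₁ (! pp₁)))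
    module _ {s} (Np₂ : Nbrs p₂ p r₂ s) where
      module P₂ = Nbrs Np₂
      s-v : ¬ T (κ₅ s v)
      s-v h with κ₅⁻ h
      ... | m , sm , mv with Nbrs.only Nv (! mv)
      ... | inj₁ refl = no₃ pp₂ P₂.~r sm
      ... | inj₂ (inj₂ refl) = no₄ P₂.~r sm rr₂ (! p₂r₂) (λ e → no₃ vp (subst (p ~_) e pp₂) rv) (P₂.q≢r ∘ sym)
      ... | inj₂ (inj₁ refl) = case Nbrs.only Nq (! sm) of λ where
              (inj₁ refl) → no₃ vp pp₂ P₂.~r
              (inj₂ (inj₁ refl)) → q₁≁p₂ (! P₂.~r)
              (inj₂ (inj₂ refl)) → no₃ P₂.~r (! r₂q₂) (! p₂r₂)
      vpp₂ : X v p p₂ ≡ 1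
      vpp₂ = corners Xsym bal (λ i _ _ → i ≤ 1 → i ≡ 1) (λ _ → refl) (λ _ → refl)
        (λ { (s≤s ()) }) (λ { (s≤s ()) }) (λ { (s≤s ()) }) (λ { (s≤s ()) })
        (swap₂₃ Np) (X≤1 (! pp₂) P₂.~r (P₂.p≢r ∘ sym) s-v)

  absurd : Fin n → ⊥
  absurd v = let _ , _ , _ , N , pq , pr , qr = S₅.Balanced.star bal v in around N pq pr qr
    where
    -- The two matchings form the paths `p₁ r₁ q₁` and `p₂ r₂ q₂`. The pentagon on `p v q` adds an
    -- edge between these paths, because an edge within one would close a triangle.
    around : ∀ {v p q r} → Nbrs v p q r → X p v q ≡ 1 → X p v r ≡ 2 → X q v r ≡ 2 → ⊥
    around Nv@(nbrs vp vq vr p≢q p≢r q≢r _) pq pr qr with nbrs₁ (! vp)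
    ... | _ , _ , Np with matching vr p≢r pr Np
    ... | _ , _ , Nr , p₁r₁ , p₂r₂ with matching vq (q≢r ∘ sym) (trans (Xsym (! vr) vq (q≢r ∘ sym)) qr) Nr
    ... | _ , _ , Nq , r₁q₁ , r₂q₂ with X≥1⇒ (! vq) (subst (1 ≤_) (sym pq) (s≤s z≤n))
    ... | _ , qx , x≢v , h with only₂ Nq qx x≢v | via Np (λ xv → no₃ vq qx xv) h
    ... | inj₁ refl | inj₁ q₁p₁ = no₃ p₁r₁ r₁q₁ q₁p₁
    ... | inj₂ refl | inj₂ q₂p₂ = no₃ p₂r₂ r₂q₂ q₂p₂
    ... | inj₂ refl | inj₁ q₂p₁ = configuration Nv pq Np Nq Nr p₁r₁ p₂r₂ r₁q₁ r₂q₂ q₂p₁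
    ... | inj₁ refl | inj₂ q₁p₂ = configuration Nv pq (swap₂₃ Np) (swap₂₃ Nq) (swap₂₃ Nr) p₂r₂ p₁r₁ r₂q₂ r₁q₁ q₁p₂

-- Finite models of the Petersen graph and the dodecahedron

module Petersen where

  -- `0F` is a root, `1F` to `3F` are its neighbours, and the remaining vertices follow in pairs
  -- below these, in the order in which they are found in Γ.
  nb : Fin 10 → Fin 3 → Fin 10
  nb a = lookup (lookup table a)
    where
    table : Vec (Vec (Fin 10) 3) 10
    table = (1F ∷ 2F ∷ 3F ∷ []) ∷ (0F ∷ 4F ∷ 5F ∷ []) ∷ (0F ∷ 6F ∷ 7F ∷ []) ∷ (0F ∷ 8F ∷ 9F ∷ [])
      ∷ (1F ∷ 6F ∷ 9F ∷ []) ∷ (1F ∷ 7F ∷ 8F ∷ []) ∷ (2F ∷ 4F ∷ 8F ∷ []) ∷ (2F ∷ 5F ∷ 9F ∷ [])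
      ∷ (3F ∷ 6F ∷ 5F ∷ []) ∷ (3F ∷ 7F ∷ 4F ∷ []) ∷ []

  pair : Fin 10 → Fin 5 × Fin 5
  pair = lookup ((0F , 1F) ∷ (2F , 3F) ∷ (2F , 4F) ∷ (3F , 4F) ∷ (0F , 4F) ∷ (1F , 4F) ∷ (1F , 3F) ∷ (0F , 3F)
    ∷ (0F , 2F) ∷ (1F , 2F) ∷ [])

  Increasing : Fin 5 × Fin 5 → Set
  Increasing p = T (toℕ (proj₁ p) ℕ.<ᵇ toℕ (proj₂ p))

  to : Fin 10 → Pet
  to k = pair k , from-yes (all? λ k → T? (toℕ (proj₁ (pair k)) ℕ.<ᵇ toℕ (proj₂ (pair k)))) k

  _≟₂_ : (p q : Fin 5 × Fin 5) → Dec (p ≡ q)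
  _≟₂_ = ≡-dec _≟_ _≟_

  abstract
    pair-onto : ∀ i j → Increasing (i , j) → ∃ λ k → pair k ≡ (i , j)
    pair-onto = from-yes (all? λ i → all? λ j → T? (toℕ i ℕ.<ᵇ toℕ j) →-dec any? λ k → pair k ≟₂ (i , j))

    pair-inj : ∀ k l → pair k ≡ pair l → k ≡ l
    pair-inj = from-yes (all? λ k → all? λ l → (pair k ≟₂ pair l) →-dec (k ≟ l))

    back : ∀ a i → ∃ λ j → nb (nb a i) j ≡ a
    back = from-yes (all? λ a → all? λ i → any? λ j → nb (nb a i) j ≟ a)

    -- The diameter is two, so `near₂-inj` alone makes a covering by this model injective.
    two-steps : ∀ a b → a ≡ b ⊎ (∃ λ i → nb a i ≡ b) ⊎ (∃₂ λ i j → nb (nb a i) j ≡ b)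
    two-steps = from-yes (all? λ a → all? λ b →
      (a ≟ b) ⊎-dec any? (λ i → nb a i ≟ b) ⊎-dec any? (λ i → any? λ j → nb (nb a i) j ≟ b))

    adj⇔ : ∀ a b → (∃ λ i → nb a i ≡ b) ⇔ PetAdj (to a) (to b)
    adj⇔ a b = mk⇔ (proj₁ (check a b)) (proj₂ (check a b))
      where
      adj? : ∀ p q → Dec (PetAdj p q)
      adj? ((i , j) , _) ((k , l) , _) = ¬? (i ≟ k) ×-dec ¬? (i ≟ l) ×-dec ¬? (j ≟ k) ×-dec ¬? (j ≟ l)
      check : ∀ a b → ((∃ λ i → nb a i ≡ b) → PetAdj (to a) (to b)) × (PetAdj (to a) (to b) → ∃ λ i → nb a i ≡ b)
      check = from-yes (all? λ a → all? λ b → let d = any? (λ i → nb a i ≟ b) in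
        (d →-dec adj? (to a) (to b)) ×-dec (adj? (to a) (to b) →-dec d))

  from : Pet → Fin 10
  from ((i , j) , t) = proj₁ (pair-onto i j t)

  to∘from : ∀ p → to (from p) ≡ p
  to∘from ((i , j) , t) = same (proj₂ (pair-onto i j t))
    where
    same : ∀ {p q : Pet} → proj₁ p ≡ proj₁ q → p ≡ q
    same {p , s} {_ , t} refl = cong (p ,_) (T-irrelevant s t)

  from∘to : ∀ k → from (to k) ≡ k
  from∘to k = pair-inj _ _ (proj₂ (pair-onto _ _ (proj₂ (to k))))

module Dodecahedron where

  next prev : Fin 5 → Fin 5
  next = lookup (1F ∷ 2F ∷ 3F ∷ 4F ∷ 0F ∷ [])
  prev = lookup (4F ∷ 0F ∷ 1F ∷ 2F ∷ 3F ∷ [])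

  abstract
    next-prev : ∀ i → next (prev i) ≡ i
    next-prev = from-yes (all? λ i → next (prev i) ≟ i)

    prev-next : ∀ i → prev (next i) ≡ i
    prev-next = from-yes (all? λ i → prev (next i) ≟ i)

    next⁴ : ∀ i → next (next (next (next i))) ≡ prev i
    next⁴ = from-yes (all? λ i → next (next (next (next i))) ≟ prev i)

  -- Four layers: two opposite faces 0F and 3F, the neighbours 1F and 2F of their vertices.
  Vertex : Set
  Vertex = Fin 4 × Fin 5

  _≟ⱽ_ : (p q : Vertex) → Dec (p ≡ q)
  _≟ⱽ_ = ≡-dec _≟_ _≟_

  nb : Vertex → Fin 3 → Vertex
  nb (0F , i) = lookup ((0F , prev i) ∷ (0F , next i) ∷ (1F , i) ∷ [])
  nb (1F , i) = lookup ((0F , i) ∷ (2F , prev i) ∷ (2F , i) ∷ [])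
  nb (2F , i) = lookup ((1F , i) ∷ (1F , next i) ∷ (3F , i) ∷ [])
  nb (3F , i) = lookup ((2F , i) ∷ (3F , prev i) ∷ (3F , next i) ∷ [])

  even odd : Fin 5 → Fin 10
  even = lookup (0F ∷ 2F ∷ 4F ∷ 6F ∷ 8F ∷ [])
  odd = lookup (1F ∷ 3F ∷ 5F ∷ 7F ∷ 9F ∷ [])

  -- The inner edges of the target join indices of equal parity, so the inner vertices form two
  -- pentagons, the faces `0F` and `3F`; the outer 10-cycle alternates between the layers `1F` and
  -- `2F`.
  to : Vertex → Fin 10 × Bool
  to (0F , i) = even i , true
  to (1F , i) = even i , false
  to (2F , i) = odd i , false
  to (3F , i) = odd i , true

  allⱽ? : {P : Vertex → Set} → (∀ a → Dec (P a)) → Dec (∀ l i → P (l , i))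
  allⱽ? P? = all? λ l → all? λ i → P? (l , i)

  Walk₁ Walk₂ Walk₃ Walk₄ Walk₅ : Vertex → Vertex → Set
  Walk₁ a b = ∃ λ i → nb a i ≡ b
  Walk₂ a b = ∃₂ λ i j → nb (nb a i) j ≡ b
  Walk₃ a b = ∃₂ λ i j → ∃ λ k → nb (nb (nb a i) j) k ≡ b
  Walk₄ a b = ∃₂ λ i j → nb (nb a i) j ≢ a × ∃₂ λ k l → nb (nb (nb a i) j) k ≢ nb a i × nb (nb (nb (nb a i) j) k) l ≡ b
  -- A walk of length 5 whose first two edges span a pentagon that the third edge leaves.
  Walk₅ a b = ∃₂ λ i j → nb (nb a i) j ≢ a
    × (∃₂ λ k l → ∃ λ m → nb (nb (nb (nb (nb a i) j) k) l) m ≡ b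
    × (∃₂ λ k′ l′ → ∃ λ m′ → nb (nb (nb a i) j) k′ ≢ nb (nb (nb a i) j) k × nb (nb (nb (nb (nb a i) j) k′) l′) m′ ≡ a))

  abstract
    back : ∀ a i → ∃ λ j → nb (nb a i) j ≡ a
    back (l , k) = from-yes (allⱽ? λ a → all? λ i → any? λ j → nb (nb a i) j ≟ⱽ a) l k

    walks : ∀ a b → a ≡ b ⊎ Walk₁ a b ⊎ Walk₂ a b ⊎ Walk₃ a b ⊎ Walk₄ a b ⊎ Walk₅ a b
    walks (l , k) (l′ , k′) = from-yes (allⱽ? λ a → allⱽ? λ b →
      (a ≟ⱽ b) ⊎-dec any? (λ i → nb a i ≟ⱽ b) ⊎-dec any? (λ i → any? λ j → nb (nb a i) j ≟ⱽ b)
      ⊎-dec any? (λ i → any? λ j → any? λ k → nb (nb (nb a i) j) k ≟ⱽ b)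
      ⊎-dec any? (λ i → any? λ j → ¬? (nb (nb a i) j ≟ⱽ a) ×-dec any? λ k → any? λ l →
              ¬? (nb (nb (nb a i) j) k ≟ⱽ nb a i) ×-dec (nb (nb (nb (nb a i) j) k) l ≟ⱽ b))
      ⊎-dec any? (λ i → any? λ j → ¬? (nb (nb a i) j ≟ⱽ a) ×-dec
              any? λ k → any? λ l → any? λ m → (nb (nb (nb (nb (nb a i) j) k) l) m ≟ⱽ b) ×-dec
              any? λ k′ → any? λ l′ → any? λ m′ →
                ¬? (nb (nb (nb a i) j) k′ ≟ⱽ nb (nb (nb a i) j) k) ×-dec (nb (nb (nb (nb (nb a i) j) k′) l′) m′ ≟ⱽ a))) l k l′ k′

    to-onto : ∀ j b → ∃₂ λ l i → to (l , i) ≡ (j , b)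
    to-onto j false = from-yes (all? λ j → any? λ l → any? λ i → ≡-dec _≟_ Bool._≟_ (to (l , i)) (j , false)) j
    to-onto j true = from-yes (all? λ j → any? λ l → any? λ i → ≡-dec _≟_ Bool._≟_ (to (l , i)) (j , true)) j

    to-inj : ∀ a b → to a ≡ to b → a ≡ b
    to-inj (l , k) (l′ , k′) = from-yes (allⱽ? λ a → allⱽ? λ b → ≡-dec _≟_ Bool._≟_ (to a) (to b) →-dec (a ≟ⱽ b)) l k l′ k′

    adj⇔ : ∀ a b → (∃ λ i → nb a i ≡ b) ⇔ DodAdj (to a) (to b)
    adj⇔ (l , k) (l′ , k′) = mk⇔ (proj₁ (check l k l′ k′)) (proj₂ (check l k l′ k′))
      where
      addMod? : ∀ x y d → Dec (AddMod 10 x y d)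
      addMod? x y d = (toℕ y + d ℕ.≟ toℕ x) ⊎-dec (toℕ y + d ℕ.≟ toℕ x + 10)
      adj? : ∀ p q → Dec (DodAdj p q)
      adj? (i , false) (j , false) = addMod? j i 1 ⊎-dec addMod? i j 1
      adj? (i , false) (j , true) = i ≟ j
      adj? (i , true) (j , false) = i ≟ j
      adj? (i , true) (j , true) = addMod? j i 2 ⊎-dec addMod? i j 2
      check : ∀ l k l′ k′ → ((∃ λ i → nb (l , k) i ≡ (l′ , k′)) → DodAdj (to (l , k)) (to (l′ , k′)))
        × (DodAdj (to (l , k)) (to (l′ , k′)) → ∃ λ i → nb (l , k) i ≡ (l′ , k′))
      check = from-yes (allⱽ? λ a → allⱽ? λ b → let d = any? (λ i → nb a i ≟ⱽ b) in
        (d →-dec adj? (to a) (to b)) ×-dec (adj? (to a) (to b) →-dec d))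

  from : Fin 10 × Bool → Vertex
  from (j , b) = proj₁ (to-onto j b) , proj₁ (proj₂ (to-onto j b))

  to∘from : ∀ p → to (from p) ≡ p
  to∘from (j , b) = proj₂ (proj₂ (to-onto j b))

  from∘to : ∀ a → from (to a) ≡ a
  from∘to a = to-inj _ _ (to∘from (to a))

-- Girth five: constructing the two isomorphisms

module GirthFive-Iso {n : ℕ} (Γ : Graph n) (cubic : Cubic Γ) (connected : Connected Γ)
  (no₃ : Girths.TriangleFree Γ cubic) (no₄ : Girths.SquareFree Γ cubic) where

  open Cub Γ cubic
  open Girths Γ cubic
  open Corner κ₅
  open GirthFive Γ cubic no₃ no₄
  open Covers Γ cubic connected
  private
    ! : ∀ {u v} → u ~ v → v ~ u
    ! = ~-sym
    Xsym : S₅.X-Symmetric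
    Xsym = X₅-sym no₃ no₄

  abstract
    far : ∀ {v a b x} → v ~ a → v ~ b → b ~ x → a ≢ x
    far va vb bx refl = no₃ va (! bx) (! vb)

    apart : ∀ {v a b x y} → v ~ a → v ~ b → a ≢ b → a ~ x → v ≢ x → b ~ y → x ≢ y
    apart va vb a≢b ax v≢x by refl = no₄ va ax (! by) (! vb) v≢x a≢b

  module _ {v p q r p₁ p₂ q₁ q₂ r₁ r₂ : Fin n} (Nv : Nbrs v p q r)
    (Np : Nbrs p v p₁ p₂) (Nq : Nbrs q v q₁ q₂) (Nr : Nbrs r v r₁ r₂)
    (p₁q₁ : p₁ ~ q₁) (p₂q₂ : p₂ ~ q₂) (q₁r₁ : q₁ ~ r₁) (q₂r₂ : q₂ ~ r₂) (r₁p₂ : r₁ ~ p₂) (r₂p₁ : r₂ ~ p₁) where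
    private
      module V = Nbrs Nv
      module P = Nbrs Np
      module Q = Nbrs Nq
      module R = Nbrs Nr

    petersen : IsoTo Γ Pet PetAdj
    petersen = IsoTo-∘ Γ (λ a b → ∃ λ i → Petersen.nb a i ≡ b) PetAdj Petersen.to Petersen.from Petersen.from∘to Petersen.to∘from Petersen.adj⇔
        (iso 0F λ {a} {b} → near₂-inj (near (Petersen.two-steps a b)))
      where
      φ : Fin 10 → Fin n
      φ = lookup (v ∷ p ∷ q ∷ r ∷ p₁ ∷ p₂ ∷ q₁ ∷ q₂ ∷ r₁ ∷ r₂ ∷ [])
      cover : ∀ a → Nbrs (φ a) (φ (Petersen.nb a 0F)) (φ (Petersen.nb a 1F)) (φ (Petersen.nb a 2F))
      cover 0F = Nv
      cover 1F = Np
      cover 2F = Nq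
      cover 3F = Nr
      cover 4F = nbrs₃ (! P.~q) p₁q₁ (! r₂p₁) (far V.~p V.~q Q.~q) (far V.~p V.~r R.~r) (apart V.~q V.~r V.q≢r Q.~q Q.p≢q R.~r)
      cover 5F = nbrs₃ (! P.~r) p₂q₂ (! r₁p₂) (far V.~p V.~q Q.~r) (far V.~p V.~r R.~q) (apart V.~q V.~r V.q≢r Q.~r Q.p≢r R.~q)
      cover 6F = nbrs₃ (! Q.~q) (! p₁q₁) q₁r₁ (far V.~q V.~p P.~q) (far V.~q V.~r R.~q) (apart V.~p V.~r V.p≢r P.~q P.p≢q R.~q)
      cover 7F = nbrs₃ (! Q.~r) (! p₂q₂) q₂r₂ (far V.~q V.~p P.~r) (far V.~q V.~r R.~r) (apart V.~p V.~r V.p≢r P.~r P.p≢r R.~r)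
      cover 8F = nbrs₃ (! R.~q) (! q₁r₁) r₁p₂ (far V.~r V.~q Q.~q) (far V.~r V.~p P.~r) (apart V.~q V.~p (V.p≢q ∘ sym) Q.~q Q.p≢q P.~r)
      cover 9F = nbrs₃ (! R.~r) (! q₂r₂) r₂p₁ (far V.~r V.~q Q.~r) (far V.~r V.~p P.~q) (apart V.~q V.~p (V.p≢q ∘ sym) Q.~r Q.p≢r P.~q)
      open Cover _≟_ Petersen.nb φ Petersen.back cover
      near : ∀ {a b} → a ≡ b ⊎ (∃ λ i → Petersen.nb a i ≡ b) ⊎ (∃₂ λ i j → Petersen.nb (Petersen.nb a i) j ≡ b) → Near₂ a b
      near (inj₁ refl) = near₀
      near (inj₂ (inj₁ (i , refl))) = near₁ i
      near (inj₂ (inj₂ (i , j , refl))) = near₂ i j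

  -- The corners `p v q` and `q v r` give the paths `p₁ q₁ r₁` and `p₂ q₂ r₂`. The corner `p v r`
  -- joins their ends, crosswise because a path closed on itself is a triangle; the outer vertices
  -- then form a hexagon.
  222⇒petersen : Fin n → S₅.Balanced 2 2 2 → IsoTo Γ Pet PetAdj
  222⇒petersen v bal = let _ , _ , _ , N , pq , pr , qr = S₅.Balanced.star bal v in around N pq pr qr
    where
    around : ∀ {v p q r} → Nbrs v p q r → X p v q ≡ 2 → X p v r ≡ 2 → X q v r ≡ 2 → IsoTo Γ Pet PetAdj
    around {v} {p} {q} {r} Nv@(nbrs vp vq vr p≢q p≢r q≢r _) pq pr qr with nbrs₁ (! vp)
    ... | p₁ , p₂ , Np with matching vq p≢q pq Np
    ... | q₁ , q₂ , Nq , p₁q₁ , p₂q₂ with matching vr q≢r qr Nq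
    ... | r₁ , r₂ , Nr@(nbrs rv rr₁ rr₂ v≢r₁ v≢r₂ _ _) , q₁r₁ , q₂r₂
        with via Np (λ h → no₃ vr rr₁ h) (X≡2⇒ rv pr rr₁ (v≢r₁ ∘ sym)) | via Np (λ h → no₃ vr rr₂ h) (X≡2⇒ rv pr rr₂ (v≢r₂ ∘ sym))
    ... | inj₁ r₁p₁ | _ = ⊥-elim (no₃ p₁q₁ q₁r₁ r₁p₁)
    ... | _ | inj₂ r₂p₂ = ⊥-elim (no₃ p₂q₂ q₂r₂ r₂p₂)
    ... | inj₂ r₁p₂ | inj₁ r₂p₁ = petersen Nv Np Nq Nr p₁q₁ p₂q₂ q₁r₁ q₂r₂ r₁p₂ r₂p₁

  module OnePentagon (one : ∀ {u v w} → u ~ v → v ~ w → u ≢ w → X u v w ≡ 1) where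

    abstract
      -- The corner count fixes `x`, and two choices of `y` would form a 4-cycle.
      unique : ∀ {u v w x y x′ y′} → u ~ v → v ~ w → u ≢ w → w ~ x → x ~ y → y ~ u → w ~ x′ → x′ ~ y′ → y′ ~ u → x ≡ x′ × y ≡ y′
      unique {u} {v} {w} {x} {y} {x′} {y′} uv vw u≢w wx xy yu wx′ x′y′ y′u = x≡x′ , y≡y′
        where
        x≡x′ : x ≡ x′
        x≡x′ = X≡1⇒ (! vw) (one uv vw u≢w) wx (λ e → no₃ (subst (_~ y) e xy) yu uv) (κ₅⁺ xy yu)
          wx′ (λ e → no₃ (subst (_~ y′) e x′y′) y′u uv) (κ₅⁺ x′y′ y′u)
        y≡y′ : y ≡ y′
        y≡y′ with y ≟ y′
        ... | yes e = e
        ... | no ne = ⊥-elim (no₄ xy yu (! y′u) (! (subst (_~ y′) (sym x≡x′) x′y′)) (λ e → no₃ uv vw (subst (w ~_) e wx)) ne)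

      -- The pentagon on `u′ u v` continues from `v` to `w` or to `v′`. If to `w`, it would be the
      -- pentagon on `u v w`, which enters `u` from `y` and not from `u′`. So it lies on the other
      -- side of the edge `u v`.
      across : ∀ {u v w x y u′ v′} → u ~ v → w ~ x → x ~ y → y ~ u → Nbrs v u w v′ → u ~ u′ → u′ ≢ v → u′ ≢ y
        → ∃ λ z → u′ ~ z × z ~ v′
      across {u} {v} {w} {x} {y} {u′} {v′} uv wx xy yu N uu′ u′≢v u′≢y
        with X≥1⇒ (! uv) (subst (1 ≤_) (sym (one (! uu′) uv u′≢v)) (s≤s z≤n))
      ... | t , vt , t≢u , h with κ₅⁻ h | only₂ N vt t≢u
      ... | m , tm , mu′ | inj₂ refl = m , ! mu′ , ! tm
      ... | m , tm , mu′ | inj₁ refl =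
            contradiction (sym (proj₂ (unique uv vt (t≢u ∘ sym) wx xy yu tm mu′ (! uu′)))) u′≢y

    -- A pentagon `a` is grown outwards: `b` holds the third neighbours of `a`, `c i` closes the
    -- pentagon across the edge from `a i` to `a (next i)`, and `d` holds the third neighbours of
    -- `c`. The cyclic order enters only through the stated identities, so each argument is made
    -- once for all `i`.
    module Layers (next prev : Fin 5 → Fin 5) (next-prev : ∀ i → next (prev i) ≡ i) (prev-next : ∀ i → prev (next i) ≡ i)
      (next⁴ : ∀ i → next (next (next (next i))) ≡ prev i) (a : Fin 5 → Fin n) (aa : ∀ i → a i ~ a (next i)) where

      abstract
        aa⁻ : ∀ i → a (prev i) ~ a i
        aa⁻ i = subst (λ j → a (prev i) ~ a j) (next-prev i) (aa (prev i))

        aa³ : ∀ i → a (next (next (next i))) ~ a (prev i)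
        aa³ i = subst (λ j → a (next (next (next i))) ~ a j) (next⁴ i) (aa _)

        a≢ : ∀ i → a i ≢ a (next (next i))
        a≢ i e = no₃ (subst (_~ a (next (next (next i)))) (sym e) (aa _)) (aa³ i) (aa⁻ i)

      abstract
        outer : ∀ i → ∃ λ b → Nbrs (a (next i)) (a i) (a (next (next i))) b
        outer i = nbrs₂ (! (aa i)) (aa (next i)) (a≢ i)

      b : Fin 5 → Fin n
      b i = proj₁ (outer (prev i))

      abstract
        Nᵃ : ∀ i → Nbrs (a (next i)) (a i) (a (next (next i))) (b (next i))
        Nᵃ i = subst (λ j → Nbrs (a (next i)) (a i) (a (next (next i))) (proj₁ (outer j))) (sym (prev-next i)) (proj₂ (outer i))

        Nᵃ⁻ : ∀ i → Nbrs (a i) (a (prev i)) (a (next i)) (b i)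
        Nᵃ⁻ i = subst (λ j → Nbrs (a j) (a (prev i)) (a (next j)) (b j)) (next-prev i) (Nᵃ (prev i))

        middle : ∀ i → ∃ λ c → b i ~ c × c ~ b (next i)
        middle i = across (aa i) (aa _) (aa³ i) (aa⁻ i) (Nᵃ i) (Nbrs.~r (Nᵃ⁻ i)) (Nbrs.q≢r (Nᵃ⁻ i) ∘ sym) (Nbrs.p≢r (Nᵃ⁻ i) ∘ sym)

      c : Fin 5 → Fin n
      c i = proj₁ (middle i)

      abstract
        bc : ∀ i → b i ~ c i
        bc i = proj₁ (proj₂ (middle i))

        cb : ∀ i → c i ~ b (next i)
        cb i = proj₂ (proj₂ (middle i))

        ab : ∀ i → a i ~ b i
        ab i = Nbrs.~r (Nᵃ⁻ i)

        b≢b : ∀ i → b i ≢ b (next i)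
        b≢b i e = no₃ (aa i) (subst (a (next i) ~_) (sym e) (ab (next i))) (! (ab i))

        Nᵇ : ∀ i → Nbrs (b (next i)) (a (next i)) (c i) (c (next i))
        Nᵇ i = nbrs₃ (! (ab (next i))) (! (cb i)) (bc (next i))
          (λ e → no₃ (aa i) (! (subst (b i ~_) (sym e) (bc i))) (! (ab i)))
          (λ e → no₃ (aa (next i)) (ab _) (! (subst (_~ b (next (next i))) (sym e) (cb (next i)))))
          -- If `c i` and `c (next i)` coincided, the corner `a (next i)`, `b (next i)`, `c i` would
          -- carry one pentagon through `a i` and one through `a (next (next i))`.
          (λ e → a≢ i (proj₂ (unique (ab (next i)) (! (cb i))
             (λ e → no₃ (aa i) (! (subst (b i ~_) (sym e) (bc i))) (! (ab i)))
             (! (bc i)) (! (ab i)) (aa i)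
             (subst (_~ b (next (next i))) (sym e) (cb (next i))) (! (ab _)) (! (aa (next i))))))

      abstract
        inner : ∀ i → ∃ λ d → Nbrs (c i) (b i) (b (next i)) d
        inner i = nbrs₂ (! (bc i)) (cb i) (b≢b i)

      d : Fin 5 → Fin n
      d i = proj₁ (inner i)

      abstract
        Nᶜ : ∀ i → Nbrs (c i) (b i) (b (next i)) (d i)
        Nᶜ i = proj₂ (inner i)

        cd : ∀ i → c i ~ d i
        cd i = Nbrs.~r (Nᶜ i)

        -- The pentagon across the edge from `b (next i)` to `c (next i)` contains `c i` and
        -- `d (next i)`. Its last vertex is a neighbour of `c i`: `b (next i)` would give a
        -- triangle, `b i` a second pentagon on `b i`, `c i`, `b (next i)`.
        dd : ∀ i → d i ~ d (next i)
        dd i = let z , cz , zd = across (bc (next i)) (! (ab _)) (! (aa (next i))) (ab (next i)) (Nᶜ (next i))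
                                   (! (cb i)) (Nbrs.q≢r (Nᵇ i)) (Nbrs.p≢q (Nᵇ i) ∘ sym)
               in go (Nbrs.only (Nᶜ i) cz) zd
          where
          go : ∀ {z} → z ≡ b i ⊎ z ≡ b (next i) ⊎ z ≡ d i → z ~ d (next i) → d i ~ d (next i)
          go (inj₂ (inj₂ refl)) zd = zd
          go (inj₂ (inj₁ refl)) zd = ⊥-elim (no₃ (bc (next i)) (cd (next i)) (! zd))
          go (inj₁ refl) zd = contradiction
            (sym (proj₁ (unique (bc i) (cb i) (b≢b i) (bc (next i)) (cd (next i)) (! zd) (! (ab (next i))) (! (aa i)) (ab i))))
            (Nbrs.p≢r (Nᵇ i))

        Nᵈ : ∀ i → Nbrs (d (next i)) (c (next i)) (d i) (d (next (next i)))
        Nᵈ i = nbrs₃ (! (cd (next i))) (! (dd i)) (dd (next i)) c≢d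
          (λ e → no₃ (bc (next (next i))) (subst (c (next (next i)) ~_) (sym e) (cd _)) (cb (next i)))
          (λ e → b≢b (next i) (proj₂ (unique (cd (next i)) (! (dd i)) c≢d (! (cd i)) (cb i) (bc (next i))
                    (! (subst (c (next (next i)) ~_) (sym e) (cd _))) (! (bc _)) (! (cb (next i))))))
          where
          c≢d : c (next i) ≢ d i
          c≢d e = no₃ (cb i) (bc (next i)) (! (subst (c i ~_) (sym e) (cd i)))

      abstract
        Nᵇ⁻ : ∀ i → Nbrs (b i) (a i) (c (prev i)) (c i)
        Nᵇ⁻ i = subst (λ j → Nbrs (b j) (a j) (c (prev i)) (c j)) (next-prev i) (Nᵇ (prev i))

        Nᵈ⁻ : ∀ i → Nbrs (d i) (c i) (d (prev i)) (d (next i))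
        Nᵈ⁻ i = subst (λ j → Nbrs (d j) (c j) (d (prev i)) (d (next j))) (next-prev i) (Nᵈ (prev i))

    module Surjection (a : Fin 5 → Fin n) (aa : ∀ i → a i ~ a (Dodecahedron.next i)) where
      open Dodecahedron using (next; prev; next-prev; prev-next; next⁴)
      open module L = Layers next prev next-prev prev-next next⁴ a aa using (b; c; d)

      φ : Dodecahedron.Vertex → Fin n
      φ (0F , i) = a i
      φ (1F , i) = b i
      φ (2F , i) = c i
      φ (3F , i) = d i

      abstract
        cover : ∀ v → Nbrs (φ v) (φ (Dodecahedron.nb v 0F)) (φ (Dodecahedron.nb v 1F)) (φ (Dodecahedron.nb v 2F))
        cover (0F , i) = L.Nᵃ⁻ i
        cover (1F , i) = L.Nᵇ⁻ i
        cover (2F , i) = L.Nᶜ i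
        cover (3F , i) = L.Nᵈ⁻ i

      open Cover Dodecahedron._≟ⱽ_ Dodecahedron.nb φ Dodecahedron.back cover
      open Dodecahedron using (Walk₁; Walk₂; Walk₃; Walk₄; Walk₅; nb)

      -- The antipodal map of the dodecahedron is excluded by the uniqueness of the pentagon at a corner.
      φ-inj : ∀ {u v} → φ u ≡ φ v → u ≡ v
      φ-inj {u} {v} = separate (Dodecahedron.walks u v)
        where
        separate : ∀ {u v} → u ≡ v ⊎ Walk₁ u v ⊎ Walk₂ u v ⊎ Walk₃ u v ⊎ Walk₄ u v ⊎ Walk₅ u v → φ u ≡ φ v → u ≡ v
        separate (inj₁ e) _ = e
        separate (inj₂ (inj₁ (i , refl))) = near₂-inj (near₁ i)
        separate (inj₂ (inj₂ (inj₁ (i , j , refl)))) = near₂-inj (near₂ i j)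
        separate {u} (inj₂ (inj₂ (inj₂ (inj₁ (i , j , k , refl))))) e = contradiction e (near₃-inj no₃ {u} i j k)
        separate {u} (inj₂ (inj₂ (inj₂ (inj₂ (inj₁ (i , j , ne , k , l , ne′ , refl)))))) e =
          ⊥-elim (no₄ (edge u i) (edge m₁ j) (edge m₂ k) (subst (φ m₃ ~_) (sym e) (edge m₃ l))
            (step₂ u i j ne ∘ sym) (step₂ m₁ j k ne′ ∘ sym))
          where
          m₁ = nb u i
          m₂ = nb m₁ j
          m₃ = nb m₂ k
        separate {u} (inj₂ (inj₂ (inj₂ (inj₂ (inj₂ (i , j , ne , k , l , m , refl , k′ , l′ , m′ , ne′ , e′)))))) e =
          contradiction (proj₁ (unique (edge u i) (edge m₁ j) (step₂ u i j ne ∘ sym)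
              (edge m₂ k′) (edge (nb m₂ k′) l′) (subst (λ x → φ (nb (nb m₂ k′) l′) ~ φ x) e′ (edge (nb (nb m₂ k′) l′) m′))
              (edge m₂ k) (edge (nb m₂ k) l) (subst (φ (nb (nb m₂ k) l) ~_) (sym e) (edge (nb (nb m₂ k) l) m))))
            (local-inj m₂ k′ k ne′)
          where
          m₁ = nb u i
          m₂ = nb m₁ j

      dodecahedron : IsoTo Γ (Fin 10 × Bool) DodAdj
      dodecahedron = IsoTo-∘ Γ (λ a b → ∃ λ i → nb a i ≡ b) DodAdj Dodecahedron.to Dodecahedron.from Dodecahedron.from∘to Dodecahedron.to∘from Dodecahedron.adj⇔
        (iso (0F , 0F) φ-inj)

  111⇒dodecahedron : Fin n → S₅.Balanced 1 1 1 → IsoTo Γ (Fin 10 × Bool) DodAdj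
  111⇒dodecahedron v bal = let _ , _ , _ , N , pq , _ = S₅.Balanced.star bal v in around N pq
    where
    open OnePentagon (Regular.all-corners Γ cubic 5 κ₅ Xsym bal)
    around : ∀ {v p q r} → Nbrs v p q r → X p v q ≡ 1 → IsoTo Γ (Fin 10 × Bool) DodAdj
    around {v} {p} {q} {r} (nbrs vp vq _ _ _ _ _) pq with X≥1⇒ (! vq) (subst (1 ≤_) (sym pq) (s≤s z≤n))
    ... | x , qx , x≢v , h with κ₅⁻ h
    ... | y , xy , yp = Surjection.dodecahedron (lookup (p ∷ v ∷ q ∷ x ∷ y ∷ []))
          λ { 0F → ! vp ; 1F → vq ; 2F → qx ; 3F → xy ; 4F → yp }

-- Girth four

addMod? : ∀ N x y d → Dec (AddMod N x y d)
addMod? N x y d = (toℕ y + d ℕ.≟ toℕ x) ⊎-dec (toℕ y + d ℕ.≟ toℕ x + N)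

Steps : {A : Set} → (A → Fin 3 → A) → A → A → Set
Steps nb a b = ∃ λ i → nb a i ≡ b

-- Every 2-path lies on a 4-cycle.
Squares : {k : ℕ} → (Fin k → Fin 3 → Fin k) → Set
Squares nb = ∀ a i j → nb a i ≢ nb a j → ∃₂ λ l m → nb (nb a j) l ≢ a × nb (nb (nb a j) l) m ≡ nb a i

squares? : {k : ℕ} (nb : Fin k → Fin 3 → Fin k) → Dec (Squares nb)
squares? nb = all? λ a → all? λ i → all? λ j → ¬? (nb a i ≟ nb a j) →-dec
  any? λ l → any? λ m → ¬? (nb (nb a j) l ≟ a) ×-dec (nb (nb (nb a j) l) m ≟ nb a i)

module _ {k : ℕ} (nb : Fin k → Fin 3 → Fin k) {B : Set} (S : B → B → Set) (to : Fin k → B) (S? : ∀ p q → Dec (S p q)) where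

  adj⇔? : Dec (∀ a b → (Steps nb a b → S (to a) (to b)) × (S (to a) (to b) → Steps nb a b))
  adj⇔? = all? λ a → all? λ b → let d = any? (λ i → nb a i ≟ b) in
    (d →-dec S? (to a) (to b)) ×-dec (S? (to a) (to b) →-dec d)

-- Finite models of K₃,₃ and the cube

module K₃₃ where

  nb : Fin 6 → Fin 3 → Fin 6
  nb a = lookup (lookup table a)
    where
    table : Vec (Vec (Fin 6) 3) 6
    table = (1F ∷ 3F ∷ 5F ∷ []) ∷ (0F ∷ 2F ∷ 4F ∷ []) ∷ (1F ∷ 3F ∷ 5F ∷ []) ∷ (0F ∷ 2F ∷ 4F ∷ [])
      ∷ (1F ∷ 3F ∷ 5F ∷ []) ∷ (0F ∷ 2F ∷ 4F ∷ []) ∷ []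

  to : Fin 6 → Bool × Fin 3
  to = lookup ((false , 0F) ∷ (true , 0F) ∷ (false , 1F) ∷ (true , 1F) ∷ (false , 2F) ∷ (true , 2F) ∷ [])

  from : Bool × Fin 3 → Fin 6
  from (false , i) = lookup (0F ∷ 2F ∷ 4F ∷ []) i
  from (true , i) = lookup (1F ∷ 3F ∷ 5F ∷ []) i

  abstract
    from∘to : ∀ a → from (to a) ≡ a
    from∘to = from-yes (all? λ a → from (to a) ≟ a)

    to∘from : ∀ p → to (from p) ≡ p
    to∘from (false , i) = from-yes (all? λ i → ≡-dec Bool._≟_ _≟_ (to (from (false , i))) (false , i)) i
    to∘from (true , i) = from-yes (all? λ i → ≡-dec Bool._≟_ _≟_ (to (from (true , i))) (true , i)) i

    adj⇔ : ∀ a b → Steps nb a b ⇔ K33Adj (to a) (to b)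
    adj⇔ a b = let f , g = from-yes (adj⇔? nb K33Adj to λ p q → ¬? (proj₁ p Bool.≟ proj₁ q)) a b in mk⇔ f g

    -- The model numbers the two sides by parity, and the differences `1`, `−1`, `3` modulo `6` are
    -- exactly the odd ones, so the identity is an isomorphism.
    adj⇔Möbius : ∀ a b → Steps nb a b ⇔ MobiusAdj 3 a b
    adj⇔Möbius a b = let f , g = from-yes (adj⇔? nb (MobiusAdj 3) id λ x y →
                                   addMod? 6 y x 1 ⊎-dec addMod? 6 x y 1 ⊎-dec addMod? 6 y x 3) a b in mk⇔ f g

    back : ∀ a i → ∃ λ j → nb (nb a i) j ≡ a
    back = from-yes (all? λ a → all? λ i → any? λ j → nb (nb a i) j ≟ a)

    two-steps : ∀ a b → Steps nb a b ⊎ (∃₂ λ i j → nb (nb a i) j ≡ b)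
    two-steps = from-yes (all? λ a → all? λ b → any? (λ i → nb a i ≟ b) ⊎-dec any? (λ i → any? λ j → nb (nb a i) j ≟ b))

    squares : Squares nb
    squares = from-yes (squares? nb)

module Cube where

  nb : Fin 8 → Fin 3 → Fin 8
  nb a = lookup (lookup table a)
    where
    table : Vec (Vec (Fin 8) 3) 8
    table = (1F ∷ 2F ∷ 3F ∷ []) ∷ (0F ∷ 4F ∷ 5F ∷ []) ∷ (0F ∷ 4F ∷ 6F ∷ []) ∷ (0F ∷ 5F ∷ 6F ∷ [])
      ∷ (1F ∷ 2F ∷ 7F ∷ []) ∷ (1F ∷ 3F ∷ 7F ∷ []) ∷ (2F ∷ 3F ∷ 7F ∷ []) ∷ (4F ∷ 5F ∷ 6F ∷ []) ∷ []

  to : Fin 8 → Q3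
  to = lookup ((false , false , false) ∷ (true , false , false) ∷ (false , true , false) ∷ (false , false , true)
    ∷ (true , true , false) ∷ (true , false , true) ∷ (false , true , true) ∷ (true , true , true) ∷ [])

  from : Q3 → Fin 8
  from (false , false , false) = 0F
  from (true , false , false) = 1F
  from (false , true , false) = 2F
  from (false , false , true) = 3F
  from (true , true , false) = 4F
  from (true , false , true) = 5F
  from (false , true , true) = 6F
  from (true , true , true) = 7F

  toPrism : Fin 8 → Fin 4 × Bool
  toPrism = lookup ((0F , false) ∷ (1F , false) ∷ (3F , false) ∷ (0F , true) ∷ (2F , false) ∷ (1F , true)
    ∷ (3F , true) ∷ (2F , true) ∷ [])

  fromPrism : Fin 4 × Bool → Fin 8
  fromPrism (i , false) = lookup (0F ∷ 1F ∷ 4F ∷ 2F ∷ []) i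
  fromPrism (i , true) = lookup (3F ∷ 5F ∷ 7F ∷ 6F ∷ []) i

  abstract
    from∘to : ∀ a → from (to a) ≡ a
    from∘to = from-yes (all? λ a → from (to a) ≟ a)

    to∘from : ∀ p → to (from p) ≡ p
    to∘from (false , false , false) = refl
    to∘from (true , false , false) = refl
    to∘from (false , true , false) = refl
    to∘from (false , false , true) = refl
    to∘from (true , true , false) = refl
    to∘from (true , false , true) = refl
    to∘from (false , true , true) = refl
    to∘from (true , true , true) = refl

    adj⇔ : ∀ a b → Steps nb a b ⇔ Q3Adj (to a) (to b)
    adj⇔ a b = let f , g = from-yes (adj⇔? nb Q3Adj to λ _ _ → _ ℕ.≟ _) a b in mk⇔ f g

    fromPrism∘to : ∀ a → fromPrism (toPrism a) ≡ a
    fromPrism∘to = from-yes (all? λ a → fromPrism (toPrism a) ≟ a)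

    toPrism∘from : ∀ p → toPrism (fromPrism p) ≡ p
    toPrism∘from (i , false) = from-yes (all? λ i → ≡-dec _≟_ Bool._≟_ (toPrism (fromPrism (i , false))) (i , false)) i
    toPrism∘from (i , true) = from-yes (all? λ i → ≡-dec _≟_ Bool._≟_ (toPrism (fromPrism (i , true))) (i , true)) i

    adj⇔Prism : ∀ a b → Steps nb a b ⇔ PrismAdj 4 (toPrism a) (toPrism b)
    adj⇔Prism a b = let f , g = from-yes (adj⇔? nb (PrismAdj 4) toPrism prism?) a b in mk⇔ f g
      where
      prism? : ∀ p q → Dec (PrismAdj 4 p q)
      prism? (i , b) (j , b′) = ((i ≟ j) ×-dec ¬? (b Bool.≟ b′)) ⊎-dec ((b Bool.≟ b′) ×-dec (addMod? 4 j i 1 ⊎-dec addMod? 4 i j 1))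

    back : ∀ a i → ∃ λ j → nb (nb a i) j ≡ a
    back = from-yes (all? λ a → all? λ i → any? λ j → nb (nb a i) j ≟ a)

    three-steps : ∀ a b → Steps nb a b ⊎ (∃₂ λ i j → nb (nb a i) j ≡ b) ⊎ (∃₂ λ i j → ∃ λ k → nb (nb (nb a i) j) k ≡ b)
    three-steps = from-yes (all? λ a → all? λ b → any? (λ i → nb a i ≟ b) ⊎-dec any? (λ i → any? λ j → nb (nb a i) j ≟ b)
      ⊎-dec any? (λ i → any? λ j → any? λ k → nb (nb (nb a i) j) k ≟ b))

    squares : Squares nb
    squares = from-yes (squares? nb)

¬K₃₃×Q₃ : {n : ℕ} (Γ : Graph n) → IsoTo Γ (Bool × Fin 3) K33Adj → IsoTo Γ Q3 Q3Adj → ⊥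
¬K₃₃×Q₃ Γ k q = contradiction
  (IsoTo-≤ Γ {R = Q3Adj} {S = K33Adj} q k (Uniqueₚ.map⁺ (λ {a} {b} e → trans (sym (Cube.from∘to a)) (trans (cong Cube.from e) (Cube.from∘to b))) (Uniqueₚ.allFin⁺ 8))
    (λ b → subst (_∈ map K₃₃.to (allFin 6)) (K₃₃.to∘from b) (∈-map⁺ K₃₃.to (∈-allFin (K₃₃.from b)))))
  (from-no (8 ℕ.≤? 6))

-- Carries `Squares` over to Γ, where it conflicts with the corner equal to `0` of the triple
-- `(0,1,1)`.
square-completion : {n : ℕ} (Γ : Graph n) {k : ℕ} {nb : Fin k → Fin 3 → Fin k} → Squares nb → IsoTo Γ (Fin k) (Steps nb)
  → ∀ {u v w} → T (Graph.adj Γ v u) → T (Graph.adj Γ v w) → u ≢ w → ∃ λ x → T (Graph.adj Γ w x) × x ≢ v × T (Graph.adj Γ x u)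
square-completion Γ {nb = nb} sq (f , (inj , surj) , hom) {u} {v} {w} vu vw u≢w with Equivalence.to (hom v u) vu | Equivalence.to (hom v w) vw
... | i , ei | j , ej with sq (f v) i j (λ e → u≢w (inj (trans (sym ei) (trans e ej))))
... | l , m , ne , e = x , Equivalence.from (hom w x) (l , trans (cong (λ a → nb a l) (sym ej)) (sym fx))
      , (λ x≡v → ne (trans (sym fx) (cong f x≡v)))
      , Equivalence.from (hom x u) (m , trans (cong (λ a → nb a m) fx) (trans e ei))
  where
  x = proj₁ (surj (nb (nb (f v) j) l))
  fx : f x ≡ nb (nb (f v) j) l
  fx = proj₂ (surj (nb (nb (f v) j) l)) refl

module GirthFour {n : ℕ} (Γ : Graph n) (cubic : Cubic Γ) (connected : Connected Γ)
  (no₃ : Girths.TriangleFree Γ cubic) where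

  open Cub Γ cubic
  open Girths Γ cubic
  open Corner κ₄
  open Covers Γ cubic connected
  open S₄ using (Balanced)
  private
    ! : ∀ {u v} → u ~ v → v ~ u
    ! = ~-sym
    open module R = Regular Γ cubic 4 κ₄ using (corners; all-corners)

  module _ {x y : ℕ} (bal : Balanced x y 2) where
    open Balanced bal

    module _ {v p q r s t : Fin n} (Nv : Nbrs v p q r) (Nq : Nbrs q v s t) (Nr : Nbrs r v s t) where
      private
        module V = Nbrs Nv
        module Q = Nbrs Nq
        module R′ = Nbrs Nr

      -- The vertex `r` is a common neighbour of `v`, `s` and `t`, so all three corners at `q` lie
      -- on 4-cycles through `r`.
      1≤x : 1 ≤ x
      1≤x = corners X₄-sym bal (λ i j k → 1 ≤ i → 1 ≤ j → 1 ≤ k → 1 ≤ x)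
        (λ h _ _ → h) (λ h _ _ → h) (λ _ h _ → h) (λ _ _ h → h) (λ _ h _ → h) (λ _ _ h → h) Nq
        (X≥1 (! Q.~q) (! R′.~q) (V.q≢r ∘ sym) (! V.~r))
        (X≥1 (! Q.~r) (! R′.~r) (V.q≢r ∘ sym) (! V.~r))
        (X≥1 (! Q.~r) (! R′.~r) (V.q≢r ∘ sym) R′.~q)

      corner≥1 : ∀ {u v w} → u ~ v → v ~ w → u ≢ w → 1 ≤ X u v w
      corner≥1 uv vw u≢w = corners X₄-sym bal (λ i _ _ → 1 ≤ i) 1≤x 1≤x 1≤y 1≤y 1≤z 1≤z (proj₂ (nbrs₂ (! uv) vw u≢w))
        where
        1≤y = ℕₚ.≤-trans 1≤x x≤y
        1≤z = ℕₚ.≤-trans 1≤y y≤z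

      third : ∀ {a b c a′} → Nbrs q a b c → Nbrs a q r a′ → a′ ~ b ⊎ a′ ~ c
      third {a} {b} {c} {a′} Nq′ Na with X≥1⇒ (! (Nbrs.~r Na)) (corner≥1 (! (Nbrs.~p Na)) (Nbrs.~r Na) (Nbrs.p≢r Na))
      ... | x , a′x , x≢a , xq with only₂ Nq′ (! xq) x≢a
      ... | inj₁ refl = inj₁ a′x
      ... | inj₂ refl = inj₂ a′x

      -- Each of `v`, `s`, `t` has one neighbour besides `q` and `r`. By `third` it is adjacent to
      -- another of the three and is then the remaining neighbour of both; among three vertices this
      -- makes all these neighbours equal.
      p~s,t : p ~ s × p ~ t
      p~s,t with nbrs₂ (! Q.~q) (! R′.~q) V.q≢r | nbrs₂ (! Q.~r) (! R′.~r) V.q≢r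
      ... | s′ , Ns | t′ , Nt with third Nq (rot Nv) | third (swap₁₂ Nq) Ns | third (rot² Nq) Nt
      ... | inj₁ ps | _ | inj₁ t′v = ps , ! (subst (t ~_) (only₁ (rot Nv) (! t′v) (Nbrs.p≢r Nt ∘ sym) (Nbrs.q≢r Nt ∘ sym)) (Nbrs.~r Nt))
      ... | inj₁ ps | _ | inj₂ t′s = ps , ! (subst (t ~_) (trans t′≡s′ (sym p≡s′)) (Nbrs.~r Nt))
        where
        p≡s′ = only₁ Ns (! ps) V.p≢q V.p≢r
        t′≡s′ = only₁ Ns (! t′s) (Nbrs.p≢r Nt ∘ sym) (Nbrs.q≢r Nt ∘ sym)
      ... | inj₂ pt | inj₁ s′v | _ = ! (subst (s ~_) (only₁ (rot Nv) (! s′v) (Nbrs.p≢r Ns ∘ sym) (Nbrs.q≢r Ns ∘ sym)) (Nbrs.~r Ns)) , pt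
      ... | inj₂ pt | inj₂ s′t | _ = ! (subst (s ~_) (trans s′≡t′ (sym p≡t′)) (Nbrs.~r Ns)) , pt
        where
        p≡t′ = only₁ Nt (! pt) V.p≢q V.p≢r
        s′≡t′ = only₁ Nt (! s′t) (Nbrs.p≢r Ns ∘ sym) (Nbrs.q≢r Ns ∘ sym)

      K₃₃-iso : IsoTo Γ (Fin 6) (Steps K₃₃.nb) × x ≡ 2
      K₃₃-iso = iso 0F (λ {a} {b} → near₂-inj (near (K₃₃.two-steps a b))) , x≡2
        where
        ps = proj₁ p~s,t
        pt = proj₂ p~s,t
        φ : Fin 6 → Fin n
        φ = lookup (v ∷ p ∷ s ∷ q ∷ t ∷ r ∷ [])
        Np : Nbrs p v s t
        Np = nbrs₃ (! V.~p) ps pt Q.p≢q Q.p≢r Q.q≢r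
        cover : ∀ a → Nbrs (φ a) (φ (K₃₃.nb a 0F)) (φ (K₃₃.nb a 1F)) (φ (K₃₃.nb a 2F))
        cover 0F = Nv
        cover 1F = Np
        cover 2F = nbrs₃ (! ps) (! Q.~q) (! R′.~q) V.p≢q V.p≢r V.q≢r
        cover 3F = Nq
        cover 4F = nbrs₃ (! pt) (! Q.~r) (! R′.~r) V.p≢q V.p≢r V.q≢r
        cover 5F = Nr
        open Cover _≟_ K₃₃.nb φ K₃₃.back cover
        near : ∀ {a b} → Steps K₃₃.nb a b ⊎ (∃₂ λ i j → K₃₃.nb (K₃₃.nb a i) j ≡ b) → Near₂ a b
        near (inj₁ (i , refl)) = near₁ i
        near (inj₂ (i , j , refl)) = near₂ i j
        x≡2 : x ≡ 2
        x≡2 = corners X₄-sym bal (λ i j k → i ≡ 2 → j ≡ 2 → k ≡ 2 → x ≡ 2)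
          (λ h _ _ → h) (λ h _ _ → h) (λ _ h _ → h) (λ _ _ h → h) (λ _ h _ → h) (λ _ _ h → h) Nv
          (X≡2 Nq (! ps) (! pt)) (X≡2 Nr (! ps) (! pt)) (X≡2 Nr (! Q.~q) (! Q.~r))

    xy2⇒K₃₃ : Fin n → IsoTo Γ (Fin 6) (Steps K₃₃.nb) × x ≡ 2
    xy2⇒K₃₃ v = let _ , _ , _ , N , _ , _ , qr = star v in around N qr
      where
      around : ∀ {v p q r} → Nbrs v p q r → X q v r ≡ 2 → IsoTo Γ (Fin 6) (Steps K₃₃.nb) × x ≡ 2
      around Nv@(nbrs vp vq vr p≢q p≢r q≢r _) qr with nbrs₁ (! vr)
      ... | s , t , Nr@(nbrs rv rs rt v≢s v≢t s≢t _) = K₃₃-iso Nv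
              (nbrs₃ (! vq) (! (X≡2⇒ rv qr rs (v≢s ∘ sym))) (! (X≡2⇒ rv qr rt (v≢t ∘ sym))) v≢s v≢t s≢t) Nr

  -- `c`, `b`, `a` complete the 4-cycles on the corners at `v`; if two agreed, `p`, `q`, `r` would
  -- have a second common neighbour and one corner two 4-cycles. The 4-cycles on `c p b` and `c q a`
  -- both pass through the third neighbour of `c`, which is the antipode of `v`.
  111⇒cube : Fin n → Balanced 1 1 1 → IsoTo Γ (Fin 8) (Steps Cube.nb)
  111⇒cube v bal = let _ , _ , _ , N , pq , pr , qr = Balanced.star bal v in around N pq pr qr
    where
    one : ∀ {u v w} → u ~ v → v ~ w → u ≢ w → X u v w ≡ 1
    one = all-corners X₄-sym bal
    unique : ∀ {a b c x y} → a ~ b → b ~ c → a ≢ c → c ~ x → x ≢ b → x ~ a → c ~ y → y ≢ b → y ~ a → x ≡ y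
    unique ab bc a≢c cx x≢b xa cy y≢b ya = X≡1⇒ (! bc) (one ab bc a≢c) cx x≢b xa cy y≢b ya
    no-K₂₃ : ∀ {v p q r x} → Nbrs v p q r → v ≢ x → p ~ x → q ~ x → r ~ x → ⊥
    no-K₂₃ (nbrs vp vq vr p≢q p≢r q≢r _) v≢x px qx rx =
      q≢r (unique vp px v≢x (! qx) (p≢q ∘ sym) (! vq) (! rx) (p≢r ∘ sym) (! vr))
    module _ {v p q r a b c w : Fin n} (Nv : Nbrs v p q r) (Np : Nbrs p v c b) (Nq : Nbrs q v c a) (Nr : Nbrs r v b a)
             (Nc : Nbrs c p q w) (Nb : Nbrs b p r w) (Na : Nbrs a q r w) where
      cube : IsoTo Γ (Fin 8) (Steps Cube.nb)
      cube = iso 0F λ {a} {b} → separate (Cube.three-steps a b)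
        where
        φ : Fin 8 → Fin n
        φ = lookup (v ∷ p ∷ q ∷ r ∷ c ∷ b ∷ a ∷ w ∷ [])
        cover : ∀ a → Nbrs (φ a) (φ (Cube.nb a 0F)) (φ (Cube.nb a 1F)) (φ (Cube.nb a 2F))
        cover 0F = Nv
        cover 1F = Np
        cover 2F = Nq
        cover 3F = Nr
        cover 4F = Nc
        cover 5F = Nb
        cover 6F = Na
        cover 7F = nbrs₃ (! (Nbrs.~r Nc)) (! (Nbrs.~r Nb)) (! (Nbrs.~r Na)) (Nbrs.q≢r Np) (Nbrs.q≢r Nq) (Nbrs.q≢r Nr)
        open Cover _≟_ Cube.nb φ Cube.back cover
        separate : ∀ {a b} → Steps Cube.nb a b ⊎ (∃₂ λ i j → Cube.nb (Cube.nb a i) j ≡ b)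
          ⊎ (∃₂ λ i j → ∃ λ k → Cube.nb (Cube.nb (Cube.nb a i) j) k ≡ b) → φ a ≡ φ b → a ≡ b
        separate (inj₁ (i , refl)) = near₂-inj (near₁ i)
        separate (inj₂ (inj₁ (i , j , refl))) = near₂-inj (near₂ i j)
        separate {a} (inj₂ (inj₂ (i , j , k , refl))) e = contradiction e (near₃-inj no₃ {a} i j k)
    around : ∀ {v p q r} → Nbrs v p q r → X p v q ≡ 1 → X p v r ≡ 1 → X q v r ≡ 1 → IsoTo Γ (Fin 8) (Steps Cube.nb)
    around {v} {p} {q} {r} Nv@(nbrs vp vq vr p≢q p≢r q≢r _) pq pr qr
      with X≥1⇒ (! vq) (subst (1 ≤_) (sym pq) (s≤s z≤n)) | X≥1⇒ (! vr) (subst (1 ≤_) (sym pr) (s≤s z≤n))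
         | X≥1⇒ (! vr) (subst (1 ≤_) (sym qr) (s≤s z≤n))
    ... | c , qc , c≢v , cp | b , rb , b≢v , bp | a , ra , a≢v , aq
      with nbrs₃ (! vp) (! cp) (! bp) (c≢v ∘ sym) (b≢v ∘ sym) (λ { refl → no-K₂₃ Nv (c≢v ∘ sym) (! cp) qc rb })
         | nbrs₃ (! vq) qc (! aq) (c≢v ∘ sym) (a≢v ∘ sym) (λ { refl → no-K₂₃ Nv (c≢v ∘ sym) (! cp) qc ra })
         | nbrs₃ (! vr) rb ra (b≢v ∘ sym) (a≢v ∘ sym) (λ { refl → no-K₂₃ Nv (b≢v ∘ sym) (! bp) (! aq) rb })
    ... | Np | Nq | Nr with X≥1⇒ bp (subst (1 ≤_) (sym (one cp (! bp) (Nbrs.q≢r Np))) (s≤s z≤n))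
    ... | w , bw , w≢p , wc with X≥1⇒ aq (subst (1 ≤_) (sym (one (! qc) (! aq) (Nbrs.q≢r Nq))) (s≤s z≤n))
    ... | w′ , aw′ , w′≢q , w′c with nbrs₃ cp (! qc) (! wc) p≢q (w≢p ∘ sym) (q≢w Nq)
      where
      q≢w : Nbrs q v c a → q ≢ w
      q≢w Nq refl = case Nbrs.only Nq (! bw) of λ where
        (inj₁ e) → b≢v e
        (inj₂ (inj₁ e)) → Nbrs.q≢r Np (sym e)
        (inj₂ (inj₂ e)) → Nbrs.q≢r Nr e
    ... | Nc with Nbrs.only Nc (! w′c)
    ... | inj₁ refl = ⊥-elim (case Nbrs.only Np (! aw′) of λ where
            (inj₁ e) → a≢v e
            (inj₂ (inj₁ e)) → Nbrs.q≢r Nq (sym e)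
            (inj₂ (inj₂ e)) → Nbrs.q≢r Nr (sym e))
    ... | inj₂ (inj₁ e) = contradiction e w′≢q
    ... | inj₂ (inj₂ refl) = cube Nv Np Nq Nr Nc
            (nbrs₃ bp (! rb) bw p≢r (w≢p ∘ sym) r≢w) (nbrs₃ aq (! ra) aw′ q≢r (w′≢q ∘ sym) r≢w)
      where
      r≢w : r ≢ w
      r≢w refl = case Nbrs.only Nr wc of λ where
        (inj₁ e) → c≢v e
        (inj₂ (inj₁ e)) → Nbrs.q≢r Np e
        (inj₂ (inj₂ e)) → Nbrs.q≢r Nq e

-- Cycles in 2-regular graphs

least : {P : ℕ → Set} → (∀ m → Dec (P m)) → ∀ m → P m → ∃ λ k → P k × (∀ j → j < k → ¬ P j)
least {P} P? = <-rec _ step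
  where
  step : ∀ m → (∀ {k} → k < m → P k → ∃ λ k → P k × (∀ j → j < k → ¬ P j)) → P m → ∃ λ k → P k × (∀ j → j < k → ¬ P j)
  step m rec h with any? (λ (i : Fin m) → P? (toℕ i))
  ... | yes (i , p) = rec (toℕ<n i) p
  ... | no none = m , h , λ j j<m p → none (fromℕ< j<m , subst P (sym (toℕ-fromℕ< j<m)) p)

AddMod-total : ∀ {N} (x : Fin N) d → d ≤ N → ∃ λ y → AddMod N y x d
AddMod-total {N} x d d≤N with toℕ x + d ℕ.<? N
... | yes lt = fromℕ< lt , inj₁ (sym (toℕ-fromℕ< lt))
... | no ge = fromℕ< lt , inj₂ (sym (trans (cong (_+ N) (toℕ-fromℕ< lt)) (ℕₚ.m∸n+n≡m (ℕₚ.≮⇒≥ ge))))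
  where
  lt : toℕ x + d ∸ N < N
  lt = ℕₚ.+-cancelʳ-< N _ _ (subst (_< N + N) (sym (ℕₚ.m∸n+n≡m (ℕₚ.≮⇒≥ ge))) (ℕₚ.+-mono-<-≤ (toℕ<n x) d≤N))

AddMod-pred : ∀ {N} (x : Fin N) → ∃ λ y → AddMod N x y 1
AddMod-pred {suc N} x with toℕ x in eq
... | zero = fromℕ< (ℕₚ.n<1+n N) , inj₂ (trans (cong (_+ 1) (toℕ-fromℕ< (ℕₚ.n<1+n N))) (ℕₚ.+-comm N 1))
... | suc k = fromℕ< k< , inj₁ (trans (cong (_+ 1) (toℕ-fromℕ< k<)) (ℕₚ.+-comm k 1))
  where
  k< : k < suc N
  k< = ℕₚ.<-trans (ℕₚ.n<1+n k) (subst (_< suc N) eq (toℕ<n x))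

module TwoRegular {n : ℕ} (R : Fin n → Fin n → Set) (R-sym : ∀ {u v} → R u v → R v u) (R⇒≢ : ∀ {u v} → R u v → u ≢ v)
  (at-most-two : ∀ {v a b c} → R v a → R v b → R v c → a ≢ c → b ≢ c → a ≡ b)
  (other : ∀ {u v} → R u v → ∃ λ w → R v w × w ≢ u) where

  -- A walk without backtracking, indexed by all of `ℕ`. Its shifts and its images under an
  -- injective map preserving `R` are of the same kind, so symmetries of a cycle can be compared on
  -- two values.
  record Straight (t : ℕ → Fin n) : Set where
    field
      step : ∀ k → R (t k) (t (suc k))
      turn : ∀ k → t (suc (suc k)) ≢ t k

  straight-unique : ∀ {t t′} → Straight t → Straight t′ → t 0 ≡ t′ 0 → t 1 ≡ t′ 1 → ∀ k → t k ≡ t′ k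
  straight-unique {t} {t′} T₁ T₂ e₀ e₁ k = proj₁ (both k)
    where
    open Straight
    both : ∀ k → t k ≡ t′ k × t (suc k) ≡ t′ (suc k)
    both zero = e₀ , e₁
    both (suc k) with both k
    ... | e , e′ = e′ , at-most-two (step T₁ (suc k)) (subst (λ v → R v (t′ (suc (suc k)))) (sym e′) (step T₂ (suc k)))
            (R-sym (step T₁ k)) (turn T₁ k) (λ q → turn T₂ k (trans q e))

  shift : ∀ {t} → Straight t → ∀ i → Straight (λ k → t (k + i))
  shift T₁ i = record { step = λ k → Straight.step T₁ (k + i) ; turn = λ k → Straight.turn T₁ (k + i) }

  record Cycle : Set where
    field
      s : ℕ → Fin n
      straight : Straight s
      N : ℕ
      3≤N : 3 ≤ N
      s-N : s N ≡ s 0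
      s-inj : ∀ {i j} → i < N → j < N → s i ≡ s j → i ≡ j

  module FirstReturn {v₀ v₁ : Fin n} (r₀ : R v₀ v₁) where

    arc : ℕ → ∃₂ R
    arc zero = v₀ , v₁ , r₀
    arc (suc k) = let _ , v , r = arc k in v , proj₁ (other r) , proj₁ (proj₂ (other r))

    s : ℕ → Fin n
    s k = proj₁ (arc k)

    straight : Straight s
    straight = record { step = λ k → proj₂ (proj₂ (arc k)) ; turn = λ k → proj₂ (proj₂ (other (proj₂ (proj₂ (arc k))))) }

    open Straight straight

    Repeats : ℕ → Set
    Repeats j = ∃ λ (i : Fin j) → s (toℕ i) ≡ s j

    repeats : ∃ Repeats
    repeats with pigeonhole (ℕₚ.n<1+n n) (λ (i : Fin (suc n)) → s (toℕ i))
    ... | i , j , i<j , e = toℕ j , fromℕ< i<j , trans (cong s (toℕ-fromℕ< i<j)) e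

    -- If the first repetition met an inner index, the vertex before it would be one of the two walk
    -- neighbours of the earlier occurrence: an earlier repetition, a backtracking step or a loop.
    returns : ∀ i j → i < j → (∀ {i′ j′} → i′ < j′ → j′ < j → s i′ ≢ s j′) → s i ≡ s j → i ≡ 0
    returns zero _ _ _ _ = refl
    returns (suc i) (suc (suc j)) (s≤s (s≤s i≤j)) inj e with s i ≟ s (suc j)
    ... | yes q = contradiction q (inj (s≤s i≤j) (ℕₚ.n<1+n _))
    ... | no ne with at-most-two (step (suc i)) (subst (λ v → R v (s (suc j))) (sym e) (R-sym (step (suc j)))) (R-sym (step i)) (turn i) (ne ∘ sym)
    ... | q with ℕₚ.<-cmp (suc (suc i)) (suc j)
    ...   | tri< lt _ _ = contradiction q (inj lt (ℕₚ.n<1+n _))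
    ...   | tri≈ _ refl _ = contradiction (sym e) (turn (suc i))
    ...   | tri> _ _ gt with ℕₚ.≤-antisym i≤j (ℕₚ.≤-pred (ℕₚ.≤-pred gt))
    ...     | refl = contradiction e (R⇒≢ (step (suc i)))
    returns (suc i) (suc zero) (s≤s ()) _ _

    at-least-3 : ∀ N → 0 < N → s N ≡ s 0 → 3 ≤ N
    at-least-3 (suc zero) _ e = contradiction (sym e) (R⇒≢ (step 0))
    at-least-3 (suc (suc zero)) _ e = contradiction e (turn 0)
    at-least-3 (suc (suc (suc _))) _ _ = s≤s (s≤s (s≤s z≤n))

    fromFirst : ∀ N → Repeats N → (∀ j → j < N → ¬ Repeats j) → Cycle
    fromFirst N (i , e) fresh = record
      { s = s ; straight = straight ; N = N
      ; 3≤N = at-least-3 N (ℕₚ.≤-<-trans z≤n (toℕ<n i)) s-N ; s-N = s-N ; s-inj = inj }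
      where
      inj< : ∀ {i j} → i < j → j < N → s i ≢ s j
      inj< {i} {j} i<j j<N e = fresh j j<N (fromℕ< i<j , trans (cong s (toℕ-fromℕ< i<j)) e)
      s-N : s N ≡ s 0
      s-N = trans (sym e) (cong s (returns (toℕ i) N (toℕ<n i) inj< e))
      inj : ∀ {i j} → i < N → j < N → s i ≡ s j → i ≡ j
      inj {i} {j} i<N j<N e with ℕₚ.<-cmp i j
      ... | tri< lt _ _ = contradiction e (inj< lt j<N)
      ... | tri≈ _ eq _ = eq
      ... | tri> _ _ gt = contradiction (sym e) (inj< gt i<N)

  cycle : ∀ {v₀ v₁} → R v₀ v₁ → Cycle
  cycle r₀ = let N , r , fresh = least (λ j → any? λ i → s (toℕ i) ≟ s j) _ (proj₂ repeats) in fromFirst N r fresh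
    where open FirstReturn r₀

  module CycleProperties (C : Cycle) where
    open Cycle C
    open Straight straight

    abstract
      0<N : 0 < N
      0<N = ℕₚ.≤-trans (s≤s z≤n) 3≤N

      periodic : ∀ k → s (k + N) ≡ s k
      periodic = straight-unique (shift straight N) straight s-N (s-1+N N 3≤N s-N s-inj)
        where
        -- Both are neighbours of `s N` other than its predecessor; that `s 1` is not this
        -- predecessor uses `3 ≤ N`.
        s-1+N : ∀ N → 3 ≤ N → s N ≡ s 0 → (∀ {i j} → i < N → j < N → s i ≡ s j → i ≡ j) → s (suc N) ≡ s 1
        s-1+N (suc (suc (suc m))) _ e inj = at-most-two
          (step (suc (suc (suc m)))) (subst (λ v → R v (s 1)) (sym e) (step 0)) (R-sym (step (suc (suc m))))
          (turn (suc (suc m))) (λ q → contradiction (inj (s≤s (s≤s z≤n)) (ℕₚ.n<1+n _) q) λ ())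
        s-1+N (suc (suc zero)) (s≤s (s≤s ())) _ _
        s-1+N (suc zero) (s≤s ()) _ _

      s-AddMod : ∀ {x y : Fin N} {d} → AddMod N y x d → s (toℕ x + d) ≡ s (toℕ y)
      s-AddMod (inj₁ e) = cong s e
      s-AddMod {y = y} (inj₂ e) = trans (cong s e) (periodic (toℕ y))

      s-next : ∀ {x y : Fin N} → AddMod N y x 1 → R (s (toℕ x)) (s (toℕ y))
      s-next {x} {y} a = subst (R (s (toℕ x))) (trans (cong s (ℕₚ.+-comm 1 (toℕ x))) (s-AddMod {x} {y} a)) (step (toℕ x))

      s-CycAdj : ∀ {x y : Fin N} → CycAdj N x y → R (s (toℕ x)) (s (toℕ y))
      s-CycAdj {x} {y} (inj₁ a) = s-next {x} {y} a
      s-CycAdj {x} {y} (inj₂ a) = R-sym (s-next {y} {x} a)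

      R⇒CycAdj : ∀ (x : Fin N) {t} → R (s (toℕ x)) t → ∃ λ y → CycAdj N x y × s (toℕ y) ≡ t
      R⇒CycAdj x {t} r with AddMod-total x 1 0<N | AddMod-pred x
      ... | y , a | z , b with s (toℕ z) ≟ t
      ... | yes e = z , inj₂ b , e
      ... | no ne = y , inj₁ a , at-most-two (s-next {x} {y} a) r (R-sym (s-next {z} {x} b)) y≢z (ne ∘ sym)
        where
        y≢z : s (toℕ y) ≢ s (toℕ z)
        y≢z e = turn (toℕ z) (trans (cong (λ k → s (suc k)) (ℕₚ.+-comm 1 (toℕ z))) (trans (two-on b)
                  (trans (cong s (ℕₚ.+-comm 1 (toℕ x))) (trans (s-AddMod {x} {y} a) e))))
          where
          two-on : AddMod N x z 1 → s (suc (toℕ z + 1)) ≡ s (suc (toℕ x))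
          two-on (inj₁ q) = cong (λ k → s (suc k)) q
          two-on (inj₂ q) = trans (cong (λ k → s (suc k)) q) (periodic (suc (toℕ x)))

halve : ∀ k → ∃ λ j → k ≡ j + j ⊎ k ≡ suc (j + j)
halve zero = 0 , inj₁ refl
halve (suc k) with halve k
... | j , inj₁ refl = j , inj₂ refl
... | j , inj₂ refl = suc j , inj₁ (cong suc (sym (ℕₚ.+-suc j j)))

-- Perfect matchings, prisms and Möbius ladders

module Matching {n : ℕ} (Γ : Graph n) (cubic : Cubic Γ)
  (ρ : Fin n → Fin n) (rung : ∀ v → Cub._~_ Γ cubic v (ρ v)) (ρ-involutive : ∀ v → ρ (ρ v) ≡ v) where

  open Cub Γ cubic
  private
    ! : ∀ {u v} → u ~ v → v ~ u
    ! = ~-sym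

  ρ-injective : ∀ {u v} → ρ u ≡ ρ v → u ≡ v
  ρ-injective e = trans (sym (ρ-involutive _)) (trans (cong ρ e) (ρ-involutive _))

  -- Removing the matching leaves a 2-regular graph. The matching will consist of the edges on two
  -- 4-cycles for ladders, and of the edges on no girth cycle for truncations.
  R : Fin n → Fin n → Set
  R u v = u ~ v × v ≢ ρ u

  abstract
    R-sym : ∀ {u v} → R u v → R v u
    R-sym (uv , v≢) = ! uv , λ e → v≢ (trans (sym (ρ-involutive _)) (cong ρ (sym e)))

    R⇒≢ : ∀ {u v} → R u v → u ≢ v
    R⇒≢ (uv , _) = ~⇒≢ uv

    at-most-two : ∀ {v a b c} → R v a → R v b → R v c → a ≢ c → b ≢ c → a ≡ b
    at-most-two {v} (va , a≢ρ) (vb , b≢ρ) (vc , c≢ρ) a≢c b≢c with nbrs₂ (rung v) vc (c≢ρ ∘ sym)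
    ... | t , N = trans (only₁ N va a≢ρ a≢c) (sym (only₁ N vb b≢ρ b≢c))

    other : ∀ {u v} → R u v → ∃ λ w → R v w × w ≢ u
    other {u} {v} r with R-sym r
    ... | vu , u≢ρ with nbrs₂ (rung v) vu (u≢ρ ∘ sym)
    ... | t , N = t , (Nbrs.~r N , Nbrs.p≢r N ∘ sym) , Nbrs.q≢r N ∘ sym

module Ladder {n : ℕ} (Γ : Graph n) (cubic : Cubic Γ) (connected : Connected Γ)
  (no₃ : Girths.TriangleFree Γ cubic) (bal : Girths.S₄.Balanced Γ cubic 0 1 1) where

  open Cub Γ cubic
  open Girths Γ cubic
  open Corner κ₄
  open Covers Γ cubic connected
  open S₄.Balanced bal
  private
    ! : ∀ {u v} → u ~ v → v ~ u
    ! = ~-sym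

  -- The rung at v is the edge on two 4-cycles.
  abstract
    ρ : Fin n → Fin n
    ρ v = proj₁ (proj₂ (proj₂ (star v)))

    rung : ∀ v → v ~ ρ v
    rung v = let _ , _ , _ , N , _ = star v in Nbrs.~r N

    corner₀ : ∀ {u v w} → v ~ u → v ~ w → u ≢ w → u ≢ ρ v → w ≢ ρ v → X u v w ≡ 0
    corner₀ {u} {v} {w} vu vw u≢w u≢ρ w≢ρ = let p , q , _ , N , pq , _ = star v in go N pq u≢ρ w≢ρ
      where
      go : ∀ {p q r} → Nbrs v p q r → X p v q ≡ 0 → u ≢ r → w ≢ r → X u v w ≡ 0
      go N pq u≢r w≢r with only₂ (rot² N) vu u≢r | only₂ (rot² N) vw w≢r
      ... | inj₁ refl | inj₁ refl = contradiction refl u≢w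
      ... | inj₂ refl | inj₂ refl = contradiction refl u≢w
      ... | inj₁ refl | inj₂ refl = pq
      ... | inj₂ refl | inj₁ refl = trans (X₄-sym (! vu) vw u≢w) pq

    corner₁ : ∀ {u v} → v ~ u → u ≢ ρ v → X u v (ρ v) ≡ 1
    corner₁ {u} {v} vu u≢ρ = let p , q , _ , N , _ , pr , qr = star v in go N pr qr u≢ρ
      where
      go : ∀ {p q r} → Nbrs v p q r → X p v r ≡ 1 → X q v r ≡ 1 → u ≢ r → X u v r ≡ 1
      go N pr qr u≢r with only₂ (rot² N) vu u≢r
      ... | inj₁ refl = pr
      ... | inj₂ refl = qr

    -- Were the rung at `ρ v` another edge, the edge from `v` to `ρ v` would count `1 + 1` at `v`
    -- but `1 + 0` at `ρ v`.
    ρ-involutive : ∀ v → ρ (ρ v) ≡ v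
    ρ-involutive v with ρ (ρ v) ≟ v
    ... | yes e = e
    ... | no ne with nbrs₁ (rung v) | nbrs₂ (! (rung v)) (rung (ρ v)) (ne ∘ sym)
    ... | p , q , N | t , M = contradiction (trans (sym lhs) (trans (Regular.ε-sym Γ cubic 4 κ₄ (Graph.sym Γ) N M) rhs)) λ ()
      where
      module N = Nbrs N
      module M = Nbrs M
      lhs : X p v (ρ v) + X q v (ρ v) ≡ 2
      lhs = cong₂ _+_ (corner₁ N.~q (N.p≢q ∘ sym)) (corner₁ N.~r (N.p≢r ∘ sym))
      rhs : X (ρ (ρ v)) (ρ v) v + X t (ρ v) v ≡ 1
      rhs = cong₂ _+_ (trans (X₄-sym (! M.~q) M.~p (M.p≢q ∘ sym)) (corner₁ M.~p M.p≢q))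
                      (corner₀ M.~r M.~p (M.p≢r ∘ sym) (M.q≢r ∘ sym) M.p≢q)

  open Matching Γ cubic ρ rung ρ-involutive

  abstract
    -- The 4-cycle on `v`, `u`, `ρ u` closes with `ρ v`: any other fourth vertex would put a 4-cycle
    -- on the corner at `v` that avoids the rung, which counts `0`.
    ρ-R : ∀ {u v} → R u v → R (ρ u) (ρ v)
    ρ-R {u} {v} (uv , v≢ρu) with X≥1⇒ (! (rung u)) (subst (1 ≤_) (sym (corner₁ uv v≢ρu)) (s≤s z≤n))
    ... | x , ρux , x≢u , xv with x ≟ ρ v
    ... | yes refl = ρux , λ e → x≢u (trans e (ρ-involutive u))
    ... | no x≢ρv = contradiction (subst (1 ≤_) (corner₀ (! uv) (! xv) (x≢u ∘ sym) (proj₂ (R-sym (uv , v≢ρu))) x≢ρv)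
                      (X≥1 xv (! ρux) (v≢ρu ∘ sym) (! (rung u)))) λ ()

  open TwoRegular R R-sym R⇒≢ at-most-two other

  Ladders : Set
  Ladders = ∃ λ m → 3 ≤ m × (IsoTo Γ (Fin m × Bool) (PrismAdj m) ⊎ IsoTo Γ (Fin (2 * m)) (MobiusAdj m))

  module _ (C : Cycle) where
    open Cycle C
    open Straight straight
    open CycleProperties C

    ρ-straight : Straight (ρ ∘ s)
    ρ-straight = record { step = λ k → ρ-R (step k) ; turn = λ k e → turn k (ρ-injective e) }

    module Disjoint (apart : ¬ ∃ λ (k : Fin N) → ρ (s 0) ≡ s (toℕ k)) where

      -- The cycle is closed under `R`, so a meeting at `suc j` moves back along `ρ ∘ s` to one at
      -- `j`.
      disjoint : ∀ j (i : Fin N) → ρ (s j) ≢ s (toℕ i)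
      disjoint zero i e = apart (i , e)
      disjoint (suc j) i e with R⇒CycAdj i (subst (λ v → R v (ρ (s j))) e (R-sym (ρ-R (step j))))
      ... | k , _ , q = disjoint j k (sym q)

      φ : Fin N × Bool → Fin n
      φ (i , false) = s (toℕ i)
      φ (i , true) = ρ (s (toℕ i))

      φ-inj : ∀ {a b} → φ a ≡ φ b → a ≡ b
      φ-inj {i , false} {j , false} e = cong (_, false) (toℕ-injective (s-inj (toℕ<n i) (toℕ<n j) e))
      φ-inj {i , true} {j , true} e = cong (_, true) (toℕ-injective (s-inj (toℕ<n i) (toℕ<n j) (ρ-injective e)))
      φ-inj {i , false} {j , true} e = contradiction (sym e) (disjoint (toℕ j) i)
      φ-inj {i , true} {j , false} e = contradiction e (disjoint (toℕ i) j)

      hom : ∀ {a b} → PrismAdj N a b → φ a ~ φ b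
      hom {i , false} {_ , false} (inj₁ (_ , ne)) = contradiction refl ne
      hom {i , true} {_ , true} (inj₁ (_ , ne)) = contradiction refl ne
      hom {i , false} {_ , true} (inj₁ (refl , _)) = rung _
      hom {i , true} {_ , false} (inj₁ (refl , _)) = ! (rung _)
      hom {i , false} {j , _} (inj₂ (refl , c)) = proj₁ (s-CycAdj {i} {j} c)
      hom {i , true} {j , _} (inj₂ (refl , c)) = proj₁ (ρ-R (s-CycAdj {i} {j} c))

      lift : ∀ {a y} → φ a ~ y → ∃ λ b → PrismAdj N a b × φ b ≡ y
      lift {i , false} {y} h with y ≟ ρ (s (toℕ i))
      ... | yes refl = (i , true) , inj₁ (refl , λ ()) , refl
      ... | no ne with R⇒CycAdj i (h , ne)
      ... | j , c , e = (j , false) , inj₂ (refl , c) , e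
      lift {i , true} {y} h with y ≟ ρ (ρ (s (toℕ i)))
      ... | yes refl = (i , false) , inj₁ (refl , λ ()) , sym (ρ-involutive _)
      ... | no ne with R⇒CycAdj i (subst (λ v → R v (ρ y)) (ρ-involutive _) (ρ-R (h , ne)))
      ... | j , c , e = (j , true) , inj₂ (refl , c) , trans (cong ρ e) (ρ-involutive y)

      prism : Ladders
      prism = N , 3≤N , inj₁ (isoFrom φ (fromℕ< 0<N , false) φ-inj (λ {a} {b} → hom {a} {b}) lift)

    -- If ρ reversed the cycle, it would fix a vertex or the two ends of an edge of the cycle.
    reflect : ∀ k → ρ (s 0) ≡ s (suc k) → ρ (s 1) ≡ s k
      → ∀ i → (∀ j → i + j ≡ suc k → ρ (s i) ≡ s j) × (∀ j → suc i + j ≡ suc k → ρ (s (suc i)) ≡ s j)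
    reflect k e₀ e₁ zero = (λ { _ refl → e₀ }) , λ { _ refl → e₁ }
    reflect k e₀ e₁ (suc i) with reflect k e₀ e₁ i
    ... | f , g = g , λ j q → at-most-two (ρ-R (step (suc i)))
            (subst (λ v → R v (s j)) (sym (g (suc j) (trans (cong suc (ℕₚ.+-suc i j)) q))) (R-sym (step j)))
            (R-sym (ρ-R (step i))) (λ e → turn i (ρ-injective e))
            (λ e → turn j (trans (sym (f (suc (suc j)) (trans (ℕₚ.+-suc i (suc j)) (trans (cong suc (ℕₚ.+-suc i j)) q)))) (sym e)))

    no-reflection : ∀ k → ρ (s 0) ≡ s (suc k) → ρ (s 1) ≢ s k
    no-reflection k e₀ e₁ with halve (suc k)
    ... | j , inj₁ q = ~⇒≢ (rung (s j)) (sym (proj₁ (reflect k e₀ e₁ j) j (sym q)))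
    ... | j , inj₂ q = proj₂ (step j) (sym (proj₁ (reflect k e₀ e₁ j) (suc j) (trans (ℕₚ.+-suc j j) (sym q))))

    module Rotation {k : ℕ} (0<k : 0 < k) (k<N : k < N) (e₀ : ρ (s 0) ≡ s k) (e₁ : ρ (s 1) ≡ s (suc k)) where

      rotate : ∀ i → ρ (s i) ≡ s (i + k)
      rotate = straight-unique ρ-straight (shift straight k) e₀ e₁

      -- Applying `ρ` twice is the identity and shifts the cycle by `2 * k`, which lies strictly
      -- between `0` and `2 * N`.
      N≡2k : N ≡ 2 * k
      N≡2k with ℕₚ.<-cmp (k + k) N
      ... | tri≈ _ e _ = trans (sym e) (cong (k +_) (sym (ℕₚ.+-identityʳ k)))
      ... | tri< lt _ _ = contradiction (s-inj lt 0<N s2k) (λ e → ℕₚ.<⇒≢ 0<k (sym (ℕₚ.m+n≡0⇒m≡0 k e)))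
        where
        s2k : s (k + k) ≡ s 0
        s2k = trans (sym (rotate k)) (trans (cong ρ (sym e₀)) (ρ-involutive _))
      ... | tri> _ _ gt = contradiction
              (s-inj {k + k ∸ N} {0} (ℕₚ.+-cancelʳ-< N _ _ (subst (_< N + N) (sym (ℕₚ.m∸n+n≡m (ℕₚ.<⇒≤ gt))) (ℕₚ.+-mono-< k<N k<N))) 0<N
                (trans (sym (periodic (k + k ∸ N))) (trans (cong s (ℕₚ.m∸n+n≡m (ℕₚ.<⇒≤ gt)))
                  (trans (sym (rotate k)) (trans (cong ρ (sym e₀)) (ρ-involutive _))))))
              (λ e → ℕₚ.<⇒≢ (ℕₚ.m<n⇒0<n∸m gt) (sym e))

      3≤k : 3 ≤ k
      3≤k = go k N≡2k e₀
        where
        go : ∀ k → N ≡ 2 * k → ρ (s 0) ≡ s k → 3 ≤ k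
        go zero e _ = contradiction (subst (3 ≤_) e 3≤N) λ ()
        go (suc zero) e _ = contradiction (subst (3 ≤_) e 3≤N) λ { (s≤s (s≤s ())) }
        go (suc (suc zero)) _ e = ⊥-elim (no₃ (proj₁ (step 0)) (proj₁ (step 1)) (! (subst (s 0 ~_) e (rung (s 0)))))
        go (suc (suc (suc _))) _ _ = s≤s (s≤s (s≤s z≤n))

      -- The modulus is a parameter so that the isomorphism can be transported along `N≡2k`, where
      -- `MAdj` becomes `MobiusAdj k`.
      MAdj : ∀ M → Fin M → Fin M → Set
      MAdj M x y = AddMod M y x 1 ⊎ AddMod M x y 1 ⊎ AddMod M y x k

      hom : ∀ {x y} → MAdj N x y → s (toℕ x) ~ s (toℕ y)
      hom {x} {y} (inj₁ a) = proj₁ (s-next {x} {y} a)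
      hom {x} {y} (inj₂ (inj₁ a)) = ! (proj₁ (s-next {y} {x} a))
      hom {x} {y} (inj₂ (inj₂ a)) = subst (s (toℕ x) ~_) (trans (rotate (toℕ x)) (s-AddMod {x} {y} a)) (rung _)

      lift : ∀ {x : Fin N} {t} → s (toℕ x) ~ t → ∃ λ y → MAdj N x y × s (toℕ y) ≡ t
      lift {x} {t} h with t ≟ ρ (s (toℕ x))
      ... | yes refl = let y , a = AddMod-total x k (ℕₚ.<⇒≤ k<N) in y , inj₂ (inj₂ a) , sym (trans (rotate (toℕ x)) (s-AddMod {x} {y} a))
      ... | no ne with R⇒CycAdj x (h , ne)
      ... | y , inj₁ a , e = y , inj₁ a , e
      ... | y , inj₂ a , e = y , inj₂ (inj₁ a) , e

      möbius : Ladders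
      möbius = k , 3≤k , inj₂ (subst (λ M → IsoTo Γ (Fin M) (MAdj M)) N≡2k
        (isoFrom (s ∘ toℕ) (fromℕ< 0<N) (λ e → toℕ-injective (s-inj (toℕ<n _) (toℕ<n _) e)) hom lift))

    -- Once `ρ (s 0)` lies on the cycle, `ρ ∘ s` runs along it in one of the two directions, and
    -- `ρ (s 1)` tells which.
    ladder : Ladders
    ladder with any? (λ (k : Fin N) → ρ (s 0) ≟ s (toℕ k))
    ... | no apart = Disjoint.prism apart
    ... | yes (k , e₀) = go (toℕ k) (toℕ<n k) e₀
      where
      go : ∀ k → k < N → ρ (s 0) ≡ s k → Ladders
      go zero _ e = contradiction (sym e) (~⇒≢ (rung (s 0)))
      go (suc k) k<N e₀ with ρ (s 1) ≟ s k
      ... | yes e₁ = ⊥-elim (no-reflection k e₀ e₁)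
      ... | no ne = Rotation.möbius (s≤s z≤n) k<N e₀ (at-most-two (subst (λ v → R v (ρ (s 1))) e₀ (ρ-R (step 0))) (step (suc k)) (R-sym (step k)) ne (turn k))

  011⇒ladder : Fin n → Ladders
  011⇒ladder v with nbrs₁ (rung v)
  ... | _ , _ , N = ladder (cycle (Nbrs.~q N , Nbrs.p≢q N ∘ sym))

  no-squares : Fin n → ¬ (∀ {u v w} → v ~ u → v ~ w → u ≢ w → ∃ λ x → w ~ x × x ≢ v × x ~ u)
  no-squares v h with nbrs₁ (rung v)
  ... | _ , _ , nbrs _ vp vq ρ≢p ρ≢q p≢q _ with h vp vq p≢q
  ... | x , qx , x≢v , xp = contradiction (subst (1 ≤_) (corner₀ vp vq p≢q (ρ≢p ∘ sym) (ρ≢q ∘ sym)) (X≥1 (! vq) qx x≢v xp)) λ ()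

-- Truncations

Unique⇒lookup-injective : {xs : List A} → Unique xs → ∀ i j → List.lookup xs i ≡ List.lookup xs j → i ≡ j
Unique⇒lookup-injective (_ ∷ _) zero zero _ = refl
Unique⇒lookup-injective {xs = _ ∷ xs} (x∉ ∷ _) zero (suc j) e = contradiction e (All.lookup x∉ (∈-lookup {xs = xs} j))
Unique⇒lookup-injective {xs = _ ∷ xs} (x∉ ∷ _) (suc i) zero e = contradiction (sym e) (All.lookup x∉ (∈-lookup {xs = xs} i))
Unique⇒lookup-injective (_ ∷ u) (suc i) (suc j) e = cong suc (Unique⇒lookup-injective u i j e)

filterᵇ-cong : (p q : A → Bool) → (∀ x → T (p x) → T (q x)) → (∀ x → T (q x) → T (p x)) → ∀ xs → filterᵇ p xs ≡ filterᵇ q xs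
filterᵇ-cong p q f g = filter-≐ (T? ∘ p) (T? ∘ q) ((λ {x} → f x) , (λ {x} → g x))

-- The vertices of a `MultiGraph` have to form a `Fin`, so a value of `f` is replaced by its
-- position in the list of distinct values.
module Image {n : ℕ} {B : Set} (_≟ᴮ_ : (a b : B) → Dec (a ≡ b)) (f : Fin n → B) where

  abstract
    values : List B
    values = List.deduplicate _≟ᴮ_ (map f (allFin n))

    size : ℕ
    size = length values

    private
      Unique-values : Unique values
      Unique-values = DecUniqueₚ.deduplicate-! _≟ᴮ_ (map f (allFin n))

      f∈ : ∀ x → f x ∈ values
      f∈ x = ∈-deduplicate⁺ _≟ᴮ_ (∈-map⁺ f (∈-allFin x))

    class : Fin n → Fin size
    class x = Any.index (f∈ x)

    class⇒≡ : ∀ {x y} → class x ≡ class y → f x ≡ f y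
    class⇒≡ {x} {y} e = trans (lookup-index (f∈ x)) (trans (cong (List.lookup values) e) (sym (lookup-index (f∈ y))))

    ≡⇒class : ∀ {x y} → f x ≡ f y → class x ≡ class y
    ≡⇒class {x} {y} e = Unique⇒lookup-injective Unique-values _ _ (trans (sym (lookup-index (f∈ x))) (trans e (lookup-index (f∈ y))))

    class-onto : ∀ u → ∃ λ x → class x ≡ u
    class-onto u with ∈-map⁻ f (∈-deduplicate⁻ _≟ᴮ_ (map f (allFin n)) (∈-lookup {xs = values} u))
    ... | x , _ , e = x , Unique⇒lookup-injective Unique-values _ _ (trans (sym (lookup-index (f∈ x))) (sym e))

module Involution {n : ℕ} (ρ : Fin n → Fin n) (ρ-involutive : ∀ v → ρ (ρ v) ≡ v) (ρ-free : ∀ v → ρ v ≢ v) where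

  abstract
    private
      lower : Fin n → Bool
      lower v = toℕ v ℕ.<ᵇ toℕ (ρ v)

      reps : List (Fin n)
      reps = filterᵇ lower (allFin n)

      Unique-reps : Unique reps
      Unique-reps = Unique-filterᵇ lower (Uniqueₚ.allFin⁺ n)

    pairs : ℕ
    pairs = length reps

    -- Each orbit of `ρ` is an edge, represented by its smaller element. Arcs thereby correspond to
    -- vertices of Γ, and reversal of arcs to `ρ`.
    point : Fin pairs × Bool → Fin n
    point (e , false) = List.lookup reps e
    point (e , true) = ρ (List.lookup reps e)

    private
      lower-lookup : ∀ e → toℕ (List.lookup reps e) < toℕ (ρ (List.lookup reps e))
      lower-lookup e = ℕₚ.<ᵇ⇒< _ _ (proj₂ (∈-filterᵇ⁻ lower {xs = allFin n} (∈-lookup {xs = reps} e)))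

      ∈reps : ∀ {v} → toℕ v < toℕ (ρ v) → ∃ λ e → List.lookup reps e ≡ v
      ∈reps {v} lt = Any.index m , sym (lookup-index m)
        where
        m : v ∈ reps
        m = ∈-filterᵇ⁺ lower (∈-allFin v) (ℕₚ.<⇒<ᵇ lt)

      crossed : ∀ e e′ → List.lookup reps e ≢ ρ (List.lookup reps e′)
      crossed e e′ q = ℕₚ.<-asym (lower-lookup e′) (subst₂ (λ u v → toℕ u < toℕ v) q (trans (cong ρ q) (ρ-involutive _)) (lower-lookup e))

    point-inv : ∀ e b → point (e , not b) ≡ ρ (point (e , b))
    point-inv e false = refl
    point-inv e true = sym (ρ-involutive _)

    point-inj : ∀ {s t} → point s ≡ point t → s ≡ t
    point-inj {e , false} {e′ , false} q = cong (_, false) (Unique⇒lookup-injective Unique-reps e e′ q)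
    point-inj {e , true} {e′ , true} q = cong (_, true) (Unique⇒lookup-injective Unique-reps e e′
      (trans (sym (ρ-involutive _)) (trans (cong ρ q) (ρ-involutive _))))
    point-inj {e , false} {e′ , true} q = contradiction q (crossed e e′)
    point-inj {e , true} {e′ , false} q = contradiction (sym q) (crossed e′ e)

    point-onto : ∀ v → ∃ λ s → point s ≡ v
    point-onto v with ℕₚ.<-cmp (toℕ v) (toℕ (ρ v))
    ... | tri< lt _ _ = let e , q = ∈reps lt in (e , false) , q
    ... | tri≈ _ q _ = contradiction (sym (toℕ-injective q)) (ρ-free v)
    ... | tri> _ _ gt = let e , q = ∈reps (subst (λ u → toℕ (ρ v) < toℕ u) (sym (ρ-involutive v)) gt)
                        in (e , true) , trans (cong ρ q) (ρ-involutive v)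

module Truncation {n : ℕ} (Γ : Graph n) (cubic : Cubic Γ)
  (ρ : Fin n → Fin n) (rung : ∀ v → Cub._~_ Γ cubic v (ρ v)) (ρ-involutive : ∀ v → ρ (ρ v) ≡ v) where

  open Cub Γ cubic
  open Matching Γ cubic ρ rung ρ-involutive

  record Block (g : ℕ) (v : Fin n) : Set where
    field
      members   : List (Fin n)
      size      : length members ≡ g
      unique    : Unique members
      v∈        : v ∈ members
      closed    : ∀ {x y} → x ∈ members → R x y → y ∈ members
      connected : ∀ {x y} → x ∈ members → y ∈ members → Star R x y

  module _ {g : ℕ} (block : ∀ v → Block g v) where
    open module B v = Block (block v) using (members)
    open DecMembership {A = Fin n} _≟_ using (_∈?_)

    abstract
      member : Fin n → Fin n → Bool
      member x y = ⌊ y ∈? members x ⌋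

      -- The lists `members` of two vertices of one block may differ in order. Filtering `allFin n`
      -- makes the list canonical, so lying in one block becomes equality of values.
      rep : Fin n → List (Fin n)
      rep x = filterᵇ (member x) (allFin n)

      ∈-closed : ∀ x {y z} → Star R y z → y ∈ members x → z ∈ members x
      ∈-closed x ε⋆ y∈ = y∈
      ∈-closed x (r ◅ rs) y∈ = ∈-closed x rs (B.closed x y∈ r)

      rep⇒∈ : ∀ {x y} → rep x ≡ rep y → y ∈ members x
      rep⇒∈ {x} {y} e = toWitness (proj₂ (∈-filterᵇ⁻ (member x) {xs = allFin n}
        (subst (y ∈_) (sym e) (∈-filterᵇ⁺ (member y) (∈-allFin y) (fromWitness (B.v∈ y))))))

      ∈⇒rep : ∀ {x y} → y ∈ members x → rep x ≡ rep y
      ∈⇒rep {x} {y} y∈ = filterᵇ-cong (member x) (member y)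
        (λ z h → fromWitness (∈-closed y (B.connected x y∈ (toWitness h)) (B.v∈ y)))
        (λ z h → fromWitness (∈-closed x (B.connected y (B.v∈ y) (toWitness h)) y∈)) (allFin n)

    open Image (Listₚ.≡-dec _≟_) rep
    open Involution ρ ρ-involutive (λ v e → ~⇒≢ (rung v) (sym e))

    -- Blocks are contracted to vertices and rungs become edges; the tail of an arc is the block of
    -- the corresponding vertex of Γ.
    Λ : MultiGraph
    Λ = record { nv = size ; ne = pairs ; ends = λ e b → class (point (e , b)) }

    index : Fin n → Arc Λ
    index v = proj₁ (point-onto v)

    point-index : ∀ v → point (index v) ≡ v
    point-index v = proj₂ (point-onto v)

    index-point : ∀ s → index (point s) ≡ s
    index-point s = point-inj (point-index (point s))

    scheme : Arc Λ → Arc Λ → Set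
    scheme s t = R (point s) (point t)

    R⇒scheme : ∀ {x y} → R x y → scheme (index x) (index y)
    R⇒scheme {x} {y} = subst₂ R (sym (point-index x)) (sym (point-index y))

    dihedral : IsDihedralScheme Λ scheme
    dihedral = (λ s r → R⇒≢ r refl) , (λ s t → R-sym) , (λ s → two s (nbrs₁ (rung (point s))))
      , (λ s t r → ≡⇒class (∈⇒rep (B.closed (point s) (B.v∈ (point s)) r)))
      , (λ s t e → subst₂ (Star scheme) (index-point s) (index-point t)
          (gmap index R⇒scheme (B.connected (point s) (B.v∈ (point s)) (rep⇒∈ (class⇒≡ e)))))
      , λ u → let x , e = class-onto u in index x , trans (cong class (point-index x)) e
      where
      two : ∀ s → (∃ λ p → ∃ λ q → Nbrs (point s) (ρ (point s)) p q)
        → Σ (Arc Λ) λ t₁ → Σ (Arc Λ) λ t₂ → t₁ ≢ t₂ × scheme s t₁ × scheme s t₂ × (∀ t → scheme s t → t ≡ t₁ ⊎ t ≡ t₂)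
      two s (p , q , N) = index p , index q
        , (λ e → Nbrs.q≢r N (trans (sym (point-index p)) (trans (cong point e) (point-index q))))
        , subst (R (point s)) (sym (point-index p)) (Nbrs.~q N , Nbrs.p≢q N ∘ sym)
        , subst (R (point s)) (sym (point-index q)) (Nbrs.~r N , Nbrs.p≢r N ∘ sym)
        , λ t r → which t (only₂ N (proj₁ r) (proj₂ r))
        where
        which : ∀ t → point t ≡ p ⊎ point t ≡ q → t ≡ index p ⊎ t ≡ index q
        which t (inj₁ e) = inj₁ (trans (sym (index-point t)) (cong index e))
        which t (inj₂ e) = inj₂ (trans (sym (index-point t)) (cong index e))

    index-inj : ∀ {x y} → index x ≡ index y → x ≡ y
    index-inj {x} {y} e = trans (sym (point-index x)) (trans (cong point e) (point-index y))

    truncation : IsoTo Γ (Arc Λ) (TrAdj Λ scheme)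
    truncation = index , (index-inj , λ s → point s , λ { refl → index-point s }) , λ x y → mk⇔ (to x y) (from x y)
      where
      to : ∀ x y → x ~ y → TrAdj Λ scheme (index x) (index y)
      to x y h with y ≟ ρ x
      ... | no ne = inj₁ (R⇒scheme (h , ne))
      ... | yes e = inj₂ (point-inj (trans (point-index y) (trans e
                      (trans (cong ρ (sym (point-index x))) (sym (point-inv (proj₁ (index x)) (proj₂ (index x))))))))
      from : ∀ x y → TrAdj Λ scheme (index x) (index y) → x ~ y
      from x y (inj₁ r) = subst₂ _~_ (point-index x) (point-index y) (proj₁ r)
      from x y (inj₂ e) = subst (x ~_) (sym y≡ρx) (rung x)
        where
        y≡ρx : y ≡ ρ x
        y≡ρx = trans (sym (point-index y)) (trans (cong point e) (trans (point-inv (proj₁ (index x)) (proj₂ (index x))) (cong ρ (point-index x))))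

    Unique-arcs : Unique (arcs Λ)
    Unique-arcs = Unique-concatMap (λ e → (e , false) ∷ (e , true) ∷ []) (Uniqueₚ.allFin⁺ pairs)
      (λ e → ((λ ()) ∷ []) ∷ [] ∷ []) (λ p q → trans (sym (edge p)) (edge q))
      where
      edge : ∀ {e s} → s ∈ (e , false) ∷ (e , true) ∷ [] → proj₁ s ≡ e
      edge (here refl) = refl
      edge (there (here refl)) = refl

    ∈-arcs : ∀ s → s ∈ arcs Λ
    ∈-arcs (e , b) = ∈-concatMap (λ e → (e , false) ∷ (e , true) ∷ []) (∈-allFin e) (side b)
      where
      side : ∀ b → (e , b) ∈ (e , false) ∷ (e , true) ∷ []
      side false = here refl
      side true = there (here refl)

    regular : Regular Λ g
    regular u = trans (length≡ (Unique-filterᵇ at-u Unique-arcs) (Uniqueₚ.map⁺ index-inj (B.unique x)) to from)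
                  (trans (length-map index (members x)) (B.size x))
      where
      x = proj₁ (class-onto u)
      at-u : Arc Λ → Bool
      at-u s = ⌊ tail Λ s ≟ u ⌋
      to : ∀ {s} → s ∈ filterᵇ at-u (arcs Λ) → s ∈ map index (members x)
      to {s} s∈ = subst (_∈ map index (members x)) (index-point s) (∈-map⁺ index (rep⇒∈ (class⇒≡
        (trans (proj₂ (class-onto u)) (sym (toWitness (proj₂ (∈-filterᵇ⁻ at-u {xs = arcs Λ} s∈))))))))
      from : ∀ {s} → s ∈ map index (members x) → s ∈ filterᵇ at-u (arcs Λ)
      from s∈ with ∈-map⁻ index s∈
      ... | y , y∈ , refl = ∈-filterᵇ⁺ at-u (∈-arcs (index y))
              (fromWitness (trans (cong class (point-index y)) (trans (≡⇒class (sym (∈⇒rep y∈))) (proj₂ (class-onto u)))))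

    truncated : Σ MultiGraph (λ Λ → Σ (Arc Λ → Arc Λ → Set) (λ S → Regular Λ g × IsDihedralScheme Λ S × IsoTo Γ (Arc Λ) (TrAdj Λ S)))
    truncated = Λ , scheme , regular , dihedral , truncation

  Star-sym : ∀ {x y} → Star R x y → Star R y x
  Star-sym = reverse R-sym

  -- Two different `R`-neighbours inside the list leave no room for a third, so closure is checked
  -- member by member.
  mkBlock : ∀ {g v} (xs : List (Fin n)) → length (v ∷ xs) ≡ g → Unique (v ∷ xs)
    → All (λ x → ∃₂ λ y z → y ∈ v ∷ xs × z ∈ v ∷ xs × R x y × R x z × y ≢ z) (v ∷ xs)
    → All (Star R v) xs → Block g v
  mkBlock {v = v} xs len u two conn = record
    { members = v ∷ xs ; size = len ; unique = u ; v∈ = here refl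
    ; closed = λ x∈ r → closed (All.lookup two x∈) r
    ; connected = λ x∈ y∈ → Star-sym (All.lookup (ε⋆ ∷ conn) x∈) ◅◅ All.lookup (ε⋆ ∷ conn) y∈ }
    where
    closed : ∀ {x w} → (∃₂ λ y z → y ∈ v ∷ xs × z ∈ v ∷ xs × R x y × R x z × y ≢ z) → R x w → w ∈ v ∷ xs
    closed {w = w} (y , z , y∈ , z∈ , xy , xz , y≢z) xw with w ≟ y
    ... | yes refl = y∈
    ... | no w≢y with at-most-two xw xz xy w≢y (y≢z ∘ sym)
    ... | refl = z∈

  block₃ : ∀ {a b c} → R a b → R b c → R c a → Block 3 a
  block₃ {a} {b} {c} ab bc ca = mkBlock (b ∷ c ∷ []) refl
    ((R⇒≢ ab ∷ a≢c ∷ []) ∷ (R⇒≢ bc ∷ []) ∷ [] ∷ [])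
    ((b , c , i₁ , i₂ , ab , R-sym ca , R⇒≢ bc) ∷ (a , c , i₀ , i₂ , R-sym ab , bc , a≢c) ∷ (b , a , i₁ , i₀ , R-sym bc , ca , R⇒≢ ab ∘ sym) ∷ [])
    ((ab ◅ ε⋆) ∷ (ab ◅ bc ◅ ε⋆) ∷ [])
    where
    a≢c = R⇒≢ ca ∘ sym
    i₀ : a ∈ a ∷ b ∷ c ∷ []
    i₀ = here refl
    i₁ : b ∈ a ∷ b ∷ c ∷ []
    i₁ = there (here refl)
    i₂ : c ∈ a ∷ b ∷ c ∷ []
    i₂ = there (there (here refl))

  block₄ : ∀ {a b c d} → R a b → R b c → R c d → R d a → a ≢ c → b ≢ d → Block 4 a
  block₄ {a} {b} {c} {d} ab bc cd da a≢c b≢d = mkBlock (b ∷ c ∷ d ∷ []) refl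
    ((R⇒≢ ab ∷ a≢c ∷ R⇒≢ da ∘ sym ∷ []) ∷ (R⇒≢ bc ∷ b≢d ∷ []) ∷ (R⇒≢ cd ∷ []) ∷ [] ∷ [])
    ((b , d , i₁ , i₃ , ab , R-sym da , b≢d) ∷ (a , c , i₀ , i₂ , R-sym ab , bc , a≢c)
      ∷ (b , d , i₁ , i₃ , R-sym bc , cd , b≢d) ∷ (c , a , i₂ , i₀ , R-sym cd , da , a≢c ∘ sym) ∷ [])
    ((ab ◅ ε⋆) ∷ (ab ◅ bc ◅ ε⋆) ∷ (ab ◅ bc ◅ cd ◅ ε⋆) ∷ [])
    where
    i₀ : a ∈ a ∷ b ∷ c ∷ d ∷ []
    i₀ = here refl
    i₁ : b ∈ a ∷ b ∷ c ∷ d ∷ []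
    i₁ = there (here refl)
    i₂ : c ∈ a ∷ b ∷ c ∷ d ∷ []
    i₂ = there (there (here refl))
    i₃ : d ∈ a ∷ b ∷ c ∷ d ∷ []
    i₃ = there (there (there (here refl)))

  block₅ : ∀ {a b c d e} → R a b → R b c → R c d → R d e → R e a
    → a ≢ c → b ≢ d → c ≢ e → d ≢ a → e ≢ b → Block 5 a
  block₅ {a} {b} {c} {d} {e} ab bc cd de ea a≢c b≢d c≢e d≢a e≢b = mkBlock (b ∷ c ∷ d ∷ e ∷ []) refl
    ((R⇒≢ ab ∷ a≢c ∷ d≢a ∘ sym ∷ R⇒≢ ea ∘ sym ∷ []) ∷ (R⇒≢ bc ∷ b≢d ∷ e≢b ∘ sym ∷ []) ∷ (R⇒≢ cd ∷ c≢e ∷ []) ∷ (R⇒≢ de ∷ []) ∷ [] ∷ [])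
    ((b , e , i₁ , i₄ , ab , R-sym ea , e≢b ∘ sym) ∷ (a , c , i₀ , i₂ , R-sym ab , bc , a≢c)
      ∷ (b , d , i₁ , i₃ , R-sym bc , cd , b≢d) ∷ (c , e , i₂ , i₄ , R-sym cd , de , c≢e)
      ∷ (d , a , i₃ , i₀ , R-sym de , ea , d≢a) ∷ [])
    ((ab ◅ ε⋆) ∷ (ab ◅ bc ◅ ε⋆) ∷ (ab ◅ bc ◅ cd ◅ ε⋆) ∷ (ab ◅ bc ◅ cd ◅ de ◅ ε⋆) ∷ [])
    where
    i₀ : a ∈ a ∷ b ∷ c ∷ d ∷ e ∷ []
    i₀ = here refl
    i₁ : b ∈ a ∷ b ∷ c ∷ d ∷ e ∷ []
    i₁ = there (here refl)
    i₂ : c ∈ a ∷ b ∷ c ∷ d ∷ e ∷ []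
    i₂ = there (there (here refl))
    i₃ : d ∈ a ∷ b ∷ c ∷ d ∷ e ∷ []
    i₃ = there (there (there (here refl)))
    i₄ : e ∈ a ∷ b ∷ c ∷ d ∷ e ∷ []
    i₄ = there (there (there (there (here refl))))

-- The classification

module Mate {n : ℕ} (Γ : Graph n) (cubic : Cubic Γ) (g : ℕ) (κ : Fin n → Fin n → Bool)
  (κ-sym : ∀ s u → κ s u ≡ κ u s) (X-sym : Signature.X-Symmetric Γ cubic g κ)
  (bal : Signature.Balanced Γ cubic g κ 0 0 1) where

  open Cub Γ cubic
  open Corner κ
  open Signature Γ cubic g κ using (module Balanced)
  open Balanced bal
  private
    ! : ∀ {u v} → u ~ v → v ~ u
    ! = ~-sym

  abstract
    -- The neighbour along the edge on no girth cycle: both corners containing that edge are `0`.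
    mate : Fin n → Fin n
    mate v = proj₁ (star v)

    rung : ∀ v → v ~ mate v
    rung v = let _ , _ , _ , N , _ = star v in Nbrs.~p N

    corner₀ : ∀ {v u} → v ~ u → u ≢ mate v → X (mate v) v u ≡ 0
    corner₀ {v} {u} vu u≢ = let _ , _ , _ , N , pq , pr , _ = star v in go N pq pr u≢
      where
      go : ∀ {p q r} → Nbrs v p q r → X p v q ≡ 0 → X p v r ≡ 0 → u ≢ p → X p v u ≡ 0
      go N pq pr u≢ with only₂ N vu u≢
      ... | inj₁ refl = pq
      ... | inj₂ refl = pr

    corner₁ : ∀ {v u w} → v ~ u → v ~ w → u ≢ w → u ≢ mate v → w ≢ mate v → X u v w ≡ 1
    corner₁ {v} {u} {w} vu vw u≢w u≢ w≢ = let _ , _ , _ , N , _ , _ , qr = star v in go N qr u≢ w≢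
      where
      go : ∀ {p q r} → Nbrs v p q r → X q v r ≡ 1 → u ≢ p → w ≢ p → X u v w ≡ 1
      go N qr u≢ w≢ with only₂ N vu u≢ | only₂ N vw w≢
      ... | inj₁ refl | inj₁ refl = contradiction refl u≢w
      ... | inj₂ refl | inj₂ refl = contradiction refl u≢w
      ... | inj₁ refl | inj₂ refl = qr
      ... | inj₂ refl | inj₁ refl = trans (X-sym (! vu) vw u≢w) qr

    -- The edge counts `0` at `v`. If the mate of `mate v` were another vertex, it would count
    -- `0 + 1` at `mate v`.
    mate-involutive : ∀ v → mate (mate v) ≡ v
    mate-involutive v with mate (mate v) ≟ v
    ... | yes e = e
    ... | no ne with nbrs₁ (rung v) | nbrs₂ (! (rung v)) (rung (mate v)) (ne ∘ sym)
    ... | p , q , N | t , M = contradiction (trans (sym lhs) (trans (Regular.ε-sym Γ cubic g κ κ-sym N M) rhs)) λ ()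
      where
      module N = Nbrs N
      module M = Nbrs M
      lhs : X p v (mate v) + X q v (mate v) ≡ 0
      lhs = cong₂ _+_ (trans (X-sym (! N.~q) N.~p (N.p≢q ∘ sym)) (corner₀ N.~q (N.p≢q ∘ sym)))
                      (trans (X-sym (! N.~r) N.~p (N.p≢r ∘ sym)) (corner₀ N.~r (N.p≢r ∘ sym)))
      rhs : X (mate (mate v)) (mate v) v + X t (mate v) v ≡ 1
      rhs = cong₂ _+_ (corner₀ M.~p M.p≢q) (corner₁ M.~r M.~p (M.p≢r ∘ sym) (M.q≢r ∘ sym) M.p≢q)

  open Matching Γ cubic mate rung mate-involutive public
  open Truncation Γ cubic mate rung mate-involutive public

  abstract
    -- Corners containing a matching edge count `0`, so girth cycles run entirely inside `R`.
    corner⇒R : ∀ {u v w} → u ~ v → v ~ w → u ≢ w → 1 ≤ X u v w → R v w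
    corner⇒R {u} {v} uv vw u≢w h = vw , λ { refl → contradiction
      (subst (1 ≤_) (trans (X-sym uv vw u≢w) (corner₀ (! uv) u≢w)) h) λ () }

    around : ∀ v → ∃₂ λ q r → R v q × v ~ r × q ≢ r × 1 ≤ X q v r
    around v with nbrs₁ (rung v)
    ... | q , r , nbrs _ vq vr m≢q m≢r q≢r _ = q , r , (vq , m≢q ∘ sym) , vr , q≢r
          , subst (1 ≤_) (sym (corner₁ vq vr q≢r (m≢q ∘ sym) (m≢r ∘ sym))) (s≤s z≤n)

-- The ten triples with `x ≤ y ≤ z ≤ 2`; those with `x = 0` and `z = 2` are treated alike for every
-- `y`.
data Pattern : ℕ → ℕ → ℕ → Set where
  p000 : Pattern 0 0 0
  p001 : Pattern 0 0 1
  p011 : Pattern 0 1 1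
  p111 : Pattern 1 1 1
  p0y2 : ∀ y → Pattern 0 y 2
  p112 : Pattern 1 1 2
  p122 : Pattern 1 2 2
  p222 : Pattern 2 2 2

pattern-of : ∀ {x y z} → x ≤ y → y ≤ z → z ≤ 2 → Pattern x y z
pattern-of z≤n z≤n z≤n = p000
pattern-of z≤n z≤n (s≤s z≤n) = p001
pattern-of z≤n z≤n (s≤s (s≤s z≤n)) = p0y2 0
pattern-of z≤n (s≤s z≤n) (s≤s z≤n) = p011
pattern-of z≤n (s≤s z≤n) (s≤s (s≤s z≤n)) = p0y2 1
pattern-of z≤n (s≤s (s≤s z≤n)) (s≤s (s≤s z≤n)) = p0y2 2
pattern-of (s≤s z≤n) (s≤s z≤n) (s≤s z≤n) = p111
pattern-of (s≤s z≤n) (s≤s z≤n) (s≤s (s≤s z≤n)) = p112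
pattern-of (s≤s z≤n) (s≤s (s≤s z≤n)) (s≤s (s≤s z≤n)) = p122
pattern-of (s≤s (s≤s z≤n)) (s≤s (s≤s z≤n)) (s≤s (s≤s z≤n)) = p222

module _ {n : ℕ} (Γ : Graph n) where

  IsTruncation : ℕ → Set₁
  IsTruncation g = Σ MultiGraph (λ Λ → Σ (Arc Λ → Arc Λ → Set) (λ R →
    Regular Λ g × IsDihedralScheme Λ R × IsoTo Γ (Arc Λ) (TrAdj Λ R)))

  LadderCase : ℕ → ℕ → ℕ → Set
  LadderCase a b c =
    Σ ℕ (λ m → 3 ≤ m × (IsoTo Γ (Fin m × Bool) (PrismAdj m) ⊎ IsoTo Γ (Fin (2 * m)) (MobiusAdj m)))
    × (IsoTo Γ (Bool × Fin 3) K33Adj → a ≡ 4 × b ≡ 4 × c ≡ 4)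
    × (IsoTo Γ Q3 Q3Adj → a ≡ 2 × b ≡ 2 × c ≡ 2)
    × (¬ IsoTo Γ (Bool × Fin 3) K33Adj → ¬ IsoTo Γ Q3 Q3Adj → a ≡ 1 × b ≡ 1 × c ≡ 2)

module Classification {n : ℕ} (Γ : Graph n) (connected : Connected Γ) (cubic : Cubic Γ) where
  open Cub Γ cubic
  open Girths Γ cubic
  private
    ! : ∀ {u v} → u ~ v → v ~ u
    ! = ~-sym

  module Three where
    open Corner κ₃
    open GirthThree Γ cubic connected

    triangle≥1 : ∀ {a b c} → b ~ c → c ~ a → a ≢ b → 1 ≤ X a b c
    triangle≥1 bc ca a≢b = X≥1 (! bc) ca a≢b (fromWitness refl)

    truncated : S₃.Balanced 0 0 1 → IsTruncation Γ 3
    truncated bal = M.truncated block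
      where
      module M = Mate Γ cubic 3 κ₃ κ₃-sym X₃-sym bal
      tri : ∀ {a b c} → a ~ b → b ~ c → c ~ a → M.R b c
      tri ab bc ca = M.corner⇒R ab bc (~⇒≢ (! ca)) (triangle≥1 bc ca (~⇒≢ ab))
      block : ∀ v → M.Block 3 v
      block v with M.around v
      ... | q , r , vq , vr , q≢r , h = let qr = corner₃ (! vr) h in
            M.block₃ vq (tri (proj₁ vq) qr (! vr)) (tri qr (! vr) (proj₁ vq))

    classify : ∀ {a b c} → Fin n → IsGirth Γ 3 → GirthRegularWith Γ 3 a b c
      → ((a ≡ 0 × b ≡ 1 × c ≡ 1) × IsTruncation Γ 3) ⊎ (IsoTo Γ (Fin 4) K4Adj × (a ≡ 2 × b ≡ 2 × c ≡ 2))
    classify {a} {b} {c} v girth reg with S₃.balanced paths₃ X₃-sym v reg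
    ... | x , y , z , bal , refl , refl , refl = go bal (pattern-of (S₃.Balanced.x≤y bal) (S₃.Balanced.y≤z bal) (ℕₚ.≤-trans z≤1 (s≤s z≤n))) z≤1
      where
      z≤1 : z ≤ 1
      z≤1 = let _ , _ , _ , N , _ , _ , qr = S₃.Balanced.star bal v in subst (_≤ 1) qr (X₃≤1 (! (Nbrs.~r N)))
      positive : ∃ (λ xs → length xs ≡ 3 × T (isCycle Γ xs)) → ¬ S₃.Balanced 0 0 0
      positive (p ∷ q ∷ r ∷ [] , _ , cyc) bal with cycle₃⁻ {p} {q} {r} cyc
      ... | pq , qr , rp = contradiction (subst (1 ≤_) (Regular.all-corners Γ cubic 3 κ₃ X₃-sym bal pq qr (~⇒≢ (! rp)))
              (triangle≥1 qr rp (~⇒≢ pq))) λ ()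
      go : ∀ {x y z} → S₃.Balanced x y z → Pattern x y z → z ≤ 1
        → ((x + y ≡ 0 × x + z ≡ 1 × y + z ≡ 1) × IsTruncation Γ 3)
          ⊎ (IsoTo Γ (Fin 4) K4Adj × (x + y ≡ 2 × x + z ≡ 2 × y + z ≡ 2))
      go bal p000 _ = ⊥-elim (positive (proj₁ girth) bal)
      go bal p001 _ = inj₁ ((refl , refl , refl) , truncated bal)
      go bal p011 _ = ⊥-elim (no-011 v bal)
      go bal p111 _ = inj₂ (111⇒K₄ v bal , refl , refl , refl)
      go bal (p0y2 _) (s≤s ())
      go bal p112 (s≤s ())
      go bal p122 (s≤s ())
      go bal p222 (s≤s ())

  module Four (no₃ : TriangleFree) where
    open Corner κ₄
    open GirthFour Γ cubic connected no₃

    square≥1 : ∀ {a b c d} → b ~ c → c ~ d → d ~ a → b ≢ d → 1 ≤ X a b c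
    square≥1 bc cd da b≢d = X≥1 (! bc) cd (b≢d ∘ sym) da

    truncated : S₄.Balanced 0 0 1 → IsTruncation Γ 4
    truncated bal = M.truncated block
      where
      module M = Mate Γ cubic 4 κ₄ (Graph.sym Γ) X₄-sym bal
      sq : ∀ {a b c d} → a ~ b → b ~ c → c ~ d → d ~ a → a ≢ c → b ≢ d → M.R b c
      sq ab bc cd da a≢c b≢d = M.corner⇒R ab bc a≢c (square≥1 bc cd da b≢d)
      block : ∀ v → M.Block 4 v
      block v with M.around v
      ... | q , r , (vq , _) , vr , q≢r , h with X≥1⇒ (! vr) h
      ... | x , rx , x≢v , xq = M.block₄ (sq (! vq) vr rx xq q≢r v≢x) (sq vr rx xq (! vq) v≢x r≢q)
                (sq rx xq (! vq) vr r≢q (x≢v)) (sq xq (! vq) vr rx x≢v q≢r) v≢x r≢q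
        where
        v≢x = x≢v ∘ sym
        r≢q = q≢r ∘ sym

    toK₃₃ : IsoTo Γ (Fin 6) (Steps K₃₃.nb) → IsoTo Γ (Bool × Fin 3) K33Adj
    toK₃₃ = IsoTo-∘ Γ (Steps K₃₃.nb) K33Adj K₃₃.to K₃₃.from K₃₃.from∘to K₃₃.to∘from K₃₃.adj⇔

    möbius₃ : IsoTo Γ (Fin 6) (Steps K₃₃.nb) → IsoTo Γ (Fin 6) (MobiusAdj 3)
    möbius₃ = IsoTo-∘ Γ (Steps K₃₃.nb) (MobiusAdj 3) id id (λ _ → refl) (λ _ → refl) K₃₃.adj⇔Möbius

    toQ₃ : IsoTo Γ (Fin 8) (Steps Cube.nb) → IsoTo Γ Q3 Q3Adj
    toQ₃ = IsoTo-∘ Γ (Steps Cube.nb) Q3Adj Cube.to Cube.from Cube.from∘to Cube.to∘from Cube.adj⇔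

    prism₄ : IsoTo Γ (Fin 8) (Steps Cube.nb) → IsoTo Γ (Fin 4 × Bool) (PrismAdj 4)
    prism₄ = IsoTo-∘ Γ (Steps Cube.nb) (PrismAdj 4) Cube.toPrism Cube.fromPrism Cube.fromPrism∘to Cube.toPrism∘from Cube.adj⇔Prism

    toK₃₃⁻¹ : IsoTo Γ (Bool × Fin 3) K33Adj → IsoTo Γ (Fin 6) (Steps K₃₃.nb)
    toK₃₃⁻¹ = IsoTo-∘ Γ K33Adj (Steps K₃₃.nb) K₃₃.from K₃₃.to K₃₃.to∘from K₃₃.from∘to
      (λ p q → subst₂ (λ p′ q′ → K33Adj p′ q′ ⇔ Steps K₃₃.nb (K₃₃.from p) (K₃₃.from q)) (K₃₃.to∘from p) (K₃₃.to∘from q)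
        (⇔-sym (K₃₃.adj⇔ (K₃₃.from p) (K₃₃.from q))))

    toQ₃⁻¹ : IsoTo Γ Q3 Q3Adj → IsoTo Γ (Fin 8) (Steps Cube.nb)
    toQ₃⁻¹ = IsoTo-∘ Γ Q3Adj (Steps Cube.nb) Cube.from Cube.to Cube.to∘from Cube.from∘to
      (λ p q → subst₂ (λ p′ q′ → Q3Adj p′ q′ ⇔ Steps Cube.nb (Cube.from p) (Cube.from q)) (Cube.to∘from p) (Cube.to∘from q)
        (⇔-sym (Cube.adj⇔ (Cube.from p) (Cube.from q))))

    -- `xy2⇒K₃₃` yields `x ≡ 2`, and then `y` is squeezed to `2`; this also disposes of the triples
    -- with `z = 2` and smaller `x`.
    K₃₃-case : ∀ {x y} → Fin n → S₄.Balanced x y 2 → LadderCase Γ (x + y) (x + 2) (y + 2)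
    K₃₃-case {x} {y} v bal = go (xy2⇒K₃₃ bal v) (S₄.Balanced.x≤y bal) (S₄.Balanced.y≤z bal)
      where
      go : ∀ {x} → IsoTo Γ (Fin 6) (Steps K₃₃.nb) × x ≡ 2 → x ≤ y → y ≤ 2 → LadderCase Γ (x + y) (x + 2) (y + 2)
      go (i , refl) (s≤s (s≤s z≤n)) (s≤s (s≤s z≤n)) = (3 , s≤s (s≤s (s≤s z≤n)) , inj₂ (möbius₃ i)) , (λ _ → refl , refl , refl)
        , (λ q → ⊥-elim (¬K₃₃×Q₃ Γ (toK₃₃ i) q)) , λ ¬k _ → contradiction (toK₃₃ i) ¬k

    classify : ∀ {a b c} → Fin n → IsGirth Γ 4 → GirthRegularWith Γ 4 a b c
      → ((a ≡ 0 × b ≡ 1 × c ≡ 1) × IsTruncation Γ 4) ⊎ LadderCase Γ a b c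
    classify {a} {b} {c} v girth reg with S₄.balanced paths₄ X₄-sym v reg
    ... | x , y , z , bal , refl , refl , refl = go bal (pattern-of (S₄.Balanced.x≤y bal) (S₄.Balanced.y≤z bal) z≤2)
      where
      z≤2 : z ≤ 2
      z≤2 = let _ , _ , _ , N , _ , _ , qr = S₄.Balanced.star bal v in subst (_≤ 2) qr (X≤2 (! (Nbrs.~r N)))
      positive : ∃ (λ xs → length xs ≡ 4 × T (isCycle Γ xs)) → ¬ S₄.Balanced 0 0 0
      positive (p ∷ q ∷ r ∷ s ∷ [] , _ , cyc) bal with cycle₄⁻ {p} {q} {r} {s} cyc
      ... | pq , qr , rs , sp , p≢r , q≢s = contradiction (subst (1 ≤_) (Regular.all-corners Γ cubic 4 κ₄ X₄-sym bal pq qr p≢r)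
              (square≥1 qr rs sp q≢s)) λ ()
      go : ∀ {x y z} → S₄.Balanced x y z → Pattern x y z
        → ((x + y ≡ 0 × x + z ≡ 1 × y + z ≡ 1) × IsTruncation Γ 4) ⊎ LadderCase Γ (x + y) (x + z) (y + z)
      go bal p000 = ⊥-elim (positive (proj₁ girth) bal)
      go bal p001 = inj₁ ((refl , refl , refl) , truncated bal)
      go bal p011 = inj₂ (L.011⇒ladder v
          -- In `K₃,₃` and in the cube every 2-path lies on a 4-cycle, whereas here the two non-rung
          -- edges at a vertex do not.
          , (λ k → ⊥-elim (L.no-squares v (square-completion Γ K₃₃.squares (toK₃₃⁻¹ k))))
          , (λ q → ⊥-elim (L.no-squares v (square-completion Γ Cube.squares (toQ₃⁻¹ q))))
          , λ _ _ → refl , refl , refl)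
        where module L = Ladder Γ cubic connected no₃ bal
      go bal p111 = let i = 111⇒cube v bal in inj₂ ((4 , s≤s (s≤s (s≤s z≤n)) , inj₁ (prism₄ i))
          , (λ k → ⊥-elim (¬K₃₃×Q₃ Γ k (toQ₃ i))) , (λ _ → refl , refl , refl) , λ _ ¬q → contradiction (toQ₃ i) ¬q)
      go bal (p0y2 y) = inj₂ (K₃₃-case v bal)
      go bal p112 = inj₂ (K₃₃-case v bal)
      go bal p122 = inj₂ (K₃₃-case v bal)
      go bal p222 = inj₂ (K₃₃-case v bal)

  module Five (no₃ : TriangleFree) (no₄ : SquareFree) where
    open Corner κ₅
    open GirthFive Γ cubic no₃ no₄
    open GirthFive-Iso Γ cubic connected no₃ no₄

    Xsym : S₅.X-Symmetric
    Xsym = X₅-sym no₃ no₄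

    -- If the two vertices coincided, three edges of the closed walk of length five would form a
    -- triangle.
    chord : ∀ {a b c d e} → c ~ d → d ~ e → e ~ a → a ~ b → b ≢ d
    chord cd de ea ab refl = no₃ ab de ea

    pentagon≥1 : ∀ {a b c d e} → a ~ b → b ~ c → c ~ d → d ~ e → e ~ a → 1 ≤ X a b c
    pentagon≥1 ab bc cd de ea = X≥1 (! bc) cd (chord cd de ea ab ∘ sym) (κ₅⁺ de ea)

    truncated : S₅.Balanced 0 0 1 → IsTruncation Γ 5
    truncated bal = M.truncated block
      where
      module M = Mate Γ cubic 5 κ₅ κ₅-sym Xsym bal
      pent : ∀ {a b c d e} → a ~ b → b ~ c → c ~ d → d ~ e → e ~ a → M.R b c
      pent ab bc cd de ea = M.corner⇒R ab bc (chord bc cd de ea) (pentagon≥1 ab bc cd de ea)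
      block : ∀ v → M.Block 5 v
      block v with M.around v
      ... | q , r , (vq , _) , vr , _ , h with X≥1⇒ (! vr) h
      ... | x , rx , _ , k with κ₅⁻ k
      ... | y , xy , yq = let qv = ! vq in
            M.block₅ (pent qv vr rx xy yq) (pent vr rx xy yq qv) (pent rx xy yq qv vr) (pent xy yq qv vr rx) (pent yq qv vr rx xy)
              (chord rx xy yq qv) (chord xy yq qv vr) (chord yq qv vr rx) (chord qv vr rx xy) (chord vr rx xy yq)

    classify : ∀ {a b c} → Fin n → IsGirth Γ 5 → GirthRegularWith Γ 5 a b c
      → ((a ≡ 0 × b ≡ 1 × c ≡ 1) × IsTruncation Γ 5)
        ⊎ ((IsoTo Γ Pet PetAdj × (a ≡ 4 × b ≡ 4 × c ≡ 4)) ⊎ (IsoTo Γ (Fin 10 × Bool) DodAdj × (a ≡ 2 × b ≡ 2 × c ≡ 2)))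
    classify {a} {b} {c} v girth reg with S₅.balanced (paths₅ no₃ no₄) Xsym v reg
    ... | x , y , z , bal , refl , refl , refl = go bal (pattern-of (S₅.Balanced.x≤y bal) (S₅.Balanced.y≤z bal) z≤2)
      where
      z≤2 : z ≤ 2
      z≤2 = let _ , _ , _ , N , _ , _ , qr = S₅.Balanced.star bal v in subst (_≤ 2) qr (X≤2 (! (Nbrs.~r N)))
      positive : ∃ (λ xs → length xs ≡ 5 × T (isCycle Γ xs)) → ¬ S₅.Balanced 0 0 0
      positive (p ∷ q ∷ r ∷ s ∷ t ∷ [] , _ , cyc) bal with cycle₅⁻ {p} {q} {r} {s} {t} cyc
      ... | pq , qr , rs , st , tp , p≢r , _ = contradiction (subst (1 ≤_) (Regular.all-corners Γ cubic 5 κ₅ Xsym bal pq qr p≢r)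
              (pentagon≥1 pq qr rs st tp)) λ ()
      go : ∀ {x y z} → S₅.Balanced x y z → Pattern x y z
        → ((x + y ≡ 0 × x + z ≡ 1 × y + z ≡ 1) × IsTruncation Γ 5)
          ⊎ ((IsoTo Γ Pet PetAdj × (x + y ≡ 4 × x + z ≡ 4 × y + z ≡ 4))
          ⊎ (IsoTo Γ (Fin 10 × Bool) DodAdj × (x + y ≡ 2 × x + z ≡ 2 × y + z ≡ 2)))
      go bal p000 = ⊥-elim (positive (proj₁ girth) bal)
      go bal p001 = inj₁ ((refl , refl , refl) , truncated bal)
      go bal p011 = ⊥-elim (no-011 v bal)
      go bal p111 = inj₂ (inj₂ (111⇒dodecahedron v bal , refl , refl , refl))
      go bal (p0y2 y) = ⊥-elim (no-0y2 v bal)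
      go bal p112 = ⊥-elim (GirthFive-112.absurd Γ cubic no₃ no₄ bal v)
      go bal p122 = ⊥-elim (GirthFive-122.absurd Γ cubic no₃ no₄ bal v)
      go bal p222 = inj₂ (inj₁ (222⇒petersen v bal , refl , refl , refl))

theorem1p5 : {n : ℕ} (Γ : Graph n) (g a b c : ℕ)
    → Connected Γ → Cubic Γ → IsGirth Γ g → g ≤ 5 → GirthRegularWith Γ g a b c
    → ((a ≡ 0 × b ≡ 1 × c ≡ 1)
    × Σ MultiGraph (λ Λ → Σ (Arc Λ → Arc Λ → Set) (λ R →
    Regular Λ g × IsDihedralScheme Λ R × IsoTo Γ (Arc Λ) (TrAdj Λ R))))
    ⊎ (g ≡ 3 × IsoTo Γ (Fin 4) K4Adj × (a ≡ 2 × b ≡ 2 × c ≡ 2))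
    ⊎ (g ≡ 4
    × Σ ℕ (λ m → 3 ≤ m × (IsoTo Γ (Fin m × Bool) (PrismAdj m) ⊎ IsoTo Γ (Fin (2 * m)) (MobiusAdj m)))
    × (IsoTo Γ (Bool × Fin 3) K33Adj → a ≡ 4 × b ≡ 4 × c ≡ 4)
    × (IsoTo Γ Q3 Q3Adj → a ≡ 2 × b ≡ 2 × c ≡ 2)
    × (¬ IsoTo Γ (Bool × Fin 3) K33Adj → ¬ IsoTo Γ Q3 Q3Adj → a ≡ 1 × b ≡ 1 × c ≡ 2))
    ⊎ (g ≡ 5
    × ((IsoTo Γ Pet PetAdj × (a ≡ 4 × b ≡ 4 × c ≡ 4))
    ⊎ (IsoTo Γ (Fin 10 × Bool) DodAdj × (a ≡ 2 × b ≡ 2 × c ≡ 2))))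
theorem1p5 Γ 0 a b c _ _ (([] , _ , ()) , _) _ _
theorem1p5 Γ 1 a b c _ _ ((_ ∷ [] , _ , ()) , _) _ _
theorem1p5 Γ 2 a b c _ _ ((_ ∷ _ ∷ [] , _ , ()) , _) _ _
theorem1p5 Γ 3 a b c connected cubic girth@((v ∷ _ , _) , _) _ reg =
  [ inj₁ , (λ k → inj₂ (inj₁ (refl , k))) ]′ (Classification.Three.classify Γ connected cubic v girth reg)
theorem1p5 Γ 4 a b c connected cubic girth@((v ∷ _ , _) , _) _ reg =
  [ inj₁ , (λ k → inj₂ (inj₂ (inj₁ (refl , k)))) ]′
    (Classification.Four.classify Γ connected cubic (Girths.triangleFree Γ cubic ℕₚ.≤-refl girth) v girth reg)
theorem1p5 Γ 5 a b c connected cubic girth@((v ∷ _ , _) , _) _ reg =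
  [ inj₁ , (λ k → inj₂ (inj₂ (inj₂ (refl , k)))) ]′
    (Classification.Five.classify Γ connected cubic (Girths.triangleFree Γ cubic (ℕₚ.n≤1+n 4) girth)
      (Girths.squareFree Γ cubic ℕₚ.≤-refl girth) v girth reg)
theorem1p5 Γ (suc (suc (suc (suc (suc (suc _)))))) a b c _ _ _ (s≤s (s≤s (s≤s (s≤s (s≤s ()))))) _
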